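{- For all integers $\ell, d \geq 1$, $$f^{d}(\ell) = \Theta^{d}(\ell).$$
   Context: For an integer $\ell \geq 1$, an $\ell$-uniform hypergraph ($\ell$-graph) $H=(V,E)$ consists of a finite vertex set $V$ and a family $E\subseteq \binom{V}{\ell}$ of $\ell$-element subsets of $V$, called edges. A fractional matching in $H$ is a function $w : E \to [0,1]$ such that $\sum_{e \ni v} w(e) \leq 1$ for every $v \in V$; its size is $\sum_{e \in E} w(e)$. For integers $\ell, m\ge 1$ and a real number $0 \leq s \leq m/\ell$, $f_0^{s}(\ell,m)$ denotes the smallest integer $M$ such that every $\ell$-graph $H$ on $m$ vertices with at least $M$ edges (i.e. with minimum $0$-degree at least $M$, the $0$-degree being the total number of edges) has a fractional matching of size $s$. For integers $\ell, d \geq 1$, define $$f^{d}(\ell) := \limsup_{m \to \infty} \frac{f_0^{(m+d)/(\ell+d)}(\ell,m)}{\binom{m}{\ell}}$$ (note that $(m+d)/(\ell+d)\le m/\ell$ whenever $m\ge \ell$). For an integer $\ell\ge 1$ and $d > 0$, define $$\Theta^{d}(\ell) := \sup \Pr[X_1 + \dots + X_\ell \geq \ell + d],$$ where the supremum is over all collections of non-negative i.i.d. random variables $X_1,\dots,X_\ell$ with mean $1$. -}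

module Defs where

open import Algebra.Bundles using (CommutativeRing)
import Algebra.Definitions.RawMonoid as RawMonoidDefinitions
open import Data.Bool.Base using (if_then_else_)
open import Data.Fin.Base using (Fin; toℕ)
open import Data.Fin.Subset using (Subset; ∣_∣)
open import Data.Fin.Subset.Properties using (_∈?_)
open import Data.Nat.Base as ℕ using (ℕ)
open import Data.Nat.Combinatorics using (_C_)
open import Data.Product.Base using (Σ-syntax; ∃-syntax; _×_)
open import Function.Base using (flip)
open import Function.Definitions using (Injective)
open import Level using (Level; 0ℓ) renaming (suc to lsuc)
open import Relation.Binary.Core using (Rel)
import Relation.Binary.Construct.NonStrictToStrict as NonStrictToStrict
open import Relation.Binary.PropositionalEquality.Core using (_≡_; _≢_)
open import Relation.Binary.Structures using (IsTotalOrder)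
open import Relation.Nullary.Decidable.Core using (does)
open import Relation.Nullary.Negation.Core using (¬_)
open import Relation.Unary using (Pred; U; ∁; ⋃; ⋂; _⊆_; _≐_; _⊥_; _⊢_; Satisfiable)

module Bounds {A : Set} (_≤_ : Rel A 0ℓ) where

  IsUpperBound : {a : Level} → Pred A a → Pred A a
  IsUpperBound S x = ∀ {y} → S y → y ≤ x

  IsSupremum : {a : Level} → Pred A a → Pred A a
  IsSupremum S x = IsUpperBound S x × (∀ {y} → IsUpperBound S y → x ≤ y)

-- The real numbers, given by their axioms (which determine them up to
-- isomorphism), with a setoid equality.
record CompleteOrderedField : Set₁ where
  infix  4 _≤_
  infix  8 _⁻¹
  field
    commutativeRing : CommutativeRing 0ℓ 0ℓ

  open CommutativeRing commutativeRing public renaming (Carrier to ℝ)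

  field
    _≤_          : Rel ℝ 0ℓ
    isTotalOrder : IsTotalOrder _≈_ _≤_
    +-monoˡ-≤    : ∀ z {x y} → x ≤ y → x + z ≤ y + z
    *-nonneg     : ∀ {x y} → 0# ≤ x → 0# ≤ y → 0# ≤ x * y
    0≉1          : ¬ (0# ≈ 1#)
    -- The value of 0# ⁻¹ is unspecified.
    _⁻¹          : ℝ → ℝ
    *-inverseʳ   : ∀ {x} → ¬ (x ≈ 0#) → x * x ⁻¹ ≈ 1#
    supremum     : (S : Pred ℝ 0ℓ) → Satisfiable S →
                   Satisfiable (Bounds.IsUpperBound _≤_ S) →
                   Satisfiable (Bounds.IsSupremum _≤_ S)

module Reals (R : CompleteOrderedField) where

  open CompleteOrderedField R public
  open NonStrictToStrict _≈_ _≤_ public using (_<_)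
  open Bounds _≤_ public
  open RawMonoidDefinitions +-rawMonoid public using (sum)
  open RawMonoidDefinitions *-rawMonoid public using () renaming (sum to product)

  IsInfimum : {a : Level} → Pred ℝ a → Pred ℝ a
  IsInfimum = Bounds.IsSupremum (flip _≤_)

  infixl 7 _/_
  _/_ : ℝ → ℝ → ℝ
  x / y = x * y ⁻¹

  fromℕ : ℕ → ℝ
  fromℕ n = RawMonoidDefinitions._×_ +-rawMonoid n 1#

  -- lim sup a = inf_n sup_{m ≥ n} a_m, all suprema being finite.
  IsLimSup : (ℕ → ℝ) → Pred ℝ 0ℓ
  IsLimSup a x =
    Σ[ s ∈ (ℕ → ℝ) ]
      (∀ n → IsSupremum (λ y → ∃[ m ] (n ℕ.≤ m × y ≈ a m)) (s n)) ×
      IsInfimum (λ y → ∃[ n ] y ≈ s n) x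

-- The family of edges is given by an injective enumeration.
record Hypergraph (ℓ m : ℕ) : Set where
  field
    size           : ℕ
    edge           : Fin size → Subset m
    edge-injective : Injective _≡_ _≡_ edge
    uniform        : ∀ i → ∣ edge i ∣ ≡ ℓ

module FractionalMatchings (R : CompleteOrderedField) where

  open Reals R

  record FractionalMatching {ℓ m : ℕ} (H : Hypergraph ℓ m) : Set where
    open Hypergraph H
    field
      weight   : Fin size → ℝ
      weight≥0 : ∀ i → 0# ≤ weight i
      weight≤1 : ∀ i → weight i ≤ 1#
      load≤1   : ∀ v → sum (λ i → if does (v ∈? edge i) then weight i else 0#) ≤ 1#

    total : ℝ
    total = sum weight

  HasMatchingOfSize : {ℓ m : ℕ} → Hypergraph ℓ m → ℝ → Set
  HasMatchingOfSize H s = Σ[ w ∈ FractionalMatching H ] FractionalMatching.total w ≈ s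

  Forces : (s : ℝ) (ℓ m M : ℕ) → Set
  Forces s ℓ m M = (H : Hypergraph ℓ m) → M ℕ.≤ Hypergraph.size H → HasMatchingOfSize H s

  -- The graph of f₀: "f₀ˢ(ℓ,m) = M".  For s > 0, the only case used below,
  -- the minimum over integers is a minimum over ℕ, since the edgeless
  -- hypergraph has no fractional matching of size s.
  Isf₀ : (s : ℝ) (ℓ m M : ℕ) → Set
  Isf₀ s ℓ m M = Forces s ℓ m M × (∀ M′ → Forces s ℓ m M′ → M ℕ.≤ M′)

  -- "fᵈ(ℓ) = x".  f₀ is only defined for (m + d) / (ℓ + d) ≤ m / ℓ, i.e. m ≥ ℓ
  -- (and for m < ℓ the binomial coefficient vanishes); the finitely many
  -- remaining values of g are arbitrary and do not affect the lim sup.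
  Isf : (ℓ d : ℕ) → Pred ℝ 0ℓ
  Isf ℓ d x =
    Σ[ g ∈ (ℕ → ℕ) ]
      (∀ m → ℓ ℕ.≤ m → Isf₀ (fromℕ (m ℕ.+ d) / fromℕ (ℓ ℕ.+ d)) ℓ m (g m)) ×
      IsLimSup (λ m → fromℕ (g m) / fromℕ (m C ℓ)) x

record IsSigmaAlgebra {Ω : Set} (𝓕 : Pred (Pred Ω 0ℓ) (lsuc 0ℓ)) : Set₁ where
  field
    resp  : ∀ {A B} → A ≐ B → 𝓕 A → 𝓕 B
    whole : 𝓕 U
    compl : ∀ {A} → 𝓕 A → 𝓕 (∁ A)
    union : ∀ {A : ℕ → Pred Ω 0ℓ} → (∀ n → 𝓕 (A n)) → 𝓕 (⋃ ℕ A)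

module Probability (R : CompleteOrderedField) where

  open Reals R

  IsOpen : Pred (Pred ℝ 0ℓ) 0ℓ
  IsOpen B = ∀ x → B x → ∃[ a ] ∃[ b ] (a < x × x < b × (∀ y → a < y → y < b → B y))

  data Borel : Pred (Pred ℝ 0ℓ) (lsuc 0ℓ) where
    opens : ∀ {B} → IsOpen B → Borel B
    resp  : ∀ {B C} → B ≐ C → Borel B → Borel C
    compl : ∀ {B} → Borel B → Borel (∁ B)
    union : ∀ {B : ℕ → Pred ℝ 0ℓ} → (∀ n → Borel (B n)) → Borel (⋃ ℕ B)

  -- Pr is a function on all subsets, but only its values on events matter:
  -- nothing is assumed about the others.
  record ProbabilitySpace : Set₂ where
    field
      Ω              : Set
      Event          : Pred (Pred Ω 0ℓ) (lsuc 0ℓ)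
      isSigmaAlgebra : IsSigmaAlgebra Event
      Pr             : Pred Ω 0ℓ → ℝ
      Pr-cong        : ∀ {A B} → Event A → Event B → A ≐ B → Pr A ≈ Pr B
      Pr-nonneg      : ∀ {A} → Event A → 0# ≤ Pr A
      Pr-whole       : Pr U ≈ 1#
      -- As the terms are non-negative, the sum of the series is the supremum
      -- of its partial sums.
      Pr-union       : ∀ {A : ℕ → Pred Ω 0ℓ} → (∀ n → Event (A n)) →
                       (∀ {i j} → i ≢ j → A i ⊥ A j) →
                       IsSupremum (λ y → ∃[ n ] y ≈ sum {n} (λ i → Pr (A (toℕ i))))
                                  (Pr (⋃ ℕ A))

  module _ (P : ProbabilitySpace) where

    open ProbabilitySpace P

    IsRandomVariable : (Ω → ℝ) → Set₁
    IsRandomVariable X = ∀ {B} → Borel B → Event (X ⊢ B)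

    IdenticallyDistributed : {n : ℕ} → (Fin n → Ω → ℝ) → Set₁
    IdenticallyDistributed X = ∀ i j {B} → Borel B → Pr (X i ⊢ B) ≈ Pr (X j ⊢ B)

    -- Taking some of the B i to be all of ℝ gives the product rule for
    -- subfamilies.
    Independent : {n : ℕ} → (Fin n → Ω → ℝ) → Set₁
    Independent {n} X = {B : Fin n → Pred ℝ 0ℓ} → (∀ i → Borel (B i)) →
      Pr (⋂ (Fin n) (λ i → X i ⊢ B i)) ≈ product (λ i → Pr (X i ⊢ B i))

    -- A non-negative simple function: a finite measurable partition of Ω
    -- together with the value taken on each cell.
    record SimpleFunction : Set₁ where
      field
        count          : ℕ
        cell           : Fin count → Pred Ω 0ℓ
        cell-event     : ∀ i → Event (cell i)
        cell-disjoint  : ∀ {i j} → i ≢ j → cell i ⊥ cell j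
        cell-exhaust   : ∀ ω → ∃[ i ] cell i ω
        value          : Fin count → ℝ
        value-nonneg   : ∀ i → 0# ≤ value i

      integral : ℝ
      integral = sum (λ i → value i * Pr (cell i))

      IsBelow : (Ω → ℝ) → Set
      IsBelow X = ∀ i → cell i ⊆ (λ ω → value i ≤ X ω)

    -- The Lebesgue integral of a non-negative random variable X is finite and
    -- equal to x.
    HasMean : (Ω → ℝ) → ℝ → Set₁
    HasMean X = IsSupremum
      (λ y → Σ[ φ ∈ SimpleFunction ] (SimpleFunction.IsBelow φ X × y ≈ SimpleFunction.integral φ))

  record NonNegativeIID (n : ℕ) : Set₂ where
    field
      space                  : ProbabilitySpace
    open ProbabilitySpace space public
    field
      X                      : Fin n → Ω → ℝ
      isRandomVariable       : ∀ i → IsRandomVariable space (X i)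
      nonneg                 : ∀ i ω → 0# ≤ X i ω
      identicallyDistributed : IdenticallyDistributed space X
      independent            : Independent space X
      mean                   : ∀ i → HasMean space (X i) 1#

    tail : ℝ → ℝ
    tail t = Pr (λ ω → t ≤ sum (λ i → X i ω))

  -- "Θᵈ(ℓ) = x"
  IsΘ : (ℓ : ℕ) (d : ℝ) → Pred ℝ (lsuc (lsuc 0ℓ))
  IsΘ ℓ d = IsSupremum
    (λ p → Σ[ 𝒳 ∈ NonNegativeIID ℓ ] p ≈ NonNegativeIID.tail 𝒳 (fromℕ ℓ + d))

-- By linear programming duality, a hypergraph has no fractional matching of size s
-- exactly if it has a fractional vertex cover of total weight less than s.  With
-- s = (m + d) / (ℓ + d), multiply the cover by ℓ + d: then the total is less than
-- m + d, and every edge has weight at least ℓ + d.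
--
-- f ≤ Θ: give mass 1 / (m + d) to each vertex and the remaining mass d / (m + d) to
-- an extra point, whose value is chosen to make the mean equal to 1.  Among ℓ
-- independent random points, each edge occurs in ℓ! orders, so that
-- |E| ℓ! ≤ Θ (m + d)^ℓ, and (m + d)^ℓ / ℓ! is asymptotic to the binomial coefficient.
--
-- Θ ≤ f: discretise the distribution and realise it, with all frequencies rounded
-- down, by m weighted vertices.  Since the mean is 1, the total weight is at most
-- m < m + d, so the ℓ-sets of weight at least ℓ + d form a hypergraph without the
-- matching.  Their number is asymptotically Pr[X₁ + ⋯ + Xℓ ≥ ℓ + d] times the
-- binomial coefficient, as almost all ℓ-tuples of vertices have distinct entries.

module Submission where

open import Algebra.Solver.Ring.AlmostCommutativeRing using (_-Raw-AlmostCommutative⟶_; fromCommutativeRing)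
open import Axiom.ExcludedMiddle using (ExcludedMiddle)
open import Data.Bool.Base using (Bool; true; false; if_then_else_; T)
open import Data.Empty using (⊥-elim) renaming (⊥ to Empty)
open import Data.Fin.Base as Fin using (Fin; zero; suc; toℕ; fromℕ<)
import Data.Fin.Properties as Finₚ
open import Data.Fin.Subset using (Subset; inside; outside; ∣_∣; ⊤) renaming (⊥ to ∅ˢ)
open import Data.Fin.Subset.Properties using (_∈?_; ∣⊤∣≡n; ∣⊥∣≡0)
open import Data.Integer.Base as ℤ using (ℤ; +_; -[1+_])
import Data.Integer.Properties as ℤₚ
import Data.List.Base as L
open import Data.List.Membership.Propositional using () renaming (_∈_ to _∈ₗ_)
open import Data.List.Membership.Propositional.Properties
  using (∈-lookup; ∈-filter⁺; ∈-filter⁻; ∈-cartesianProductWith⁺)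
open import Data.List.Relation.Unary.All as All using ()
open import Data.List.Relation.Unary.AllPairs using (AllPairs)
open import Data.List.Relation.Unary.Any as Any using ()
open import Data.List.Relation.Unary.Any.Properties using (lookup-index)
open import Data.List.Relation.Unary.Unique.Propositional using (Unique)
open import Data.List.Relation.Unary.Unique.Propositional.Properties using (filter⁺; cartesianProductWith⁺)
open import Data.Maybe.Base using (Maybe; just; nothing)
open import Data.Nat.Base as ℕ using (ℕ; zero; suc; z≤n; s≤s; _∸_; _!)
open import Data.Nat.Combinatorics using (_C_; nCk≡nPk/k!) renaming (_P_ to _↓_)
open import Data.Nat.Combinatorics.Base using (_P′_)
open import Data.Nat.Combinatorics.Specification using (nP′k≡n[n∸1P′k∸1]; k!∣nP′k)
import Data.Nat.DivMod as ℕ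
import Data.Nat.Properties as ℕₚ
open import Data.Product.Base using (∃; _×_; _,_; proj₁; proj₂; ∃-syntax; Σ-syntax)
import Data.Sign.Base as Sign
open import Data.Sum.Base using (_⊎_; inj₁; inj₂; [_,_]′)
open import Data.Unit.Base using (tt) renaming (⊤ to Unit)
open import Data.Vec.Base using (Vec; []; _∷_; lookup; map; _[_]≔_)
import Data.Vec.Functional as Vector
open import Data.Vec.Properties
  using (∷-injective; lookup∘update; lookup∘update′; []≔-idempotent; []≔-lookup; lookup-map; lookup-replicate)
open import Defs
open import Function.Base using (_∘_)
open import Level using (0ℓ; Lift; lift) renaming (suc to lsuc)
open import Relation.Binary.Bundles using (Poset)
open import Relation.Binary.Definitions using (tri<; tri≈; tri>)
open import Relation.Binary.PropositionalEquality.Core as ≡ using (_≡_; _≢_)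
open import Relation.Binary.Structures using (IsTotalOrder)
open import Relation.Nullary using (¬_; yes; no)
open import Relation.Nullary.Decidable.Core using (decidable-stable; does)
open import Relation.Unary using (Pred; ∁; ⋃; ⋂; ∅; _∩_; _∪_; _⊆_; _⊥_; _⊢_)

-- The integer `d` works on both sides. As the mass of the extra point it leaves room to raise the
-- mean to exactly 1 without changing the weights of the vertices; as the gap between m and m + d it
-- keeps the cover of the converse strictly below the matching size, although the discretised mean
-- may reach 1.
--
-- Ordered tuples, repetitions allowed, are the meeting ground. Probabilities are sums of product
-- weights over them and edges are counted through their orderings, so both inequalities become
-- comparisons of such sums, with the weights of one side pushed forward to those of the other.
--
-- The cover must come from an exact duality theorem over an abstract complete ordered field.
-- Farkas' lemma is therefore proved for the whole cone of valid constraints, eliminating one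
-- variable at a time; completeness picks its value, so no finite list of inequalities has to be
-- maintained.
--
-- The existence of both quantities belongs to the claim: the supremum `θ` is constructed first, and
-- the limsup is then identified with it up to constant multiples of an arbitrary ε.

module Proof (em : ∀ {a} → ExcludedMiddle a) (R : CompleteOrderedField) where

  open Reals R hiding (zero)
  open Probability R hiding (resp; compl; union)
  open FractionalMatchings R
  open import Algebra.Properties.Ring ring
    using (-0#≈0#; -‿involutive; -‿distribˡ-*; -‿distribʳ-*; -‿+-comm)
  open import Algebra.Properties.Semiring.Mult semiring using (×1-homo-*; ×-homo-+)
  open import Algebra.Properties.Monoid.Mult +-monoid using (×-congˡ)
  open import Algebra.Properties.CommutativeSemiring.Exp commutativeSemiring
    using (_^_; ^-congˡ; ^-distrib-*)

  open IsTotalOrder isTotalOrder using ()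
    renaming (refl to ≤-refl; trans to ≤-trans; antisym to ≤-antisym; total to ≤-total;
              reflexive to ≤-reflexive)

  -- Naturals and integers in the reals, and the ring solver.

  fromℕ-+ : ∀ m n → fromℕ (m ℕ.+ n) ≈ fromℕ m + fromℕ n
  fromℕ-+ = ×-homo-+ 1#

  fromℕ-* : ∀ m n → fromℕ (m ℕ.* n) ≈ fromℕ m * fromℕ n
  fromℕ-* = ×1-homo-*

  fromℕ-cong : ∀ {m n} → m ≡ n → fromℕ m ≈ fromℕ n
  fromℕ-cong = ×-congˡ

  -- The solver compares coefficients by computation, which abstract reals do not allow; integer
  -- coefficients do, and this homomorphism interprets them.
  module IntegerCoefficients where

    open import Relation.Binary.Reasoning.Setoid setoid

    ⟦_⟧ℤ : ℤ → ℝ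
    ⟦ + n ⟧ℤ     = fromℕ n
    ⟦ -[1+ n ] ⟧ℤ = - fromℕ (suc n)

    ⊖-homo : ∀ m n → ⟦ m ℤ.⊖ n ⟧ℤ ≈ fromℕ m - fromℕ n
    ⊖-homo m zero = sym (trans (+-congˡ -0#≈0#) (+-identityʳ _))
    ⊖-homo zero (suc n) = sym (+-identityˡ _)
    ⊖-homo (suc m) (suc n) = begin
      ⟦ suc m ℤ.⊖ suc n ⟧ℤ                ≡⟨ ≡.cong ⟦_⟧ℤ (ℤₚ.[1+m]⊖[1+n]≡m⊖n m n) ⟩
      ⟦ m ℤ.⊖ n ⟧ℤ                        ≈⟨ ⊖-homo m n ⟩
      a - b                               ≈⟨ +-congʳ (+-identityˡ a) ⟨
      (0# + a) - b                        ≈⟨ +-congʳ (+-congʳ (-‿inverseʳ 1#)) ⟨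
      ((1# - 1#) + a) - b                 ≈⟨ +-congʳ (+-congʳ (+-comm _ _)) ⟩
      ((- 1# + 1#) + a) - b               ≈⟨ +-congʳ (+-assoc _ _ _) ⟩
      (- 1# + (1# + a)) - b               ≈⟨ +-congʳ (+-comm _ _) ⟩
      ((1# + a) + - 1#) - b               ≈⟨ +-assoc _ _ _ ⟩
      (1# + a) + (- 1# - b)               ≈⟨ +-congˡ (-‿+-comm 1# b) ⟩
      (1# + a) - (1# + b)                 ∎
      where
      a = fromℕ m
      b = fromℕ n

    neg-homo : ∀ i → ⟦ ℤ.- i ⟧ℤ ≈ - ⟦ i ⟧ℤ
    neg-homo (+ zero)  = sym -0#≈0#
    neg-homo (+ suc n) = refl
    neg-homo -[1+ n ]  = sym (-‿involutive _)

    +-homo : ∀ i j → ⟦ i ℤ.+ j ⟧ℤ ≈ ⟦ i ⟧ℤ + ⟦ j ⟧ℤ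
    +-homo (+ m) (+ n)         = fromℕ-+ m n
    +-homo (+ m) -[1+ n ]      = ⊖-homo m (suc n)
    +-homo -[1+ m ] (+ n)      = trans (⊖-homo n (suc m)) (+-comm _ _)
    +-homo -[1+ m ] -[1+ n ]   = begin
      - fromℕ (suc (suc (m ℕ.+ n)))        ≈⟨ -‿cong (fromℕ-cong (≡.cong suc (≡.sym (ℕₚ.+-suc m n)))) ⟩
      - fromℕ (suc m ℕ.+ suc n)            ≈⟨ -‿cong (fromℕ-+ (suc m) (suc n)) ⟩
      - (fromℕ (suc m) + fromℕ (suc n))    ≈⟨ -‿+-comm _ _ ⟨
      - fromℕ (suc m) - fromℕ (suc n)      ∎

    +◃-homo : ∀ n → ⟦ Sign.+ ℤ.◃ n ⟧ℤ ≈ fromℕ n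
    +◃-homo n = reflexive (≡.cong ⟦_⟧ℤ (ℤₚ.+◃n≡+n n))

    -◃-homo : ∀ n → ⟦ Sign.- ℤ.◃ n ⟧ℤ ≈ - fromℕ n
    -◃-homo n = trans (reflexive (≡.cong ⟦_⟧ℤ (ℤₚ.-◃n≡-n n))) (neg-homo (+ n))

    *-homo : ∀ i j → ⟦ i ℤ.* j ⟧ℤ ≈ ⟦ i ⟧ℤ * ⟦ j ⟧ℤ
    *-homo (+ m) (+ n) = trans (+◃-homo (m ℕ.* n)) (fromℕ-* m n)
    *-homo (+ m) -[1+ n ] = begin
      ⟦ Sign.- ℤ.◃ (m ℕ.* suc n) ⟧ℤ   ≈⟨ -◃-homo (m ℕ.* suc n) ⟩
      - fromℕ (m ℕ.* suc n)           ≈⟨ -‿cong (fromℕ-* m (suc n)) ⟩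
      - (fromℕ m * fromℕ (suc n))     ≈⟨ -‿distribʳ-* _ _ ⟩
      fromℕ m * - fromℕ (suc n)       ∎
    *-homo -[1+ m ] (+ n) = begin
      ⟦ Sign.- ℤ.◃ (suc m ℕ.* n) ⟧ℤ   ≈⟨ -◃-homo (suc m ℕ.* n) ⟩
      - fromℕ (suc m ℕ.* n)           ≈⟨ -‿cong (fromℕ-* (suc m) n) ⟩
      - (fromℕ (suc m) * fromℕ n)     ≈⟨ -‿distribˡ-* _ _ ⟩
      - fromℕ (suc m) * fromℕ n       ∎
    *-homo -[1+ m ] -[1+ n ] = begin
      ⟦ Sign.+ ℤ.◃ (suc m ℕ.* suc n) ⟧ℤ  ≈⟨ +◃-homo (suc m ℕ.* suc n) ⟩
      fromℕ (suc m ℕ.* suc n)            ≈⟨ fromℕ-* (suc m) (suc n) ⟩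
      a * b                              ≈⟨ -‿involutive _ ⟨
      - - (a * b)                        ≈⟨ -‿cong (-‿distribʳ-* _ _) ⟩
      - (a * - b)                        ≈⟨ -‿distribˡ-* _ _ ⟩
      - a * - b                          ∎
      where
      a = fromℕ (suc m)
      b = fromℕ (suc n)

    -- Agrees with ⟦_⟧ℤ, but sends + 1 to 1# rather than to 1# + 0#, so that the
    -- solver recognises the literal 1#.
    ⟦_⟧ : ℤ → ℝ
    ⟦ + 1 ⟧      = 1#
    ⟦ -[1+ 0 ] ⟧ = - 1#
    ⟦ i ⟧        = ⟦ i ⟧ℤ

    ⟦⟧≈⟦⟧ℤ : ∀ i → ⟦ i ⟧ ≈ ⟦ i ⟧ℤ
    ⟦⟧≈⟦⟧ℤ (+ zero)          = refl
    ⟦⟧≈⟦⟧ℤ (+ suc zero)      = sym (+-identityʳ 1#)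
    ⟦⟧≈⟦⟧ℤ (+ suc (suc n))   = refl
    ⟦⟧≈⟦⟧ℤ -[1+ zero ]       = -‿cong (sym (+-identityʳ 1#))
    ⟦⟧≈⟦⟧ℤ -[1+ suc n ]      = refl

    homomorphism : ℤ.+-*-rawRing -Raw-AlmostCommutative⟶ fromCommutativeRing commutativeRing
    homomorphism = record
      { ⟦_⟧    = ⟦_⟧
      ; +-homo = λ i j → trans (⟦⟧≈⟦⟧ℤ (i ℤ.+ j)) (trans (+-homo i j) (sym (+-cong (⟦⟧≈⟦⟧ℤ i) (⟦⟧≈⟦⟧ℤ j))))
      ; *-homo = λ i j → trans (⟦⟧≈⟦⟧ℤ (i ℤ.* j)) (trans (*-homo i j) (sym (*-cong (⟦⟧≈⟦⟧ℤ i) (⟦⟧≈⟦⟧ℤ j))))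
      ; -‿homo = λ i → trans (⟦⟧≈⟦⟧ℤ (ℤ.- i)) (trans (neg-homo i) (sym (-‿cong (⟦⟧≈⟦⟧ℤ i))))
      ; 0-homo = refl
      ; 1-homo = refl
      }

    _≟_ : ∀ i j → Maybe (⟦ i ⟧ ≈ ⟦ j ⟧)
    i ≟ j with i ℤₚ.≟ j
    ... | yes i≡j = just (reflexive (≡.cong ⟦_⟧ i≡j))
    ... | no _    = nothing

  open import Algebra.Solver.Ring ℤ.+-*-rawRing (fromCommutativeRing commutativeRing)
    IntegerCoefficients.homomorphism IntegerCoefficients._≟_
    using (solve; _:+_; _:*_; _:-_; :-_; con; _:=_)

  -- Arithmetic of a complete ordered field.

  poset : Poset 0ℓ 0ℓ 0ℓ
  poset = record { isPartialOrder = IsTotalOrder.isPartialOrder isTotalOrder }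

  module ≈-Reasoning where
    open import Relation.Binary.Reasoning.Setoid setoid public

  module ≤-Reasoning where
    open import Relation.Binary.Reasoning.PartialOrder poset public
      using (begin_; _∎; step-≤; step-≈; step-≈-⟩; step-≈-⟨; step-≡; step-≡-⟩; step-≡-⟨; step-≡-∣)

  ≤-resp : ∀ {x x′ y y′} → x ≈ x′ → y ≈ y′ → x ≤ y → x′ ≤ y′
  ≤-resp p q h = ≤-trans (≤-reflexive (sym p)) (≤-trans h (≤-reflexive q))

  0≤y-x : ∀ {x y} → x ≤ y → 0# ≤ y - x
  0≤y-x {x} h = ≤-resp (-‿inverseʳ x) refl (+-monoˡ-≤ (- x) h)

  -- Inequalities are proved by certificate: `e` is built from terms known to be non-negative, and
  -- the identity is left to the solver.
  ≤-by : ∀ {x y e} → 0# ≤ e → e ≈ y - x → x ≤ y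
  ≤-by {x} {y} {e} h p = ≤-resp (+-identityˡ x)
    (trans (+-congʳ p) (solve 2 (λ x y → (y :- x) :+ x := y) refl x y)) (+-monoˡ-≤ x h)

  +-mono-≤ : ∀ {x y u v} → x ≤ y → u ≤ v → x + u ≤ y + v
  +-mono-≤ {x} {y} {u} {v} p q =
    ≤-trans (+-monoˡ-≤ u p) (≤-resp (+-comm u y) (+-comm v y) (+-monoˡ-≤ y q))

  +-monoʳ-≤ : ∀ z {x y} → x ≤ y → z + x ≤ z + y
  +-monoʳ-≤ z p = +-mono-≤ (≤-refl {z}) p

  +-nonneg : ∀ {x y} → 0# ≤ x → 0# ≤ y → 0# ≤ x + y
  +-nonneg p q = ≤-resp (+-identityʳ 0#) refl (+-mono-≤ p q)

  x≤x+y : ∀ {x y} → 0# ≤ y → x ≤ x + y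
  x≤x+y {x} p = ≤-resp (+-identityʳ x) refl (+-monoʳ-≤ x p)

  y≤x+y : ∀ {x y} → 0# ≤ x → y ≤ x + y
  y≤x+y {x} {y} p = ≤-resp (+-identityˡ y) refl (+-monoˡ-≤ y p)

  x-y≤x : ∀ {x y} → 0# ≤ y → x - y ≤ x
  x-y≤x {x} {y} p = ≤-by p (solve 2 (λ x y → y := x :- (x :- y)) refl x y)

  *-monoˡ-≤ : ∀ z → 0# ≤ z → ∀ {x y} → x ≤ y → z * x ≤ z * y
  *-monoˡ-≤ z 0≤z {x} {y} p =
    ≤-by (*-nonneg 0≤z (0≤y-x p)) (solve 3 (λ z x y → z :* (y :- x) := z :* y :- z :* x) refl z x y)

  *-monoʳ-≤ : ∀ z → 0# ≤ z → ∀ {x y} → x ≤ y → x * z ≤ y * z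
  *-monoʳ-≤ z 0≤z {x} {y} p = ≤-resp (*-comm z x) (*-comm z y) (*-monoˡ-≤ z 0≤z p)

  *-mono-≤ : ∀ {x y u v} → 0# ≤ u → 0# ≤ y → x ≤ y → u ≤ v → x * u ≤ y * v
  *-mono-≤ {x} {y} {u} {v} 0≤u 0≤y p q = ≤-trans (*-monoʳ-≤ u 0≤u p) (*-monoˡ-≤ y 0≤y q)

  ≰⇒> : ∀ {x y} → ¬ (x ≤ y) → y < x
  ≰⇒> {x} {y} x≰y with ≤-total x y
  ... | inj₁ x≤y = ⊥-elim (x≰y x≤y)
  ... | inj₂ y≤x = y≤x , λ y≈x → x≰y (≤-reflexive (sym y≈x))

  <⇒≱ : ∀ {x y} → x < y → ¬ (y ≤ x)
  <⇒≱ (x≤y , x≉y) y≤x = x≉y (≤-antisym x≤y y≤x)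

  <⇒≤ : ∀ {x y} → x < y → x ≤ y
  <⇒≤ = proj₁

  ≤-<-trans : ∀ {x y z} → x ≤ y → y < z → x < z
  ≤-<-trans x≤y y<z = ≰⇒> (λ z≤x → <⇒≱ y<z (≤-trans z≤x x≤y))

  <-≤-trans : ∀ {x y z} → x < y → y ≤ z → x < z
  <-≤-trans x<y y≤z = ≰⇒> (λ z≤x → <⇒≱ x<y (≤-trans y≤z z≤x))

  _≤?_ : ∀ x y → (x ≤ y) ⊎ (y < x)
  x ≤? y with em {P = x ≤ y}
  ... | yes p = inj₁ p
  ... | no ¬p = inj₂ (≰⇒> ¬p)

  0<y-x : ∀ {x y} → x < y → 0# < y - x
  0<y-x {x} {y} x<y = ≰⇒> (λ h → <⇒≱ x<y
    (≤-by (0≤y-x h) (solve 2 (λ x y → con (+ 0) :- (y :- x) := x :- y) refl x y)))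

  <-by : ∀ {x y e} → 0# < e → e ≈ y - x → x < y
  <-by {x} {y} {e} 0<e p = ≰⇒> (λ y≤x → <⇒≱ 0<e
    (≤-by (0≤y-x y≤x) (trans (solve 2 (λ x y → x :- y := con (+ 0) :- (y :- x)) refl x y)
                             (+-congˡ (-‿cong (sym p))))))

  0≤x² : ∀ x → 0# ≤ x * x
  0≤x² x with ≤-total 0# x
  ... | inj₁ 0≤x = *-nonneg 0≤x 0≤x
  ... | inj₂ x≤0 = ≤-resp refl (solve 1 (λ x → (con (+ 0) :- x) :* (con (+ 0) :- x) := x :* x) refl x)
                     (*-nonneg (0≤y-x x≤0) (0≤y-x x≤0))

  0≤1 : 0# ≤ 1#
  0≤1 = ≤-resp refl (*-identityˡ 1#) (0≤x² 1#)

  0<1 : 0# < 1#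
  0<1 = 0≤1 , 0≉1

  -- If x and y are positive and x * y = 0, then 1 = x x⁻¹ y y⁻¹ = 0.
  *-pos : ∀ {x y} → 0# < x → 0# < y → 0# < x * y
  *-pos {x} {y} (0≤x , 0≉x) (0≤y , 0≉y) = *-nonneg 0≤x 0≤y , λ 0≈xy → 0≉1 (begin
    0#                          ≈⟨ zeroˡ _ ⟨
    0# * (x ⁻¹ * y ⁻¹)          ≈⟨ *-congʳ 0≈xy ⟩
    (x * y) * (x ⁻¹ * y ⁻¹)     ≈⟨ solve 4 (λ x y u v → (x :* y) :* (u :* v) := (x :* u) :* (y :* v)) refl x
      y (x ⁻¹) (y ⁻¹) ⟩
    (x * x ⁻¹) * (y * y ⁻¹)     ≈⟨ *-cong (*-inverseʳ (λ p → 0≉x (sym p))) (*-inverseʳ (λ p → 0≉y (sym p))) ⟩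
    1# * 1#                     ≈⟨ *-identityˡ 1# ⟩
    1#                          ∎)
    where open ≈-Reasoning

  +-pos-nonneg : ∀ {x y} → 0# < x → 0# ≤ y → 0# < x + y
  +-pos-nonneg p q = <-≤-trans p (x≤x+y q)

  x*x⁻¹≈1 : ∀ {x} → 0# < x → x * x ⁻¹ ≈ 1#
  x*x⁻¹≈1 (_ , 0≉x) = *-inverseʳ (λ p → 0≉x (sym p))

  *-cancelˡ-≤ : ∀ {z x y} → 0# < z → z * x ≤ z * y → x ≤ y
  *-cancelˡ-≤ {z} {x} {y} 0<z h with x ≤? y
  ... | inj₁ p = p
  ... | inj₂ y<x = ⊥-elim (<⇒≱ (<-by (*-pos 0<z (0<y-x y<x))
                       (solve 3 (λ z x y → z :* (x :- y) := z :* x :- z :* y) refl z x y)) h)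

  -- Opaque, because with-abstractions would normalise the proofs inside.
  opaque
    ⁻¹-pos : ∀ {x} → 0# < x → 0# < x ⁻¹
    ⁻¹-pos {x} 0<x with (x ⁻¹) ≤? 0#
    ... | inj₂ p = p
    ... | inj₁ h = ⊥-elim (<⇒≱ 0<1 (≤-resp (x*x⁻¹≈1 0<x) (zeroʳ x) (*-monoˡ-≤ x (<⇒≤ 0<x) h)))

  /-* : ∀ {x y} → 0# < y → x / y * y ≈ x
  /-* {x} {y} 0<y = begin
    x * y ⁻¹ * y     ≈⟨ solve 3 (λ x y z → x :* z :* y := x :* (y :* z)) refl x y (y ⁻¹) ⟩
    x * (y * y ⁻¹)   ≈⟨ *-congˡ (x*x⁻¹≈1 0<y) ⟩
    x * 1#           ≈⟨ *-identityʳ x ⟩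
    x                ∎
    where open ≈-Reasoning

  /-nonneg : ∀ {x y} → 0# ≤ x → 0# < y → 0# ≤ x / y
  /-nonneg 0≤x 0<y = *-nonneg 0≤x (<⇒≤ (⁻¹-pos 0<y))

  /-pos : ∀ {x y} → 0# < x → 0# < y → 0# < x / y
  /-pos 0<x 0<y = *-pos 0<x (⁻¹-pos 0<y)

  /-≤ : ∀ {x y z} → 0# < y → x ≤ z * y → x / y ≤ z
  /-≤ {x} {y} {z} 0<y h = *-cancelˡ-≤ 0<y
    (≤-resp (trans (sym (/-* 0<y)) (*-comm _ _)) (*-comm z y) h)

  ≤-/ : ∀ {x y z} → 0# < y → z * y ≤ x → z ≤ x / y
  ≤-/ {x} {y} {z} 0<y h = *-cancelˡ-≤ 0<y
    (≤-resp (*-comm z y) (trans (sym (/-* 0<y)) (*-comm _ _)) h)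

  fromℕ-nonneg : ∀ n → 0# ≤ fromℕ n
  fromℕ-nonneg zero    = ≤-refl
  fromℕ-nonneg (suc n) = +-nonneg 0≤1 (fromℕ-nonneg n)

  fromℕ-mono : ∀ {m n} → m ℕ.≤ n → fromℕ m ≤ fromℕ n
  fromℕ-mono {n = n} z≤n = fromℕ-nonneg n
  fromℕ-mono (s≤s p)     = +-monoʳ-≤ 1# (fromℕ-mono p)

  fromℕ-pos : ∀ {n} → 0 ℕ.< n → 0# < fromℕ n
  fromℕ-pos {suc n} _ = +-pos-nonneg 0<1 (fromℕ-nonneg n)

  fromℕ-cancel-≤ : ∀ {m n} → fromℕ m ≤ fromℕ n → m ℕ.≤ n
  fromℕ-cancel-≤ {m} {n} h with m ℕₚ.≤? n
  ... | yes p = p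
  ... | no m≰n = ⊥-elim (<⇒≱ 0<1 (≤-by (0≤y-x (≤-trans (fromℕ-mono (ℕₚ.≰⇒> m≰n)) h))
                   (solve 1 (λ a → a :- (con (+ 1) :+ a) := con (+ 0) :- con (+ 1)) refl (fromℕ n))))

  x<1+x : ∀ x → x < 1# + x
  x<1+x x = <-by 0<1 (solve 1 (λ x → con (+ 1) := (con (+ 1) :+ x) :- x) refl x)

  x-1<x : ∀ x → x - 1# < x
  x-1<x x = <-by 0<1 (solve 1 (λ x → con (+ 1) := x :- (x :- con (+ 1))) refl x)

  opaque
    -- If the naturals were bounded, with supremum `u`, then n + 1 ≤ u for all n, and u - 1 would be
    -- a smaller upper bound.
    archimedean : ∀ x → ∃[ n ] x ≤ fromℕ n
    archimedean x with em {P = ∃[ n ] x ≤ fromℕ n}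
    ... | yes p = p
    ... | no ¬p with supremum (λ y → ∃[ n ] y ≈ fromℕ n) (0# , 0 , refl)
                       (x , λ { (n , y≈n) → ≤-trans (≤-reflexive y≈n) (<⇒≤ (≰⇒> (λ q → ¬p (n , q)))) })
    ...   | u , upper , least = ⊥-elim (<⇒≱ (x-1<x u) (least λ { (n , y≈n) →
              ≤-trans (≤-reflexive y≈n)
                (≤-by (0≤y-x (upper (suc n , refl)))
                   (solve 2 (λ u a → u :- (con (+ 1) :+ a) := (u :- con (+ 1)) :- a) refl u (fromℕ n))) }))

  opaque
    floor : ∀ {x} → 0# ≤ x → ∃[ n ] (fromℕ n ≤ x × x < fromℕ (suc n))
    floor {x} 0≤x with archimedean x
    ... | N , x≤N = search N (≤-<-trans x≤N (x<1+x (fromℕ N)))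
      where
      search : ∀ n → x < fromℕ (suc n) → ∃[ n ] (fromℕ n ≤ x × x < fromℕ (suc n))
      search n x<n+1 with fromℕ n ≤? x
      ... | inj₁ n≤x = n , n≤x , x<n+1
      search zero    _ | inj₂ x<0 = ⊥-elim (<⇒≱ x<0 0≤x)
      search (suc n) _ | inj₂ x<n = search n x<n

  -- If x > y, the choice ε = (x - y) / ((x - y) + K + 1) refutes the hypothesis.
  ≤-from-approximations : ∀ {x y} K → 0# ≤ K →
    (∀ ε → 0# < ε → ε < 1# → x ≤ y + K * ε) → x ≤ y
  ≤-from-approximations {x} {y} K 0≤K h with x ≤? y
  ... | inj₁ p = p
  ... | inj₂ y<x = ⊥-elim (<⇒≱ gap (h ε 0<ε ε<1))
    where
    D = x - y
    0<D = 0<y-x y<x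
    S = 1# + (D + K)
    0<S : 0# < S
    0<S = +-pos-nonneg 0<1 (+-nonneg (<⇒≤ 0<D) 0≤K)
    ε = D / S
    0<ε : 0# < ε
    0<ε = /-pos 0<D 0<S
    εS≈D : ε * S ≈ D
    εS≈D = /-* 0<S
    ε<1 : ε < 1#
    ε<1 = ≰⇒> (λ 1≤ε → <⇒≱ (<-≤-trans (x<1+x D) (+-monoʳ-≤ 1# (x≤x+y 0≤K)))
            (≤-resp (*-identityˡ S) εS≈D (*-monoʳ-≤ S (<⇒≤ 0<S) 1≤ε)))
    -- Since ε S = D, the difference of the two sides is exactly ε (1 + D).
    gap : y + K * ε < x
    gap = <-by (*-pos 0<ε (+-pos-nonneg 0<1 (<⇒≤ 0<D))) (begin
      ε * (1# + D)              ≈⟨ solve 3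
        (λ e d k → e :* (con (+ 1) :+ d) := e :* (con (+ 1) :+ (d :+ k)) :- k :* e) refl ε D K ⟩
      ε * S - K * ε             ≈⟨ +-congʳ εS≈D ⟩
      (x - y) - K * ε           ≈⟨ solve 3 (λ x y t → (x :- y) :- t := x :- (y :+ t)) refl x y (K * ε) ⟩
      x - (y + K * ε)           ∎)
      where open ≈-Reasoning

  ^-nonneg : ∀ n {x} → 0# ≤ x → 0# ≤ x ^ n
  ^-nonneg zero    h = 0≤1
  ^-nonneg (suc n) h = *-nonneg h (^-nonneg n h)

  ^-mono : ∀ n {x y} → 0# ≤ x → x ≤ y → x ^ n ≤ y ^ n
  ^-mono zero    0≤x h = ≤-refl
  ^-mono (suc n) 0≤x h = *-mono-≤ (^-nonneg n 0≤x) (≤-trans 0≤x h) h (^-mono n 0≤x h)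

  fromℕ-^ : ∀ a n → fromℕ (a ℕ.^ n) ≈ fromℕ a ^ n
  fromℕ-^ a zero    = +-identityʳ 1#
  fromℕ-^ a (suc n) = trans (fromℕ-* a (a ℕ.^ n)) (*-congˡ (fromℕ-^ a n))

  -- Induction multiplies by the non-negative factor 1 - x; the term dropped on the way is n x².
  bernoulli : ∀ n {x} → 0# ≤ x → x ≤ 1# → 1# - fromℕ n * x ≤ (1# - x) ^ n
  bernoulli zero {x} _ _ = ≤-reflexive (solve 1 (λ x → con (+ 1) :- con (+ 0) :* x := con (+ 1)) refl x)
  bernoulli (suc n) {x} 0≤x x≤1 = ≤-trans
    (≤-by (*-nonneg (fromℕ-nonneg n) (*-nonneg 0≤x 0≤x))
       (solve 2 (λ a x → a :* (x :* x) :=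
         (con (+ 1) :- x) :* (con (+ 1) :- a :* x) :- (con (+ 1) :- (con (+ 1) :+ a) :* x)) refl (fromℕ n) x))
    (*-monoˡ-≤ (1# - x) (0≤y-x x≤1) (bernoulli n 0≤x x≤1))

  -- Statements about all large m.

  Eventually : (ℕ → Set) → Set
  Eventually P = ∃[ n ] (∀ m → n ℕ.≤ m → P m)

  eventually-map : ∀ {P Q : ℕ → Set} → (∀ m → P m → Q m) → Eventually P → Eventually Q
  eventually-map f (n , h) = n , λ m n≤m → f m (h m n≤m)

  eventually-× : ∀ {P Q : ℕ → Set} → Eventually P → Eventually Q → Eventually (λ m → P m × Q m)
  eventually-× (n₁ , h₁) (n₂ , h₂) = n₁ ℕ.+ n₂ , λ m p →
    h₁ m (ℕₚ.≤-trans (ℕₚ.m≤m+n n₁ n₂) p) , h₂ m (ℕₚ.≤-trans (ℕₚ.m≤n+m n₂ n₁) p)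

  eventually-≥ : ∀ k → Eventually (k ℕ.≤_)
  eventually-≥ k = k , λ _ p → p

  eventually-large : ∀ {c} → 0# < c → ∀ x → Eventually (λ m → x ≤ c * fromℕ m)
  eventually-large {c} 0<c x with archimedean (x / c)
  ... | n , h = n , λ m n≤m → ≤-resp (/-* 0<c) (*-comm _ _)
        (*-monoʳ-≤ c (<⇒≤ 0<c) (≤-trans h (fromℕ-mono n≤m)))

  -- Weighted sums over tuples

  open import Algebra.Properties.CommutativeMonoid.Sum *-commutativeMonoid using ()
    renaming (sum-cong-≋ to product-cong)
  open import Algebra.Properties.Semiring.Sum semiring
    using (sum-cong-≋; sum-replicate-zero; ∑-distrib-+; ∑-comm; *-distribˡ-sum; *-distribʳ-sum)

  sum-mono : ∀ {n} {f g : Fin n → ℝ} → (∀ i → f i ≤ g i) → sum f ≤ sum g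
  sum-mono {zero}  h = ≤-refl
  sum-mono {suc n} h = +-mono-≤ (h zero) (sum-mono (h ∘ suc))

  sum-zero : ∀ {n} {f : Fin n → ℝ} → (∀ i → f i ≈ 0#) → sum f ≈ 0#
  sum-zero {n} h = trans (sum-cong-≋ h) (sum-replicate-zero n)

  sum-nonneg : ∀ {n} {f : Fin n → ℝ} → (∀ i → 0# ≤ f i) → 0# ≤ sum f
  sum-nonneg {n} h = ≤-resp (sum-replicate-zero n) refl (sum-mono h)

  sum-const : ∀ n c → sum {n} (λ _ → c) ≈ fromℕ n * c
  sum-const zero    c = sym (zeroˡ c)
  sum-const (suc n) c = trans (+-congˡ (sum-const n c))
    (solve 2 (λ a c → c :+ a :* c := (con (+ 1) :+ a) :* c) refl (fromℕ n) c)

  term≤sum : ∀ {n} {f : Fin n → ℝ} → (∀ i → 0# ≤ f i) → ∀ i → f i ≤ sum f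
  term≤sum {suc n} h zero    = x≤x+y (sum-nonneg (h ∘ suc))
  term≤sum {suc n} h (suc i) = ≤-trans (term≤sum (h ∘ suc) i) (y≤x+y (h zero))

  sum-single : ∀ {n} {f : Fin n → ℝ} i → (∀ j → j ≢ i → f j ≈ 0#) → sum f ≈ f i
  sum-single {suc n} zero    h =
    trans (+-congˡ (sum-zero (λ j → h (suc j) λ ()))) (+-identityʳ _)
  sum-single {suc n} (suc i) h =
    trans (+-cong (h zero λ ()) (sum-single i (λ j j≢i → h (suc j) (λ p → j≢i (Finₚ.suc-injective p)))))
      (+-identityˡ _)

  ind : Set → ℝ
  ind P = if does (em {P = P}) then 1# else 0#

  ind-yes : ∀ {P} → P → ind P ≈ 1#
  ind-yes {P} p with em {P = P}
  ... | yes _ = refl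
  ... | no ¬p = ⊥-elim (¬p p)

  ind-no : ∀ {P} → ¬ P → ind P ≈ 0#
  ind-no {P} ¬p with em {P = P}
  ... | yes p = ⊥-elim (¬p p)
  ... | no _  = refl

  ind-≤ : ∀ {P x} → (P → 1# ≤ x) → 0# ≤ x → ind P ≤ x
  ind-≤ {P} h₁ h₀ with em {P = P}
  ... | yes p = h₁ p
  ... | no _  = h₀

  ind-nonneg : ∀ P → 0# ≤ ind P
  ind-nonneg P with em {P = P}
  ... | yes _ = 0≤1
  ... | no _  = ≤-refl

  ind-mono : ∀ {P Q} → (P → Q) → ind P ≤ ind Q
  ind-mono {Q = Q} f = ind-≤ (λ p → ≤-reflexive (sym (ind-yes (f p)))) (ind-nonneg Q)

  ind≤1 : ∀ P → ind P ≤ 1#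
  ind≤1 P = ind-≤ (λ _ → ≤-refl) 0≤1

  ind-cong : ∀ {P Q} → (P → Q) → (Q → P) → ind P ≈ ind Q
  ind-cong f g = ≤-antisym (ind-mono f) (ind-mono g)

  ind-× : ∀ {P Q} → ind (P × Q) ≈ ind P * ind Q
  ind-× {P} {Q} with em {P = P}
  ... | no ¬p = trans (ind-no (¬p ∘ proj₁)) (sym (zeroˡ _))
  ... | yes p = trans (ind-cong proj₂ (p ,_)) (sym (*-identityˡ _))

  ind-∀ : ∀ {n} (P : Fin n → Set) → ind (∀ i → P i) ≈ product (λ i → ind (P i))
  ind-∀ {zero}  P = ind-yes λ ()
  ind-∀ {suc n} P = trans
    (ind-cong (λ h → h zero , h ∘ suc) (λ { (p , h) zero → p ; (p , h) (suc i) → h i }))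
    (trans ind-× (*-congˡ (ind-∀ (P ∘ suc))))

  -- At most one term is non-zero. Disjointness enters the counting here, both for disjoint events
  -- and for distinct edges, which have no ordering in common.
  sum-ind-unique : ∀ {n} {P : Fin n → Set} {Q : Set} → (∀ i j → P i → P j → i ≡ j) → (∀ i → P i → Q) →
    sum (λ i → ind (P i)) ≤ ind Q
  sum-ind-unique {P = P} {Q} unique incl with em {P = ∃ P}
  ... | no ¬p = ≤-resp (sym (sum-zero (λ i → ind-no (λ p → ¬p (i , p))))) refl (ind-nonneg Q)
  ... | yes (i , p) = ≤-resp (sym (sum-single i (λ j j≢i → ind-no (λ q → j≢i (unique j i q p))))) refl
    (ind-mono (incl i))

  -- The integral of a function against the ℓ-fold power of the measure `q`, which need not have
  -- mass 1: constant weights 1 give counting, a distribution gives expectation.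
  tupleSum : ∀ {k} → (Fin k → ℝ) → ∀ ℓ → (Vec (Fin k) ℓ → ℝ) → ℝ
  tupleSum q zero    F = F []
  tupleSum q (suc ℓ) F = sum (λ x → q x * tupleSum q ℓ (λ ω → F (x ∷ ω)))

  module _ {k : ℕ} {q : Fin k → ℝ} where

    tupleSum-cong : ∀ ℓ {F G : Vec (Fin k) ℓ → ℝ} → (∀ ω → F ω ≈ G ω) → tupleSum q ℓ F ≈ tupleSum q ℓ G
    tupleSum-cong zero    h = h []
    tupleSum-cong (suc ℓ) h = sum-cong-≋ (λ x → *-congˡ (tupleSum-cong ℓ (λ ω → h (x ∷ ω))))

    tupleSum-zero : ∀ ℓ {F : Vec (Fin k) ℓ → ℝ} → (∀ ω → F ω ≈ 0#) → tupleSum q ℓ F ≈ 0#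
    tupleSum-zero zero    h = h []
    tupleSum-zero (suc ℓ) h = sum-zero (λ x → trans (*-congˡ (tupleSum-zero ℓ (λ ω → h (x ∷ ω)))) (zeroʳ _))

    tupleSum-+ : ∀ ℓ (F G : Vec (Fin k) ℓ → ℝ) →
      tupleSum q ℓ (λ ω → F ω + G ω) ≈ tupleSum q ℓ F + tupleSum q ℓ G
    tupleSum-+ zero    F G = refl
    tupleSum-+ (suc ℓ) F G = trans
      (sum-cong-≋ (λ x → trans (*-congˡ (tupleSum-+ ℓ (λ ω → F (x ∷ ω)) (λ ω → G (x ∷ ω)))) (distribˡ _ _ _)))
      (∑-distrib-+ (λ x → q x * tupleSum q ℓ (λ ω → F (x ∷ ω))) (λ x → q x * tupleSum q ℓ (λ ω → G (x ∷ ω))))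

    tupleSum-*ˡ : ∀ ℓ c (F : Vec (Fin k) ℓ → ℝ) → tupleSum q ℓ (λ ω → c * F ω) ≈ c * tupleSum q ℓ F
    tupleSum-*ˡ zero    c F = refl
    tupleSum-*ˡ (suc ℓ) c F = trans
      (sum-cong-≋ (λ x → trans (*-congˡ (tupleSum-*ˡ ℓ c (λ ω → F (x ∷ ω))))
        (solve 3 (λ q c t → q :* (c :* t) := c :* (q :* t)) refl (q x) c (tupleSum q ℓ (λ ω → F (x ∷ ω))))))
      (sym (*-distribˡ-sum c (λ x → q x * tupleSum q ℓ (λ ω → F (x ∷ ω)))))

    tupleSum-sum : ∀ ℓ {n} (F : Fin n → Vec (Fin k) ℓ → ℝ) →
      tupleSum q ℓ (λ ω → sum (λ i → F i ω)) ≈ sum (λ i → tupleSum q ℓ (F i))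
    tupleSum-sum ℓ {zero}  F = tupleSum-zero ℓ (λ _ → refl)
    tupleSum-sum ℓ {suc n} F = trans (tupleSum-+ ℓ (F zero) (λ ω → sum (λ i → F (suc i) ω)))
      (+-congˡ (tupleSum-sum ℓ (F ∘ suc)))

    -- Fubini for a product of functions of single coordinates; independence of the coordinates is
    -- the case of indicators.
    tupleSum-product : ∀ ℓ (f : Fin ℓ → Fin k → ℝ) →
      tupleSum q ℓ (λ ω → product (λ i → f i (lookup ω i))) ≈ product (λ i → sum (λ x → q x * f i x))
    tupleSum-product zero    f = refl
    tupleSum-product (suc ℓ) f = begin
      sum (λ x → q x * tupleSum q ℓ (λ ω → f zero x * product (λ i → f (suc i) (lookup ω i))))
        ≈⟨ sum-cong-≋ (λ x → *-congˡ
          (tupleSum-*ˡ ℓ (f zero x) (λ ω → product (λ i → f (suc i) (lookup ω i))))) ⟩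
      sum (λ x → q x * (f zero x * rest))
        ≈⟨ sum-cong-≋ (λ x → sym (*-assoc (q x) (f zero x) rest)) ⟩
      sum (λ x → (q x * f zero x) * rest)
        ≈⟨ *-distribʳ-sum rest (λ x → q x * f zero x) ⟨
      sum (λ x → q x * f zero x) * rest
        ≈⟨ *-congˡ (tupleSum-product ℓ (f ∘ suc)) ⟩
      sum (λ x → q x * f zero x) * product (λ i → sum (λ x → q x * f (suc i) x)) ∎
      where
      open ≈-Reasoning
      rest = tupleSum q ℓ (λ ω → product (λ i → f (suc i) (lookup ω i)))

    tupleSum-1 : ∀ ℓ → tupleSum q ℓ (λ _ → 1#) ≈ sum q ^ ℓ
    tupleSum-1 zero    = refl
    tupleSum-1 (suc ℓ) = trans (sum-cong-≋ (λ x → *-congˡ {x = q x} (tupleSum-1 ℓ)))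
      (sym (*-distribʳ-sum (sum q ^ ℓ) q))

    tupleSum-scale : ∀ ℓ r (F : Vec (Fin k) ℓ → ℝ) →
      tupleSum (λ x → r * q x) ℓ F ≈ r ^ ℓ * tupleSum q ℓ F
    tupleSum-scale zero    r F = sym (*-identityˡ _)
    tupleSum-scale (suc ℓ) r F = trans
      (sum-cong-≋ (λ x → trans (*-congˡ (tupleSum-scale ℓ r (λ ω → F (x ∷ ω))))
        (solve 4 (λ r q p t → (r :* q) :* (p :* t) := (r :* p) :* (q :* t)) refl r (q x) (r ^ ℓ)
          (tupleSum q ℓ (λ ω → F (x ∷ ω))))))
      (sym (*-distribˡ-sum (r * r ^ ℓ) (λ x → q x * tupleSum q ℓ (λ ω → F (x ∷ ω)))))

    module _ (0≤q : ∀ x → 0# ≤ q x) where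

      tupleSum-mono : ∀ ℓ {F G : Vec (Fin k) ℓ → ℝ} → (∀ ω → F ω ≤ G ω) → tupleSum q ℓ F ≤ tupleSum q ℓ G
      tupleSum-mono zero    h = h []
      tupleSum-mono (suc ℓ) h = sum-mono (λ x → *-monoˡ-≤ (q x) (0≤q x) (tupleSum-mono ℓ (λ ω → h (x ∷ ω))))

      tupleSum-nonneg : ∀ ℓ {F : Vec (Fin k) ℓ → ℝ} → (∀ ω → 0# ≤ F ω) → 0# ≤ tupleSum q ℓ F
      tupleSum-nonneg ℓ h = ≤-resp (tupleSum-zero ℓ (λ _ → refl)) refl (tupleSum-mono ℓ h)

  -- Domination of the images of two measures in S passes to their powers.
  tupleSum-push : ∀ {S : Set} {k k′} {q : Fin k → ℝ} {q′ : Fin k′ → ℝ} (σ : Fin k → S) (τ : Fin k′ → S) →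
    (∀ x → 0# ≤ q x) → (∀ x → 0# ≤ q′ x) →
    ((f : S → ℝ) → (∀ s → 0# ≤ f s) → sum (λ x → q x * f (σ x)) ≤ sum (λ x → q′ x * f (τ x))) →
    ∀ ℓ (F : Vec S ℓ → ℝ) → (∀ v → 0# ≤ F v) →
    tupleSum q ℓ (λ ω → F (map σ ω)) ≤ tupleSum q′ ℓ (λ ω → F (map τ ω))
  tupleSum-push σ τ 0≤q 0≤q′ h zero    F 0≤F = ≤-refl
  tupleSum-push {q = q} {q′} σ τ 0≤q 0≤q′ h (suc ℓ) F 0≤F = ≤-trans
    (h (λ s → tupleSum q ℓ (λ ω → F (s ∷ map σ ω))) (λ s → tupleSum-nonneg 0≤q ℓ (λ ω → 0≤F (s ∷ map σ ω))))
    (sum-mono (λ x → *-monoˡ-≤ (q′ x) (0≤q′ x)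
      (tupleSum-push σ τ 0≤q 0≤q′ h ℓ (λ v → F (τ x ∷ v)) (λ v → 0≤F (τ x ∷ v)))))

  tupleSum-mono-weights : ∀ {k} {q q′ : Fin k → ℝ} → (∀ x → 0# ≤ q x) → (∀ x → q x ≤ q′ x) →
    ∀ ℓ {F : Vec (Fin k) ℓ → ℝ} → (∀ ω → 0# ≤ F ω) → tupleSum q ℓ F ≤ tupleSum q′ ℓ F
  tupleSum-mono-weights 0≤q h zero    0≤F = ≤-refl
  tupleSum-mono-weights 0≤q h (suc ℓ) 0≤F = sum-mono (λ x → *-mono-≤
    (tupleSum-nonneg 0≤q ℓ (λ ω → 0≤F (x ∷ ω))) (≤-trans (0≤q x) (h x)) (h x)
    (tupleSum-mono-weights 0≤q h ℓ (λ ω → 0≤F (x ∷ ω))))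

  -- Linear programming duality

  basis : ∀ {n} → Fin n → Fin n → ℝ
  basis zero    zero    = 1#
  basis zero    (suc j) = 0#
  basis (suc i) zero    = 0#
  basis (suc i) (suc j) = basis i j

  sum-basis : ∀ {n} (i : Fin n) (f : Fin n → ℝ) → sum (λ j → basis i j * f j) ≈ f i
  sum-basis zero    f = trans (+-cong (*-identityˡ _) (sum-zero (λ j → zeroˡ (f (suc j))))) (+-identityʳ _)
  sum-basis (suc i) f = trans (+-cong (zeroˡ _) (sum-basis i (f ∘ suc))) (+-identityˡ _)

  -- K α β stands for the constraint Σ αᵢ xᵢ ≤ β; the box constraints 0 ≤ xᵢ ≤ 1
  -- make the system compact, so that it need not be finite.
  record IsBoxedCone {n : ℕ} (K : (Fin n → ℝ) → ℝ → Set) : Set where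
    field
      resp  : ∀ {α α′ β β′} → (∀ i → α i ≈ α′ i) → β ≈ β′ → K α β → K α′ β′
      add   : ∀ {α α′ β β′} → K α β → K α′ β′ → K (λ i → α i + α′ i) (β + β′)
      scale : ∀ {α β} r → 0# < r → K α β → K (λ i → r * α i) (r * β)
      lower : ∀ i → K (λ j → - basis i j) 0#
      upper : ∀ i → K (basis i) 1#

  Contradictory : ∀ {n} → ((Fin n → ℝ) → ℝ → Set) → Set
  Contradictory K = ∃[ β ] (β < 0# × K (λ _ → 0#) β)

  -- Farkas' lemma.  The first coordinate of a solution is the supremum of the
  -- lower bounds for it that follow from the system.
  solvable : ∀ n {K : (Fin n → ℝ) → ℝ → Set} → IsBoxedCone K → ¬ Contradictory K →
    Σ[ x ∈ (Fin n → ℝ) ] (∀ {α β} → K α β → sum (λ i → α i * x i) ≤ β)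
  solvable zero {K} cone consistent = (λ ()) , λ {α} {β} c → nonneg c
    where
    nonneg : ∀ {α β} → K α β → 0# ≤ β
    nonneg {α} {β} c with 0# ≤? β
    ... | inj₁ p   = p
    ... | inj₂ β<0 = ⊥-elim (consistent (β , β<0 , IsBoxedCone.resp cone (λ ()) refl c))
  solvable (suc n) {K} cone consistent = first Vector.∷ proj₁ rest , solves
    where
    open IsBoxedCone cone
    only : ℝ → Fin (suc n) → ℝ
    only a = a Vector.∷ (λ _ → 0#)

    LowerBound : ℝ → Set
    LowerBound l = K (only (- 1#)) (- l)

    -- Adding the two constraints cancels the first variable and leaves 0 ≤ u - l.
    clash : ∀ {l u} → LowerBound l → K (only 1#) u → l ≤ u
    clash {l} {u} cl cu with l ≤? u
    ... | inj₁ p   = p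
    ... | inj₂ u<l = ⊥-elim (consistent (- l + u ,
      <-by (0<y-x u<l) (solve 2 (λ l u → l :- u := con (+ 0) :- (:- l :+ u)) refl l u) ,
      resp (λ { zero → -‿inverseˡ 1# ; (suc i) → +-identityʳ 0# }) refl (add cl cu)))

    -- The box constraints supply both side conditions: 0 is a lower bound that follows from the
    -- system, and no such bound exceeds 1.
    sup = supremum LowerBound
      (0# , resp (λ { zero → refl ; (suc i) → -0#≈0# }) (sym -0#≈0#) (lower zero))
      (1# , λ cl → clash cl (resp (λ { zero → refl ; (suc i) → refl }) refl (upper zero)))
    first = proj₁ sup

    -- The constraints on the remaining variables after substituting `first`, with its contribution
    -- moved to the right-hand side.
    K′ : (Fin n → ℝ) → ℝ → Set
    K′ α β = ∃[ a ] K (a Vector.∷ α) (β + a * first)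

    cone′ : IsBoxedCone K′
    cone′ = record
      { resp  = λ p q (a , c) → a , resp (λ { zero → refl ; (suc i) → p i }) (+-congʳ q) c
      ; add   = λ {_} {_} {β} {β′} (a , c) (a′ , c′) → a + a′ ,
          resp (λ { zero → refl ; (suc i) → refl })
            (solve 5 (λ b b′ a a′ x → (b :+ a :* x) :+ (b′ :+ a′ :* x) := (b :+ b′) :+ (a :+ a′) :* x) refl
              β β′ a a′ first)
            (add c c′)
      ; scale = λ {_} {β} r 0<r (a , c) → r * a ,
          resp (λ { zero → refl ; (suc i) → refl })
            (solve 4 (λ r b a x → r :* (b :+ a :* x) := r :* b :+ (r :* a) :* x) refl r β a first)
            (scale r 0<r c)
      ; lower = λ i → 0# , resp (λ { zero → -0#≈0# ; (suc j) → refl })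
          (solve 1 (λ x → con (+ 0) := con (+ 0) :+ con (+ 0) :* x) refl first) (lower (suc i))
      ; upper = λ i → 0# , resp (λ { zero → refl ; (suc j) → refl })
          (solve 1 (λ x → con (+ 1) := con (+ 1) :+ con (+ 0) :* x) refl first) (upper (suc i))
      }

    -- A contradiction after substitution comes from a x₀ ≤ β + a `first` with β < 0. For a = 0 the
    -- original system is contradictory; for a < 0 division yields a lower bound above the supremum;
    -- for a > 0 it yields an upper bound below it, and every lower bound clashes with that one.
    consistent′ : ¬ Contradictory K′
    consistent′ (β , β<0 , a , c) with a ≤? 0# | 0# ≤? a
    ... | inj₁ a≤0 | inj₁ 0≤a = consistent (β , β<0 , resp (λ { zero → a≈0 ; (suc i) → refl })
            (trans (+-congˡ (trans (*-congʳ a≈0) (zeroˡ _))) (+-identityʳ β)) c)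
      where a≈0 = ≤-antisym a≤0 0≤a
    ... | inj₁ a≤0 | inj₂ a<0 = <⇒≱ (<-by (*-pos 0<r (0<y-x β<0))
            (solve 3 (λ r b x → r :* (con (+ 0) :- b) := (x :- r :* b) :- x) refl r β first))
            (proj₁ (proj₂ sup) l-bound)
      where
      0<-a : 0# < 0# - a
      0<-a = 0<y-x a<0
      r = (0# - a) ⁻¹
      0<r = ⁻¹-pos 0<-a
      ra≈-1 : r * a ≈ - 1#
      ra≈-1 = trans (solve 2 (λ r a → r :* a := :- ((con (+ 0) :- a) :* r)) refl r a) (-‿cong (x*x⁻¹≈1 0<-a))
      l-bound : LowerBound (first - r * β)
      l-bound = resp (λ { zero → ra≈-1 ; (suc i) → zeroʳ r })
        (trans (solve 4 (λ r b a x → r :* (b :+ a :* x) := r :* b :+ (r :* a) :* x) refl r β a first)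
          (trans (+-congˡ (*-congʳ ra≈-1))
            (solve 3 (λ r b x → r :* b :+ :- con (+ 1) :* x := :- (x :- r :* b)) refl r β first)))
        (scale r 0<r c)
    ... | inj₂ 0<a | _ = <⇒≱ (<-by (*-pos 0<r (0<y-x β<0))
            (solve 3 (λ r b x → r :* (con (+ 0) :- b) := x :- (r :* b :+ x)) refl r β first))
            (proj₂ (proj₂ sup) (λ cl → clash cl u-bound))
      where
      r = a ⁻¹
      0<r = ⁻¹-pos 0<a
      ra≈1 : r * a ≈ 1#
      ra≈1 = trans (*-comm r a) (x*x⁻¹≈1 0<a)
      u-bound : K (only 1#) (r * β + first)
      u-bound = resp (λ { zero → ra≈1 ; (suc i) → zeroʳ r })
        (trans (solve 4 (λ r b a x → r :* (b :+ a :* x) := r :* b :+ (r :* a) :* x) refl r β a first)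
          (+-congˡ (trans (*-congʳ ra≈1) (*-identityˡ first))))
        (scale r 0<r c)

    rest = solvable n cone′ consistent′

    solves : ∀ {α β} → K α β → sum (λ i → α i * (first Vector.∷ proj₁ rest) i) ≤ β
    solves {α} {β} c = ≤-resp refl
      (solve 2 (λ t b → t :+ (b :- t) := b) refl (α zero * first) β)
      (+-monoʳ-≤ (α zero * first) (proj₂ rest (α zero ,
        resp (λ { zero → refl ; (suc i) → refl })
          (solve 2 (λ t b → b := (b :- t) :+ t) refl (α zero * first) β) c)))

  -- Edges and their enumerations

  χ : ∀ {m} → Subset m → Fin m → ℝ
  χ e v = if lookup e v then 1# else 0#

  does-∈? : ∀ {m} (v : Fin m) (e : Subset m) → does (v ∈? e) ≡ lookup e v
  does-∈? zero    (inside  ∷ e) = ≡.refl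
  does-∈? zero    (outside ∷ e) = ≡.refl
  does-∈? (suc v) (s ∷ e)       = does-∈? v e

  if-∈? : ∀ {m} (v : Fin m) (e : Subset m) x → (if does (v ∈? e) then x else 0#) ≈ χ e v * x
  if-∈? v e x rewrite does-∈? v e with lookup e v
  ... | true  = sym (*-identityˡ x)
  ... | false = sym (zeroˡ x)

  χ-nonneg : ∀ {m} (e : Subset m) v → 0# ≤ χ e v
  χ-nonneg e v with lookup e v
  ... | true  = 0≤1
  ... | false = ≤-refl

  χ-remove : ∀ {m} (e : Subset m) x → lookup e x ≡ inside → ∀ v → χ e v ≈ basis x v + χ (e [ x ]≔ outside) v
  χ-remove (s ∷ e) zero    ≡.refl zero    = sym (+-identityʳ 1#)
  χ-remove (s ∷ e) zero    p      (suc v) = sym (+-identityˡ _)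
  χ-remove (s ∷ e) (suc x) p      zero    = sym (+-identityˡ _)
  χ-remove (s ∷ e) (suc x) p      (suc v) = χ-remove e x p v

  sum-χ : ∀ {m} (e : Subset m) → sum (χ e) ≈ fromℕ ∣ e ∣
  sum-χ []            = refl
  sum-χ (inside  ∷ e) = +-congˡ (sum-χ e)
  sum-χ (outside ∷ e) = trans (+-identityˡ _) (sum-χ e)

  infix 9 _⟨_⟩
  -- The weight of an edge, written as an inner product with its characteristic vector so that
  -- linearity in `c` comes from that of sums.
  _⟨_⟩ : ∀ {m} → (Fin m → ℝ) → Subset m → ℝ
  c ⟨ e ⟩ = sum (λ v → χ e v * c v)

  ⟨⟩-remove : ∀ {m} (c : Fin m → ℝ) e x → lookup e x ≡ inside → c ⟨ e ⟩ ≈ c x + c ⟨ e [ x ]≔ outside ⟩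
  ⟨⟩-remove c e x p = begin
    sum (λ v → χ e v * c v)
      ≈⟨ sum-cong-≋ (λ v → trans (*-congʳ (χ-remove e x p v))
        (distribʳ (c v) (basis x v) (χ (e [ x ]≔ outside) v))) ⟩
    sum (λ v → basis x v * c v + χ (e [ x ]≔ outside) v * c v)
      ≈⟨ ∑-distrib-+ (λ v → basis x v * c v) (λ v → χ (e [ x ]≔ outside) v * c v) ⟩
    sum (λ v → basis x v * c v) + c ⟨ e [ x ]≔ outside ⟩
      ≈⟨ +-congʳ (sum-basis x c) ⟩
    c x + c ⟨ e [ x ]≔ outside ⟩ ∎
    where open ≈-Reasoning

  ∣∣-remove : ∀ {m} (e : Subset m) x → lookup e x ≡ inside → ∣ e ∣ ≡ suc ∣ e [ x ]≔ outside ∣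
  ∣∣-remove (s ∷ e)       zero    ≡.refl = ≡.refl
  ∣∣-remove (inside ∷ e)  (suc x) p = ≡.cong suc (∣∣-remove e x p)
  ∣∣-remove (outside ∷ e) (suc x) p = ∣∣-remove e x p

  restore : ∀ {m} (e : Subset m) x s {s′} → lookup e x ≡ s → (e [ x ]≔ s′) [ x ]≔ s ≡ e
  restore e x s p = ≡.trans ([]≔-idempotent e x) (≡.trans (≡.cong (e [ x ]≔_) (≡.sym p)) ([]≔-lookup e x))

  _⊑_ : ∀ {m} → Subset m → Subset m → Set
  a ⊑ b = ∀ v → lookup a v ≡ inside → lookup b v ≡ inside

  ⊑-⊤ : ∀ {m} (a : Subset m) → a ⊑ ⊤
  ⊑-⊤ a v _ = lookup-replicate v inside

  false≢true : false ≢ true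
  false≢true ()

  ∉-removed : ∀ {m} (a : Subset m) x → lookup (a [ x ]≔ outside) x ≢ inside
  ∉-removed a x p = false≢true (≡.trans (≡.sym (lookup∘update x a outside)) p)

  -- The tuples of distinct elements of a.
  Selects : ∀ {m ℓ} → Subset m → Vec (Fin m) ℓ → Set
  Selects a []      = Unit
  Selects a (x ∷ ω) = lookup a x ≡ inside × Selects (a [ x ]≔ outside) ω

  Selects-mono : ∀ {m ℓ} {a b : Subset m} (ω : Vec (Fin m) ℓ) → a ⊑ b → Selects a ω → Selects b ω
  Selects-mono []      a⊑b _       = tt
  Selects-mono {a = a} {b} (x ∷ ω) a⊑b (p , s) = a⊑b x p , Selects-mono ω step s
    where
    step : (a [ x ]≔ outside) ⊑ (b [ x ]≔ outside)
    step v q with v Finₚ.≟ x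
    ... | yes ≡.refl = ⊥-elim (∉-removed a x q)
    ... | no v≢x = ≡.trans (lookup∘update′ v≢x b outside)
      (a⊑b v (≡.trans (≡.sym (lookup∘update′ v≢x a outside)) q))

  empty-unique : ∀ {m} (e e′ : Subset m) → ∣ e ∣ ≡ 0 → ∣ e′ ∣ ≡ 0 → e ≡ e′
  empty-unique []            []             _ _ = ≡.refl
  empty-unique (outside ∷ e) (outside ∷ e′) p q = ≡.cong (outside ∷_) (empty-unique e e′ p q)

  -- Distinct entries, as many as the set has elements, exhaust the set, so the tuple determines it.
  -- Hence the orderings of different edges are different.
  Selects-unique : ∀ {m ℓ} {e e′ : Subset m} (ω : Vec (Fin m) ℓ) → ∣ e ∣ ≡ ℓ → ∣ e′ ∣ ≡ ℓ →
    Selects e ω → Selects e′ ω → e ≡ e′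
  Selects-unique [] p p′ _ _ = empty-unique _ _ p p′
  Selects-unique {e = e} {e′} (x ∷ ω) p p′ (x∈e , s) (x∈e′ , s′) =
    ≡.trans (≡.sym (restore e x inside x∈e))
      (≡.trans (≡.cong (_[ x ]≔ inside)
        (Selects-unique ω (ℕₚ.suc-injective (≡.trans (≡.sym (∣∣-remove e x x∈e)) p))
                          (ℕₚ.suc-injective (≡.trans (≡.sym (∣∣-remove e′ x x∈e′)) p′)) s s′))
        (restore e′ x inside x∈e′))

  empty-⟨⟩ : ∀ {m} (c : Fin m → ℝ) e → ∣ e ∣ ≡ 0 → c ⟨ e ⟩ ≈ 0#
  empty-⟨⟩ c []            _ = refl
  empty-⟨⟩ c (outside ∷ e) p = trans (+-cong (zeroˡ _) (empty-⟨⟩ (c ∘ suc) e p)) (+-identityˡ _)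

  Selects-⟨⟩ : ∀ {m ℓ} (c : Fin m → ℝ) {e : Subset m} (ω : Vec (Fin m) ℓ) → ∣ e ∣ ≡ ℓ → Selects e ω →
    c ⟨ e ⟩ ≈ sum (λ i → c (lookup ω i))
  Selects-⟨⟩ c {e} []      p _         = empty-⟨⟩ c e p
  Selects-⟨⟩ c {e} (x ∷ ω) p (x∈e , s) = trans (⟨⟩-remove c e x x∈e)
    (+-congˡ (Selects-⟨⟩ c ω (ℕₚ.suc-injective (≡.trans (≡.sym (∣∣-remove e x x∈e)) p)) s))

  -- The support is built by inserting the head into the support of the tail. The clause `e ⊑ a`
  -- carries the induction: the tail selects from a set without x, so x is new and the size grows by
  -- one.
  Selects-support : ∀ {m ℓ} {a : Subset m} (ω : Vec (Fin m) ℓ) → Selects a ω →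
    ∃[ e ] (∣ e ∣ ≡ ℓ × Selects e ω × e ⊑ a)
  Selects-support {m} [] _ = ∅ˢ , ∣⊥∣≡0 m , tt ,
    λ v p → ⊥-elim (false≢true (≡.trans (≡.sym (lookup-replicate v outside)) p))
  Selects-support {a = a} (x ∷ ω) (x∈a , s) with Selects-support ω s
  ... | e , size , s′ , e⊑ = e′ ,
    ≡.trans (∣∣-remove e′ x x∈e′) (≡.cong suc (≡.trans (≡.cong ∣_∣ e′-x≡e) size)) ,
      (x∈e′ , ≡.subst (λ e → Selects e ω) (≡.sym e′-x≡e) s′) , e′⊑a
    where
    e′ = e [ x ]≔ inside
    x∈e′ = lookup∘update x e inside
    x∉e : ∀ {s} → lookup e x ≡ s → s ≡ outside
    x∉e {inside}  p = ⊥-elim (∉-removed a x (e⊑ x p))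
    x∉e {outside} p = ≡.refl
    e′-x≡e : e′ [ x ]≔ outside ≡ e
    e′-x≡e = restore e x outside (x∉e ≡.refl)
    e′⊑a : e′ ⊑ a
    e′⊑a v p with v Finₚ.≟ x
    ... | yes ≡.refl = x∈a
    ... | no v≢x = ≡.trans (≡.sym (lookup∘update′ v≢x a outside))
      (e⊑ v (≡.trans (≡.sym (lookup∘update′ v≢x e inside)) p))

  -- Falling factorials and the number of orderings.

  falling : ℕ → ℕ → ℕ
  falling n zero    = 1
  falling n (suc k) = n ℕ.* falling (n ∸ 1) k

  ones : ∀ {m} → Fin m → ℝ
  ones _ = 1#

  count : ∀ {m} ℓ → (Vec (Fin m) ℓ → Set) → ℝ
  count ℓ P = tupleSum ones ℓ (λ ω → ind (P ω))

  -- The first entry is any element of `a`, and each choice leaves a set smaller by one. If `a` is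
  -- too small, truncated subtraction makes a factor of the falling factorial zero.
  count-Selects : ∀ {m} ℓ (a : Subset m) → count ℓ (Selects a) ≈ fromℕ (falling ∣ a ∣ ℓ)
  count-Selects zero    a = trans (ind-yes tt) (sym (+-identityʳ 1#))
  count-Selects (suc ℓ) a = begin
    sum (λ x → 1# * tupleSum ones ℓ (λ ω → ind (lookup a x ≡ inside × Selects (a [ x ]≔ outside) ω)))
      ≈⟨ sum-cong-≋ (λ x → trans (*-identityˡ _) (step x)) ⟩
    sum (λ x → χ a x * fromℕ (falling (∣ a ∣ ∸ 1) ℓ))
      ≈⟨ *-distribʳ-sum (fromℕ (falling (∣ a ∣ ∸ 1) ℓ)) (χ a) ⟨
    sum (χ a) * fromℕ (falling (∣ a ∣ ∸ 1) ℓ)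
      ≈⟨ *-congʳ (sum-χ a) ⟩
    fromℕ ∣ a ∣ * fromℕ (falling (∣ a ∣ ∸ 1) ℓ)
      ≈⟨ fromℕ-* ∣ a ∣ (falling (∣ a ∣ ∸ 1) ℓ) ⟨
    fromℕ (falling ∣ a ∣ (suc ℓ)) ∎
    where
    open ≈-Reasoning
    step : ∀ x → tupleSum ones ℓ (λ ω → ind (lookup a x ≡ inside × Selects (a [ x ]≔ outside) ω))
               ≈ χ a x * fromℕ (falling (∣ a ∣ ∸ 1) ℓ)
    step x with lookup a x in eq
    ... | false = trans (tupleSum-zero ℓ (λ ω → ind-no (λ p → false≢true (proj₁ p)))) (sym (zeroˡ _))
    ... | true  = begin
      tupleSum ones ℓ (λ ω → ind (true ≡ inside × Selects (a [ x ]≔ outside) ω))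
        ≈⟨ tupleSum-cong ℓ (λ ω → ind-cong proj₂ (≡.refl ,_)) ⟩
      count ℓ (Selects (a [ x ]≔ outside))
        ≈⟨ count-Selects ℓ (a [ x ]≔ outside) ⟩
      fromℕ (falling ∣ a [ x ]≔ outside ∣ ℓ)
        ≈⟨ fromℕ-cong (≡.cong (λ n → falling (n ∸ 1) ℓ) (≡.sym (∣∣-remove a x eq))) ⟩
      fromℕ (falling (∣ a ∣ ∸ 1) ℓ)
        ≈⟨ *-identityˡ _ ⟨
      1# * fromℕ (falling (∣ a ∣ ∸ 1) ℓ) ∎

  falling-! : ∀ n → falling n n ≡ n !
  falling-! zero    = ≡.refl
  falling-! (suc n) = ≡.cong (suc n ℕ.*_) (falling-! n)

  falling≡P′ : ∀ {n k} → k ℕ.≤ n → falling n k ≡ n P′ k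
  falling≡P′ {n}     {zero}  _ = ≡.refl
  falling≡P′ {suc n} {suc k} (s≤s p) =
    ≡.trans (≡.cong (suc n ℕ.*_) (falling≡P′ p)) (≡.sym (nP′k≡n[n∸1P′k∸1] (suc n) (suc k)))

  falling≡C*! : ∀ {n k} → k ℕ.≤ n → falling n k ≡ (n C k) ℕ.* k !
  falling≡C*! {n} {k} k≤n = ≡.trans (falling≡P′ k≤n) (≡.sym (≡.trans
    (≡.cong (ℕ._* k !) (≡.trans (nCk≡nPk/k! k≤n) (≡.cong (λ p → (p ℕ./ k !) {{k ℕₚ.!≢0}}) P≡P′)))
    (ℕ.m/n*n≡m {{k ℕₚ.!≢0}} (k!∣nP′k k≤n))))
    where
    P≡P′ : n ↓ k ≡ n P′ k
    P≡P′ with k ℕ.≤ᵇ n | ℕₚ.≤⇒≤ᵇ k≤n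
    ... | true | _ = ≡.refl

  [n∸k]^k≤falling : ∀ n k → (n ∸ k) ℕ.^ k ℕ.≤ falling n k
  [n∸k]^k≤falling n zero    = ℕₚ.≤-refl
  [n∸k]^k≤falling n (suc k) = ℕₚ.*-mono-≤ (ℕₚ.m∸n≤m n (suc k))
    (ℕₚ.≤-trans (ℕₚ.≤-reflexive (≡.cong (ℕ._^ k) (≡.sym (ℕₚ.∸-+-assoc n 1 k)))) ([n∸k]^k≤falling (n ∸ 1) k))

  falling≤^ : ∀ n k → falling n k ℕ.≤ n ℕ.^ k
  falling≤^ n zero    = ℕₚ.≤-refl
  falling≤^ n (suc k) = ℕₚ.*-monoʳ-≤ n (ℕₚ.≤-trans (falling≤^ (n ∸ 1) k) (ℕₚ.^-monoˡ-≤ k (ℕₚ.m∸n≤m n 1)))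

  -- All ℓ factors are at least m - ℓ, which for η m ≥ ℓ + d is at least (1 - η)(m + d). Bernoulli's
  -- inequality turns (1 - η)^ℓ into 1 - ε when ℓ η ≤ ε; the denominator 1 + ℓ in η also keeps η at
  -- most 1.
  falling-asymptotics : ∀ d ℓ {ε} → 0# < ε → ε ≤ 1# →
    Eventually (λ m → (1# - ε) * fromℕ (m ℕ.+ d) ^ ℓ ≤ fromℕ (falling m ℓ))
  falling-asymptotics d ℓ {ε} 0<ε ε≤1 =
    eventually-map bound (eventually-× (eventually-≥ ℓ) (eventually-large 0<η (fromℕ ℓ + fromℕ d)))
    where
    L = 1# + fromℕ ℓ
    0<L : 0# < L
    0<L = +-pos-nonneg 0<1 (fromℕ-nonneg ℓ)
    η = ε / L
    0<η = /-pos 0<ε 0<L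
    η≤1 : η ≤ 1#
    η≤1 = /-≤ 0<L (≤-trans ε≤1 (≤-trans (x≤x+y (fromℕ-nonneg ℓ)) (≤-reflexive (sym (*-identityˡ L)))))
    ℓη≤ε : fromℕ ℓ * η ≤ ε
    ℓη≤ε = ≤-resp refl (trans (*-comm _ _) (/-* 0<L)) (*-monoʳ-≤ η (<⇒≤ 0<η) (y≤x+y 0≤1))
    bound : ∀ m → ℓ ℕ.≤ m × fromℕ ℓ + fromℕ d ≤ η * fromℕ m →
      (1# - ε) * fromℕ (m ℕ.+ d) ^ ℓ ≤ fromℕ (falling m ℓ)
    bound m (ℓ≤m , large) = begin
      (1# - ε) * M ^ ℓ               ≤⟨ *-monoʳ-≤ (M ^ ℓ) (^-nonneg ℓ 0≤M) 1-ε≤[1-η]^ℓ ⟩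
      (1# - η) ^ ℓ * M ^ ℓ           ≈⟨ ^-distrib-* (1# - η) M ℓ ⟨
      ((1# - η) * M) ^ ℓ             ≤⟨ ^-mono ℓ (*-nonneg (0≤y-x η≤1) 0≤M) shrink ⟩
      fromℕ (m ∸ ℓ) ^ ℓ              ≈⟨ fromℕ-^ (m ∸ ℓ) ℓ ⟨
      fromℕ ((m ∸ ℓ) ℕ.^ ℓ)          ≤⟨ fromℕ-mono ([n∸k]^k≤falling m ℓ) ⟩
      fromℕ (falling m ℓ)            ∎
      where
      open ≤-Reasoning
      M = fromℕ (m ℕ.+ d)
      0≤M = fromℕ-nonneg (m ℕ.+ d)
      1-ε≤[1-η]^ℓ : 1# - ε ≤ (1# - η) ^ ℓ
      1-ε≤[1-η]^ℓ = ≤-trans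
        (≤-by (0≤y-x ℓη≤ε)
          (solve 2 (λ e t → e :- t := (con (+ 1) :- t) :- (con (+ 1) :- e)) refl ε (fromℕ ℓ * η)))
        (bernoulli ℓ (<⇒≤ 0<η) η≤1)
      m≈ : fromℕ m ≈ fromℕ (m ∸ ℓ) + fromℕ ℓ
      m≈ = trans (fromℕ-cong (≡.sym (ℕₚ.m∸n+n≡m ℓ≤m))) (fromℕ-+ (m ∸ ℓ) ℓ)
      shrink : (1# - η) * M ≤ fromℕ (m ∸ ℓ)
      shrink = ≤-by (+-nonneg (0≤y-x large) (*-nonneg (<⇒≤ 0<η) (fromℕ-nonneg d)))
        (trans (solve 5 (λ l d h m x → (h :* m :- (l :+ d)) :+ h :* d :=
          m :- l :- (con (+ 1) :- h) :* (m :+ d)) refl (fromℕ ℓ) (fromℕ d) η (fromℕ m) M)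
          (+-cong (trans (+-congʳ m≈) (solve 2 (λ a b → a :+ b :- b := a) refl (fromℕ (m ∸ ℓ)) (fromℕ ℓ)))
                  (-‿cong (*-congˡ (sym (fromℕ-+ m d))))))

  -- Hypergraphs given by a property of subsets, and their sizes.

  lookup-injective : ∀ {A : Set} {xs : L.List A} → Unique xs → ∀ {i j} → L.lookup xs i ≡ L.lookup xs j → i ≡ j
  lookup-injective (_ AllPairs.∷ _) {zero}  {zero}  _ = ≡.refl
  lookup-injective (x∉ AllPairs.∷ _) {zero}  {suc j} p = ⊥-elim (All.lookup x∉ (∈-lookup j) p)
  lookup-injective (x∉ AllPairs.∷ _) {suc i} {zero}  p = ⊥-elim (All.lookup x∉ (∈-lookup i) (≡.sym p))
  lookup-injective (_ AllPairs.∷ u) {suc i} {suc j} p = ≡.cong suc (lookup-injective u p)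

  module _ where
    open L using (_∷_; [])

    sides : L.List Bool
    sides = inside ∷ outside ∷ []

    subsets : ∀ m → L.List (Subset m)
    subsets zero    = Vec.[] ∷ []
    subsets (suc m) = L.cartesianProductWith Vec._∷_ sides (subsets m)

    subsets-unique : ∀ m → Unique (subsets m)
    subsets-unique zero    = All.[] AllPairs.∷ AllPairs.[]
    subsets-unique (suc m) = cartesianProductWith⁺ Vec._∷_ ∷-injective
      (((λ ()) All.∷ All.[]) AllPairs.∷ All.[] AllPairs.∷ AllPairs.[]) (subsets-unique m)

    subsets-complete : ∀ {m} (e : Subset m) → e ∈ₗ subsets m
    subsets-complete Vec.[]      = Any.here ≡.refl
    subsets-complete (s Vec.∷ e) = ∈-cartesianProductWith⁺ Vec._∷_ (side s) (subsets-complete e)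
      where
      side : ∀ s → s ∈ₗ sides
      side inside  = Any.here ≡.refl
      side outside = Any.there (Any.here ≡.refl)

  module _ {ℓ m : ℕ} (P : Subset m → Set) where

    edgesWhere : L.List (Subset m)
    edgesWhere = L.filter (λ e → em {P = ∣ e ∣ ≡ ℓ × P e}) (subsets m)

    ∈-edgesWhere⁻ : ∀ i → ∣ L.lookup edgesWhere i ∣ ≡ ℓ × P (L.lookup edgesWhere i)
    ∈-edgesWhere⁻ i = proj₂ (∈-filter⁻ (λ e → em {P = ∣ e ∣ ≡ ℓ × P e}) {xs = subsets m} (∈-lookup i))

    hypergraphWhere : Hypergraph ℓ m
    hypergraphWhere = record
      { size           = L.length edgesWhere
      ; edge           = L.lookup edgesWhere
      ; edge-injective = lookup-injective (filter⁺ _ (subsets-unique m))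
      ; uniform        = proj₁ ∘ ∈-edgesWhere⁻
      }

    hypergraphWhere-complete : ∀ e → ∣ e ∣ ≡ ℓ → P e → ∃[ i ] e ≡ Hypergraph.edge hypergraphWhere i
    hypergraphWhere-complete e size p = Any.index e∈ , lookup-index e∈
      where e∈ = ∈-filter⁺ (λ e → em {P = ∣ e ∣ ≡ ℓ × P e}) (subsets-complete e) (size , p)

  module _ {ℓ m : ℕ} (H : Hypergraph ℓ m) where
    open Hypergraph H

    -- Double counting of pairs of an edge and one of its ℓ! orderings.
    count-edge-selections :
      tupleSum ones ℓ (λ ω → sum (λ i → ind (Selects (edge i) ω))) ≈ fromℕ size * fromℕ (ℓ !)
    count-edge-selections = begin
      tupleSum ones ℓ (λ ω → sum (λ i → ind (Selects (edge i) ω)))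
        ≈⟨ tupleSum-sum ℓ (λ i ω → ind (Selects (edge i) ω)) ⟩
      sum (λ i → count ℓ (Selects (edge i)))
        ≈⟨ sum-cong-≋ {size} (λ i → trans (count-Selects ℓ (edge i)) (selections i)) ⟩
      sum {size} (λ i → fromℕ (ℓ !))
        ≈⟨ sum-const size (fromℕ (ℓ !)) ⟩
      fromℕ size * fromℕ (ℓ !) ∎
      where
      open ≈-Reasoning
      selections : ∀ i → fromℕ (falling ∣ edge i ∣ ℓ) ≈ fromℕ (ℓ !)
      selections i = fromℕ-cong (≡.trans (≡.cong (λ n → falling n ℓ) (uniform i)) (falling-! ℓ))

    size*!≤count : (F : Vec (Fin m) ℓ → Set) → (∀ i ω → Selects (edge i) ω → F ω) →
      fromℕ size * fromℕ (ℓ !) ≤ count ℓ F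
    size*!≤count F h = ≤-resp count-edge-selections refl (tupleSum-mono (λ _ → 0≤1) ℓ (λ ω →
      sum-ind-unique (λ i j s s′ → edge-injective (Selects-unique ω (uniform i) (uniform j) s s′))
        (λ i → h i ω)))

    count≤size*! : (F : Vec (Fin m) ℓ → Set) → (∀ ω → F ω → ∃[ i ] Selects (edge i) ω) →
      count ℓ F ≤ fromℕ size * fromℕ (ℓ !)
    count≤size*! F h = ≤-resp refl count-edge-selections (tupleSum-mono (λ _ → 0≤1) ℓ (λ ω →
      ind-≤ (λ f → ≤-trans (≤-reflexive (sym (ind-yes (proj₂ (h ω f)))))
                           (term≤sum {size} (λ i → ind-nonneg (Selects (edge i) ω)) (proj₁ (h ω f))))
            (sum-nonneg {size} (λ i → ind-nonneg (Selects (edge i) ω)))))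

    -- Orderings of edges are among the selections from the whole vertex set, and both counts are
    -- multiples of ℓ!.
    size≤C : ℓ ℕ.≤ m → size ℕ.≤ m C ℓ
    size≤C ℓ≤m = ℕₚ.*-cancelʳ-≤ size (m C ℓ) (ℓ !) {{ℓ ℕₚ.!≢0}}
      (fromℕ-cancel-≤ (≤-resp (sym (fromℕ-* size (ℓ !)))
      (trans (count-Selects ℓ ⊤)
        (fromℕ-cong (≡.trans (≡.cong (λ n → falling n ℓ) (∣⊤∣≡n m)) (falling≡C*! ℓ≤m))))
      (size*!≤count (Selects ⊤) (λ i ω → Selects-mono ω (⊑-⊤ (edge i))))))

  -- Duality between fractional matchings and fractional covers.

  ⟨⟩-+ : ∀ {m} (c c′ : Fin m → ℝ) e → (λ v → c v + c′ v) ⟨ e ⟩ ≈ c ⟨ e ⟩ + c′ ⟨ e ⟩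
  ⟨⟩-+ c c′ e = trans (sum-cong-≋ (λ v → distribˡ (χ e v) (c v) (c′ v)))
    (∑-distrib-+ (λ v → χ e v * c v) (λ v → χ e v * c′ v))

  ⟨⟩-* : ∀ {m} r (c : Fin m → ℝ) e → (λ v → r * c v) ⟨ e ⟩ ≈ r * c ⟨ e ⟩
  ⟨⟩-* r c e = trans (sum-cong-≋
    (λ v → solve 3 (λ x r c → x :* (r :* c) := r :* (x :* c)) refl (χ e v) r (c v)))
    (sym (*-distribˡ-sum r (λ v → χ e v * c v)))

  ⟨⟩-0 : ∀ {m} (e : Subset m) → (λ _ → 0#) ⟨ e ⟩ ≈ 0#
  ⟨⟩-0 e = sum-zero (λ v → zeroʳ (χ e v))

  ⟨⟩-basis : ∀ {m} (v : Fin m) e → basis v ⟨ e ⟩ ≈ χ e v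
  ⟨⟩-basis v e = trans (sum-cong-≋ (λ u → *-comm (χ e u) (basis v u))) (sum-basis v (χ e))

  basis-nonneg : ∀ {n} (i j : Fin n) → 0# ≤ basis i j
  basis-nonneg zero    zero    = 0≤1
  basis-nonneg zero    (suc j) = ≤-refl
  basis-nonneg (suc i) zero    = ≤-refl
  basis-nonneg (suc i) (suc j) = basis-nonneg i j

  basis-≤ : ∀ {n} (i j : Fin n) {x} → (i ≡ j → 1# ≤ x) → 0# ≤ x → basis i j ≤ x
  basis-≤ zero    zero    h₁ h₀ = h₁ ≡.refl
  basis-≤ zero    (suc j) h₁ h₀ = h₀
  basis-≤ (suc i) zero    h₁ h₀ = h₀
  basis-≤ (suc i) (suc j) h₁ h₀ = basis-≤ i j (λ p → h₁ (≡.cong suc p)) h₀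

  sum-basis-1 : ∀ {n} (i : Fin n) → sum (basis i) ≈ 1#
  sum-basis-1 i = trans (sum-cong-≋ (λ j → sym (*-identityʳ (basis i j)))) (sum-basis i (λ _ → 1#))

  nonempty : ∀ {m} (e : Subset m) → 1 ℕ.≤ ∣ e ∣ → ∃[ v ] lookup e v ≡ inside
  nonempty (inside  ∷ e) _ = zero , ≡.refl
  nonempty (outside ∷ e) h with nonempty e h
  ... | v , p = suc v , p

  module _ {ℓ m : ℕ} (H : Hypergraph ℓ m) where
    open Hypergraph H

    FractionalCover : (Fin m → ℝ) → Set
    FractionalCover c = (∀ v → 0# ≤ c v) × (∀ i → 1# ≤ c ⟨ edge i ⟩)

    -- Double counting of the products w(e) c(v) over incidences: each edge is covered at least
    -- once, each vertex is loaded at most once.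
    weak-duality : ∀ {c s} → FractionalCover c → HasMatchingOfSize H s → s ≤ sum c
    weak-duality {c} {s} (0≤c , covers) (w , total≈s) = begin
      s                                                 ≈⟨ total≈s ⟨
      sum weight                                        ≈⟨ sum-cong-≋ (λ i → *-identityʳ (weight i)) ⟨
      sum (λ i → weight i * 1#)                         ≤⟨ sum-mono
        (λ i → *-monoˡ-≤ (weight i) (weight≥0 i) (covers i)) ⟩
      sum (λ i → weight i * c ⟨ edge i ⟩)               ≈⟨ sum-cong-≋
        (λ i → *-distribˡ-sum (weight i) (λ v → χ (edge i) v * c v)) ⟩
      sum (λ i → sum (λ v → weight i * (χ (edge i) v * c v)))
        ≈⟨ ∑-comm (λ i v → weight i * (χ (edge i) v * c v)) ⟩
      sum (λ v → sum (λ i → weight i * (χ (edge i) v * c v)))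
        ≈⟨ sum-cong-≋ (λ v → trans
          (sum-cong-≋ (λ i → solve 3 (λ w x c → w :* (x :* c) := c :* (x :* w)) refl (weight i)
          (χ (edge i) v) (c v)))
                                   (sym (*-distribˡ-sum (c v) (λ i → χ (edge i) v * weight i)))) ⟩
      sum (λ v → c v * sum (λ i → χ (edge i) v * weight i))
        ≤⟨ sum-mono (λ v → *-monoˡ-≤ (c v) (0≤c v)
          (≤-resp (sum-cong-≋ (λ i → if-∈? v (edge i) (weight i))) refl (load≤1 v))) ⟩
      sum (λ v → c v * 1#)                              ≈⟨ sum-cong-≋ (λ v → *-identityʳ (c v)) ⟩
      sum c                                             ∎
      where
      open ≤-Reasoning
      open FractionalMatching w

    -- The constraints on a fractional matching of size s that follow from the
    -- load constraints with multipliers c and the size constraint with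
    -- multiplier t.
    Consequence : ℝ → (Fin size → ℝ) → ℝ → Set
    Consequence s α β = Σ[ c ∈ (Fin m → ℝ) ] ∃[ t ]
      ((∀ v → 0# ≤ c v) × (∀ i → α i ≤ c ⟨ edge i ⟩ - t) × sum c - t * s ≤ β)

    -- Non-negativity of the weights is built into the inequality for `α i`, which gives `lower`.
    -- The bound w(e) ≤ 1 is the load constraint at some vertex of e, so edges must be non-empty,
    -- whence ℓ ≥ 1. The multiplier t has no sign, as the size is prescribed by an equation.
    consequences-cone : 1 ℕ.≤ ℓ → ∀ s → IsBoxedCone (Consequence s)
    consequences-cone 1≤ℓ s = record
      { resp  = λ p q (c , t , 0≤c , h , b) → c , t , 0≤c ,
          (λ i → ≤-resp (p i) refl (h i)) , ≤-resp refl q b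
      ; add   = λ (c , t , 0≤c , h , b) (c′ , t′ , 0≤c′ , h′ , b′) → (λ v → c v + c′ v) , t + t′ ,
          (λ v → +-nonneg (0≤c v) (0≤c′ v)) ,
          (λ i → ≤-resp refl (trans
              (solve 4 (λ x t x′ t′ → (x :- t) :+ (x′ :- t′) := (x :+ x′) :- (t :+ t′)) refl (c ⟨ edge i ⟩)
                t (c′ ⟨ edge i ⟩) t′)
              (+-congʳ (sym (⟨⟩-+ c c′ (edge i))))) (+-mono-≤ (h i) (h′ i))) ,
          ≤-resp (trans
              (solve 5 (λ x t x′ t′ s → (x :- t :* s) :+ (x′ :- t′ :* s) := (x :+ x′) :- (t :+ t′) :* s)
                refl (sum c) t (sum c′) t′ s)
              (+-congʳ (sym (∑-distrib-+ c c′)))) refl (+-mono-≤ b b′)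
      ; scale = λ r 0<r (c , t , 0≤c , h , b) → (λ v → r * c v) , r * t ,
          (λ v → *-nonneg (<⇒≤ 0<r) (0≤c v)) ,
          (λ i → ≤-resp refl (trans
              (solve 3 (λ r x t → r :* (x :- t) := r :* x :- r :* t) refl r (c ⟨ edge i ⟩) t)
              (+-congʳ (sym (⟨⟩-* r c (edge i))))) (*-monoˡ-≤ r (<⇒≤ 0<r) (h i))) ,
          ≤-resp (trans
              (solve 4 (λ r x t s → r :* (x :- t :* s) := r :* x :- (r :* t) :* s) refl r (sum c) t s)
              (+-congʳ (*-distribˡ-sum r c))) refl (*-monoˡ-≤ r (<⇒≤ 0<r) b)
      ; lower = λ i → (λ _ → 0#) , 0# , (λ _ → ≤-refl) ,
          (λ j → ≤-by (basis-nonneg i j) (trans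
              (solve 1 (λ d → d := (con (+ 0) :- con (+ 0)) :- :- d) refl (basis i j))
              (+-congʳ (+-congʳ (sym (⟨⟩-0 (edge j))))))) ,
          ≤-reflexive (trans (+-congʳ (sum-zero {m} (λ _ → refl)))
            (solve 1 (λ s → con (+ 0) :- con (+ 0) :* s := con (+ 0)) refl s))
      ; upper = λ i → let (v , v∈i) = nonempty (edge i) (≡.subst (1 ℕ.≤_) (≡.sym (uniform i)) 1≤ℓ) in
          basis v , 0# , basis-nonneg v ,
          (λ j → ≤-resp refl (trans (solve 1 (λ x → x := x :- con (+ 0)) refl (χ (edge j) v))
            (+-congʳ (sym (⟨⟩-basis v (edge j)))))
              (basis-≤ i j (λ { ≡.refl →
                ≤-reflexive (sym (reflexive (≡.cong (λ b → if b then 1# else 0#) v∈i))) })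
                (χ-nonneg (edge j) v))) ,
          ≤-reflexive (trans (+-congʳ (sum-basis-1 v))
            (solve 1 (λ s → con (+ 1) :- con (+ 0) :* s := con (+ 1)) refl s))
      }

    -- A contradiction says t ≤ c(e) for every edge and Σ c < t s. As Σ c ≥ 0 and s > 0, t is
    -- positive, and c / t is the cover.
    contradiction⇒cover : ∀ {s} → 0# < s → Contradictory (Consequence s) →
      Σ[ c ∈ (Fin m → ℝ) ] (FractionalCover c × sum c < s)
    contradiction⇒cover {s} 0<s (β , β<0 , c , t , 0≤c , h , b) =
      (λ v → r * c v) , ((λ v → *-nonneg (<⇒≤ 0<r) (0≤c v)) , covers) , small
      where
      Σc-ts<0 : sum c - t * s < 0#
      Σc-ts<0 = ≤-<-trans b β<0
      0<t : 0# < t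
      0<t with t ≤? 0#
      ... | inj₂ p   = p
      ... | inj₁ t≤0 = ⊥-elim (<⇒≱ Σc-ts<0 (≤-resp refl
              (solve 3 (λ x t s → x :+ (con (+ 0) :- t) :* s := x :- t :* s) refl (sum c) t s)
              (+-nonneg (sum-nonneg 0≤c) (*-nonneg (0≤y-x t≤0) (<⇒≤ 0<s)))))
      r = t ⁻¹
      0<r = ⁻¹-pos 0<t
      rt≈1 : r * t ≈ 1#
      rt≈1 = trans (*-comm r t) (x*x⁻¹≈1 0<t)
      covers : ∀ i → 1# ≤ (λ v → r * c v) ⟨ edge i ⟩
      covers i = ≤-by (*-nonneg (<⇒≤ 0<r) (h i)) (trans
        (solve 3 (λ r x t → r :* (x :- t) := r :* x :- r :* t) refl r (c ⟨ edge i ⟩) t)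
        (+-cong (sym (⟨⟩-* r c (edge i))) (-‿cong rt≈1)))
      small : sum (λ v → r * c v) < s
      small = <-by (*-pos 0<r (0<y-x Σc-ts<0)) (trans
        (solve 4 (λ r x t s → r :* (con (+ 0) :- (x :- t :* s)) := (r :* t) :* s :- r :* x) refl r (sum c) t s)
        (+-cong (trans (*-congʳ rt≈1) (*-identityˡ s)) (-‿cong (*-distribˡ-sum r c))))

    solution⇒matching : ∀ {s} → 1 ℕ.≤ ℓ → (w : Fin size → ℝ) →
      (∀ {α β} → Consequence s α β → sum (λ i → α i * w i) ≤ β) → HasMatchingOfSize H s
    solution⇒matching {s} 1≤ℓ w solves = record
      { weight   = w
      ; weight≥0 = λ i → ≤-by (0≤y-x (solves (lower i))) (trans
          (+-congˡ (-‿cong (trans (sum-cong-≋ (λ j → sym (-‿distribˡ-* (basis i j) (w j))))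
            (trans (sum-neg (λ j → basis i j * w j)) (-‿cong (sum-basis i w))))))
          (solve 1 (λ w → con (+ 0) :- (:- w) := w :- con (+ 0)) refl (w i)))
      ; weight≤1 = λ i → ≤-resp (sum-basis i w) refl (solves (upper i))
      ; load≤1   = λ v → ≤-resp (sum-cong-≋ (λ i → sym (if-∈? v (edge i) (w i)))) refl (solves (load v))
      } , ≤-antisym
        (≤-resp (sum-cong-≋ (λ i → *-identityˡ (w i))) refl (solves at-most))
        (≤-by (0≤y-x (solves at-least)) (trans
          (+-congˡ (-‿cong (trans (sum-cong-≋
            (λ i → trans (sym (-‿distribˡ-* 1# (w i))) (-‿cong (*-identityˡ (w i))))) (sum-neg w))))
          (solve 2 (λ s t → (:- s) :- (:- t) := t :- s) refl s (sum w))))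
      where
      open IsBoxedCone (consequences-cone 1≤ℓ s)
      sum-neg : ∀ {n} (f : Fin n → ℝ) → sum (λ i → - f i) ≈ - sum f
      sum-neg {zero}  f = sym -0#≈0#
      sum-neg {suc n} f = trans (+-congˡ (sum-neg (f ∘ suc))) (-‿+-comm (f zero) (sum (f ∘ suc)))
      load : ∀ v → Consequence s (λ i → χ (edge i) v) 1#
      load v = basis v , 0# , basis-nonneg v ,
        (λ i → ≤-reflexive (trans (sym (⟨⟩-basis v (edge i)))
          (solve 1 (λ x → x := x :- con (+ 0)) refl (basis v ⟨ edge i ⟩)))) ,
        ≤-reflexive (trans (+-congʳ (sum-basis-1 v))
          (solve 1 (λ s → con (+ 1) :- con (+ 0) :* s := con (+ 1)) refl s))
      -- The size equation is recovered as two inequalities, with multipliers -1 and 1.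
      at-most : Consequence s (λ _ → 1#) s
      at-most = (λ _ → 0#) , - 1# , (λ _ → ≤-refl) ,
        (λ i → ≤-reflexive (trans (solve 0 (con (+ 1) := con (+ 0) :- (:- con (+ 1))) refl)
          (+-congʳ (sym (⟨⟩-0 (edge i)))))) ,
        ≤-reflexive (trans (+-congʳ (sum-zero {m} (λ _ → refl)))
          (solve 1 (λ s → con (+ 0) :- (:- con (+ 1)) :* s := s) refl s))
      at-least : Consequence s (λ _ → - 1#) (- s)
      at-least = (λ _ → 0#) , 1# , (λ _ → ≤-refl) ,
        (λ i → ≤-reflexive (trans (solve 0 (:- con (+ 1) := con (+ 0) :- con (+ 1)) refl)
          (+-congʳ (sym (⟨⟩-0 (edge i)))))) ,
        ≤-reflexive (trans (+-congʳ (sum-zero {m} (λ _ → refl)))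
          (solve 1 (λ s → con (+ 0) :- con (+ 1) :* s := :- s) refl s))

    strong-duality : ∀ {s} → 1 ℕ.≤ ℓ → 0# < s → ¬ HasMatchingOfSize H s →
      Σ[ c ∈ (Fin m → ℝ) ] (FractionalCover c × sum c < s)
    strong-duality {s} 1≤ℓ 0<s unmatched with em {P = Contradictory (Consequence s)}
    ... | yes contradictory = contradiction⇒cover 0<s contradictory
    ... | no consistent with solvable size (consequences-cone 1≤ℓ s) consistent
    ...   | w , solves = ⊥-elim (unmatched (solution⇒matching 1≤ℓ w solves))

  -- Finite product spaces

  eventually-Fin : ∀ {k} {P : Fin k → ℕ → Set} → (∀ x → Eventually (P x)) → Eventually (λ n → ∀ x → P x n)
  eventually-Fin {zero}  h = 0 , λ _ _ ()
  eventually-Fin {suc k} h = eventually-map (λ { n (p , ps) zero → p ; n (p , ps) (suc x) → ps x })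
    (eventually-× (h zero) (eventually-Fin (h ∘ suc)))

  eventually-Vec : ∀ {k} ℓ {P : Vec (Fin k) ℓ → ℕ → Set} → (∀ ω → Eventually (P ω)) →
    Eventually (λ n → ∀ ω → P ω n)
  eventually-Vec zero    h = eventually-map (λ { n p [] → p }) (h [])
  eventually-Vec (suc ℓ) h = eventually-map (λ { n p (x ∷ ω) → p x ω })
    (eventually-Fin (λ x → eventually-Vec ℓ (λ ω → h (x ∷ ω))))

  1^ : ∀ n → 1# ^ n ≈ 1#
  1^ zero    = refl
  1^ (suc n) = trans (*-identityˡ _) (1^ n)

  -- The space of ℓ-tuples of points under product weights. Every predicate counts as an event, so
  -- measurability is trivial; independence and the mean remain to be computed.
  module FiniteProduct {k : ℕ} (ℓ : ℕ) (q c : Fin k → ℝ)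
    (0≤q : ∀ x → 0# ≤ q x) (Σq≈1 : sum q ≈ 1#) (0≤c : ∀ x → 0# ≤ c x)
    (mean-c : sum (λ x → q x * c x) ≈ 1#) where

    pr : Pred (Vec (Fin k) ℓ) 0ℓ → ℝ
    pr A = tupleSum q ℓ (λ ω → ind (A ω))

    -- There are finitely many tuples, so from some stage on every tuple of the union lies in one of
    -- the sets listed so far, and that partial sum already dominates the whole.
    pr-union : ∀ {A : ℕ → Pred (Vec (Fin k) ℓ) 0ℓ} → (∀ {i j} → i ≢ j → ∀ {ω} → A i ω × A j ω → Empty) →
      IsSupremum (λ y → ∃[ n ] y ≈ sum {n} (λ i → pr (A (toℕ i)))) (pr (⋃ ℕ A))
    pr-union {A} disjoint = upper , least
      where
      partial : ∀ n → tupleSum q ℓ (λ ω → sum {n} (λ i → ind (A (toℕ i) ω))) ≈ sum {n} (λ i → pr (A (toℕ i)))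
      partial n = tupleSum-sum ℓ {n} (λ i ω → ind (A (toℕ i) ω))
      upper : IsUpperBound (λ y → ∃[ n ] y ≈ sum {n} (λ i → pr (A (toℕ i)))) (pr (⋃ ℕ A))
      upper (n , y≈) = ≤-resp (trans (partial n) (sym y≈)) refl (tupleSum-mono 0≤q ℓ (λ ω →
        sum-ind-unique {n} (λ i j p p′ → same i j p p′) (λ i p → toℕ i , p)))
        where
        same : ∀ (i j : Fin n) {ω} → A (toℕ i) ω → A (toℕ j) ω → i ≡ j
        same i j p p′ with i Finₚ.≟ j
        ... | yes eq = eq
        ... | no i≢j = ⊥-elim (disjoint (λ eq → i≢j (Finₚ.toℕ-injective eq)) (p , p′))
      Reached : Vec (Fin k) ℓ → ℕ → Set
      Reached ω n = ⋃ ℕ A ω → ∃[ i ] (i ℕ.< n × A i ω)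
      reached : ∀ ω → Eventually (Reached ω)
      reached ω with em {P = ⋃ ℕ A ω}
      ... | yes (i , p) = suc i , λ n i<n _ → i , i<n , p
      ... | no ¬p       = 0 , λ n _ p → ⊥-elim (¬p p)
      least : ∀ {y} → IsUpperBound (λ y → ∃[ n ] y ≈ sum {n} (λ i → pr (A (toℕ i)))) y → pr (⋃ ℕ A) ≤ y
      least bound with eventually-Vec ℓ reached
      ... | n , h = ≤-trans (≤-resp refl (partial n) (tupleSum-mono 0≤q ℓ λ ω → ind-≤
              (λ p → let (i , i<n , a) = h n ℕₚ.≤-refl ω p in
                 ≤-trans (≤-reflexive (sym (ind-yes (≡.subst (λ i → A i ω) (≡.sym (Finₚ.toℕ-fromℕ< i<n)) a))))
                         (term≤sum {n} (λ i → ind-nonneg (A (toℕ i) ω)) (fromℕ< i<n)))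
              (sum-nonneg {n} (λ i → ind-nonneg (A (toℕ i) ω)))))
            (bound (n , refl))

    tupleSum-const : ∀ ℓ a → tupleSum q ℓ (λ _ → a) ≈ a
    tupleSum-const ℓ a = trans (tupleSum-cong ℓ (λ _ → sym (*-identityʳ a))) (trans (tupleSum-*ˡ ℓ a (λ _ → 1#))
      (trans (*-congˡ (trans (tupleSum-1 ℓ) (trans (^-congˡ ℓ Σq≈1) (1^ ℓ)))) (*-identityʳ a)))

    -- Every other coordinate integrates to the total mass 1.
    marginal : ∀ {ℓ} (i : Fin ℓ) (f : Fin k → ℝ) → tupleSum q ℓ (λ ω → f (lookup ω i)) ≈ sum (λ x → q x * f x)
    marginal {suc ℓ} zero    f = sum-cong-≋ (λ x → *-congˡ (tupleSum-const ℓ (f x)))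
    marginal {suc ℓ} (suc i) f = begin
      sum (λ x → q x * tupleSum q ℓ (λ ω → f (lookup ω i)))  ≈⟨ *-distribʳ-sum
        (tupleSum q ℓ (λ ω → f (lookup ω i))) q ⟨
      sum q * tupleSum q ℓ (λ ω → f (lookup ω i))            ≈⟨ *-cong Σq≈1 (marginal i f) ⟩
      1# * sum (λ x → q x * f x)                             ≈⟨ *-identityˡ _ ⟩
      sum (λ x → q x * f x)                                  ∎
      where open ≈-Reasoning

    space : ProbabilitySpace
    space = record
      { Ω              = Vec (Fin k) ℓ
      ; Event          = λ _ → Lift _ Unit
      ; isSigmaAlgebra = record
        { resp  = λ _ _ → lift tt
        ; whole = lift tt
        ; compl = λ _ → lift tt
        ; union = λ _ → lift tt
        }
      ; Pr             = pr
      ; Pr-cong        = λ _ _ (f , g) → tupleSum-cong ℓ (λ ω → ind-cong f g)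
      ; Pr-nonneg      = λ {A} _ → tupleSum-nonneg 0≤q ℓ (λ ω → ind-nonneg (A ω))
      ; Pr-whole       = trans (tupleSum-cong ℓ (λ ω → ind-yes tt)) (tupleSum-const ℓ 1#)
      ; Pr-union       = λ _ disjoint → pr-union disjoint
      }

    X : Fin ℓ → Vec (Fin k) ℓ → ℝ
    X i ω = c (lookup ω i)

    fibre-integral : ∀ i → sum (λ x → c x * pr (λ ω → lookup ω i ≡ x)) ≈ 1#
    fibre-integral i = trans (sum-cong-≋ (λ x → trans
      (*-congˡ (trans (marginal i (λ y → ind (y ≡ x)))
        (trans (sum-single x (λ y y≢x → trans (*-congˡ (ind-no y≢x)) (zeroʳ (q y))))
          (trans (*-congˡ (ind-yes ≡.refl)) (*-identityʳ (q x))))))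
      (*-comm (c x) (q x)))) mean-c

    -- The supremum is attained: the fibres of coordinate i, with values `c`, form a simple function
    -- equal to `X i`. Any other simple function below `X i` is compared pointwise.
    hasMean : ∀ i → HasMean space (X i) 1#
    hasMean i = (λ (φ , below , y≈) → ≤-trans (≤-reflexive y≈) (integral≤1 φ below)) ,
      λ bound → bound (fibres , (λ x eq → ≤-reflexive (reflexive (≡.cong c (≡.sym eq)))) ,
        sym (fibre-integral i))
      where
      fibres : SimpleFunction space
      fibres = record
        { count         = k
        ; cell          = λ x ω → lookup ω i ≡ x
        ; cell-event    = λ _ → lift tt
        ; cell-disjoint = λ x≢y (p , q) → x≢y (≡.trans (≡.sym p) q)
        ; cell-exhaust  = λ ω → lookup ω i , ≡.refl
        ; value         = c
        ; value-nonneg  = 0≤c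
        }
      integral≤1 : (φ : SimpleFunction space) → SimpleFunction.IsBelow φ (X i) → SimpleFunction.integral φ ≤ 1#
      integral≤1 φ below = begin
        sum (λ j → value j * pr (cell j))
          ≈⟨ sum-cong-≋ (λ j → tupleSum-*ˡ ℓ (value j) (λ ω → ind (cell j ω))) ⟨
        sum (λ j → tupleSum q ℓ (λ ω → value j * ind (cell j ω)))
          ≈⟨ tupleSum-sum ℓ (λ j ω → value j * ind (cell j ω)) ⟨
        tupleSum q ℓ (λ ω → sum (λ j → value j * ind (cell j ω)))
          ≤⟨ tupleSum-mono 0≤q ℓ pointwise ⟩
        tupleSum q ℓ (X i)
          ≈⟨ trans (marginal i c) mean-c ⟩
        1# ∎
        where
        open SimpleFunction φ
        open ≤-Reasoning
        pointwise : ∀ ω → sum (λ j → value j * ind (cell j ω)) ≤ X i ω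
        pointwise ω with cell-exhaust ω
        ... | j , ω∈j = ≤-trans (≤-reflexive (trans
                (sum-single j (λ j′ j′≢j →
                  trans (*-congˡ (ind-no (λ p → cell-disjoint j′≢j (p , ω∈j)))) (zeroʳ (value j′))))
                (trans (*-congˡ (ind-yes ω∈j)) (*-identityʳ (value j)))))
              (below j ω∈j)

    iid : NonNegativeIID ℓ
    iid = record
      { space                  = space
      ; X                      = X
      ; isRandomVariable       = λ _ _ → lift tt
      ; nonneg                 = λ i ω → 0≤c (lookup ω i)
      ; identicallyDistributed = λ i j {B} _ →
        trans (marginal i (λ x → ind (B (c x)))) (sym (marginal j (λ x → ind (B (c x)))))
      ; independent            = λ {B} _ → trans
          (tupleSum-cong ℓ (λ ω → ind-∀ (λ i → B i (X i ω))))
          (trans (tupleSum-product ℓ (λ i x → ind (B i (c x))))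
            (product-cong (λ i → sym (marginal i (λ x → ind (B i (c x)))))))
      ; mean                   = hasMean
      }

  -- Discretisation of random variables

  -- The sequence A, B, B, ... derives binary unions and intersections from countable ones.
  pair : ∀ {Ω : Set} → Pred Ω 0ℓ → Pred Ω 0ℓ → ℕ → Pred Ω 0ℓ
  pair A B zero    = A
  pair A B (suc _) = B

  module SigmaAlgebra {Ω : Set} {𝓕 : Pred (Pred Ω 0ℓ) (lsuc 0ℓ)} (isσ : IsSigmaAlgebra 𝓕) where
    open IsSigmaAlgebra isσ public

    ∅-closed : 𝓕 ∅
    ∅-closed = resp ((λ ¬u → ¬u tt) , λ ()) (compl whole)

    ∪-closed : ∀ {A B} → 𝓕 A → 𝓕 B → 𝓕 (A ∪ B)
    ∪-closed {A} {B} a b = resp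
      ((λ { (zero , p) → inj₁ p ; (suc _ , p) → inj₂ p }) , λ { (inj₁ p) → 0 , p ; (inj₂ p) → 1 , p })
      (union {A = pair A B} λ { zero → a ; (suc _) → b })

    ⋂-closed : ∀ {A : ℕ → Pred Ω 0ℓ} → (∀ n → 𝓕 (A n)) → 𝓕 (⋂ ℕ A)
    ⋂-closed h = resp ((λ ¬∃ n → decidable-stable em (λ ¬p → ¬∃ (n , ¬p))) , λ { ps (n , ¬p) → ¬p (ps n) })
      (compl (union (λ n → compl (h n))))

    ∩-closed : ∀ {A B} → 𝓕 A → 𝓕 B → 𝓕 (A ∩ B)
    ∩-closed {A} {B} a b = resp ((λ h → h 0 , h 1) , λ { (p , q) zero → p ; (p , q) (suc _) → q })
      (⋂-closed {A = pair A B} λ { zero → a ; (suc _) → b })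

    const-closed : ∀ (P : Set) → 𝓕 (λ _ → P)
    const-closed P with em {P = P}
    ... | yes p = resp ((λ _ → p) , λ _ → tt) whole
    ... | no ¬p = resp ((λ ()) , λ p → ⊥-elim (¬p p)) ∅-closed

    →-closed : ∀ (P : Set) {A} → 𝓕 A → 𝓕 (λ ω → P → A ω)
    →-closed P a with em {P = P}
    ... | yes p = resp ((λ q _ → q) , λ h → h p) a
    ... | no ¬p = resp ((λ _ p → ⊥-elim (¬p p)) , λ _ → tt) whole

    ∀-Fin-closed : ∀ {k} {A : Fin k → Pred Ω 0ℓ} → (∀ x → 𝓕 (A x)) → 𝓕 (⋂ (Fin k) A)
    ∀-Fin-closed {zero}  h = resp ((λ _ ()) , λ _ → tt) whole
    ∀-Fin-closed {suc k} h = resp ((λ { (p , ps) zero → p ; (p , ps) (suc x) → ps x }) , λ h → h zero , h ∘ suc)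
      (∩-closed (h zero) (∀-Fin-closed (h ∘ suc)))

    ∃-Fin-closed : ∀ {k} {A : Fin k → Pred Ω 0ℓ} → (∀ x → 𝓕 (A x)) → 𝓕 (⋃ (Fin k) A)
    ∃-Fin-closed {zero}  h = resp ((λ ()) , λ ()) ∅-closed
    ∃-Fin-closed {suc k} h = resp
      ((λ { (inj₁ p) → zero , p ; (inj₂ (x , p)) → suc x , p }) ,
        λ { (zero , p) → inj₁ p ; (suc x , p) → inj₂ (x , p) })
      (∪-closed (h zero) (∃-Fin-closed (h ∘ suc)))

    ∃-Vec-closed : ∀ {k} ℓ {A : Vec (Fin k) ℓ → Pred Ω 0ℓ} → (∀ v → 𝓕 (A v)) → 𝓕 (⋃ (Vec (Fin k) ℓ) A)
    ∃-Vec-closed zero    h = resp (([] ,_) , λ { ([] , p) → p }) (h [])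
    ∃-Vec-closed (suc ℓ) h = resp ((λ (x , v , p) → x ∷ v , p) , λ { (x ∷ v , p) → x , v , p })
      (∃-Fin-closed (λ x → ∃-Vec-closed ℓ (λ v → h (x ∷ v))))

  -- Borel sets, finite additivity and partitions.

  borel : IsSigmaAlgebra Borel
  borel = record
    { resp  = Borel.resp
    ; whole = opens (λ x _ → x - 1# , 1# + x , x-1<x x , x<1+x x , λ _ _ _ → tt)
    ; compl = Borel.compl
    ; union = Borel.union
    }

  below-borel : ∀ b → Borel (_< b)
  below-borel b = opens (λ x x<b → x - 1# , b , x-1<x x , x<b , λ _ _ y<b → y<b)

  above-borel : ∀ a → Borel (a ≤_)
  above-borel a = Borel.resp ((λ x≮a → decidable-stable em (λ a≰x → x≮a (≰⇒> a≰x))) , λ a≤x x<a → <⇒≱ x<a a≤x)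
    (Borel.compl (below-borel a))

  module Measure (P : ProbabilitySpace) where
    open ProbabilitySpace P
    open SigmaAlgebra isSigmaAlgebra public

    -- The empty set is the disjoint union of copies of itself, and the partial sum of two copies
    -- gives p + p ≤ p.
    Pr-∅ : Pr ∅ ≈ 0#
    Pr-∅ = ≤-antisym
      (≤-by (0≤y-x (≤-resp refl (Pr-cong (union (λ _ → ∅-closed)) ∅-closed ((λ ()) , λ ()))
          (proj₁ (Pr-union {A = λ _ → ∅} (λ _ → ∅-closed) (λ _ ())) (2 , refl))))
        (solve 1 (λ p → p :- (p :+ (p :+ con (+ 0))) := con (+ 0) :- p) refl (Pr ∅)))
      (Pr-nonneg ∅-closed)

    -- Countable additivity for A, B, ∅, ∅, ..., whose partial sums are constant from the second on.
    Pr-∪ : ∀ {A B} → Event A → Event B → A ⊥ B → Pr (A ∪ B) ≈ Pr A + Pr B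
    Pr-∪ {A} {B} a b A⊥B = trans
      (Pr-cong (∪-closed a b) (union events)
        ((λ { (inj₁ p) → 0 , p ; (inj₂ p) → 1 , p }) , λ { (0 , p) → inj₁ p ; (1 , p) → inj₂ p }))
      (≤-antisym (proj₂ total λ { (n , y≈) → ≤-trans (≤-reflexive y≈) (partial n) })
        (≤-resp (solve 2 (λ a b → a :+ (b :+ con (+ 0)) := a :+ b) refl (Pr A) (Pr B)) refl
          (proj₁ total (2 , refl))))
      where
      seq : ℕ → Pred Ω 0ℓ
      seq 0 = A
      seq 1 = B
      seq _ = ∅
      events : ∀ n → Event (seq n)
      events 0 = a
      events 1 = b
      events (suc (suc _)) = ∅-closed
      disjoint : ∀ {i j} → i ≢ j → seq i ⊥ seq j
      disjoint {0} {0} i≢j _ = i≢j ≡.refl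
      disjoint {0} {1} i≢j p = A⊥B p
      disjoint {1} {0} i≢j (p , q) = A⊥B (q , p)
      disjoint {1} {1} i≢j _ = i≢j ≡.refl
      disjoint {0} {suc (suc j)} i≢j ()
      disjoint {1} {suc (suc j)} i≢j ()
      disjoint {suc (suc i)} i≢j ()
      total = Pr-union events disjoint
      partial : ∀ n → sum {n} (λ i → Pr (seq (toℕ i))) ≤ Pr A + Pr B
      partial 0 = +-nonneg (Pr-nonneg a) (Pr-nonneg b)
      partial 1 = +-monoʳ-≤ (Pr A) (Pr-nonneg b)
      partial (suc (suc n)) = +-monoʳ-≤ (Pr A)
        (≤-reflexive (trans (+-congˡ (sum-zero {n} (λ _ → Pr-∅))) (+-identityʳ _)))

    Pr-mono : ∀ {A B} → Event A → Event B → A ⊆ B → Pr A ≤ Pr B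
    Pr-mono {A} {B} a b A⊆B = ≤-trans (x≤x+y (Pr-nonneg b∖a)) (≤-reflexive (trans
      (sym (Pr-∪ a b∖a (λ { (p , _ , ¬p) → ¬p p })))
      (Pr-cong (∪-closed a b∖a) b ([ A⊆B , proj₁ ]′ , split))))
      where
      b∖a = ∩-closed b (compl a)
      split : B ⊆ A ∪ (B ∩ ∁ A)
      split {ω} p with em {P = A ω}
      ... | yes q = inj₁ q
      ... | no ¬q = inj₂ (p , ¬q)

    Pr≤1 : ∀ {A} → Event A → Pr A ≤ 1#
    Pr≤1 a = ≤-resp refl Pr-whole (Pr-mono a whole (λ _ → tt))

    Pr-⋃-Fin : ∀ {k} {A : Fin k → Pred Ω 0ℓ} → (∀ x → Event (A x)) → (∀ {x y} → x ≢ y → A x ⊥ A y) →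
      Pr (⋃ (Fin k) A) ≈ sum (λ x → Pr (A x))
    Pr-⋃-Fin {zero}  h _ = trans (Pr-cong (∃-Fin-closed h) ∅-closed ((λ ()) , λ ())) Pr-∅
    Pr-⋃-Fin {suc k} {A} h disjoint = trans
      (Pr-cong (∃-Fin-closed h) (∪-closed (h zero) (∃-Fin-closed (h ∘ suc)))
        ((λ { (zero , p) → inj₁ p ; (suc x , p) → inj₂ (x , p) }) ,
          λ { (inj₁ p) → zero , p ; (inj₂ (x , p)) → suc x , p }))
      (trans (Pr-∪ (h zero) (∃-Fin-closed (h ∘ suc))
        (λ { (p , x , q) → disjoint {zero} {suc x} (λ ()) (p , q) }))
        (+-congˡ (Pr-⋃-Fin (h ∘ suc) (λ x≢y → disjoint (λ eq → x≢y (Finₚ.suc-injective eq))))))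

    record Partition (k : ℕ) (C : Fin k → Pred Ω 0ℓ) : Set₁ where
      field
        event    : ∀ x → Event (C x)
        disjoint : ∀ {x y} → x ≢ y → C x ⊥ C y
        exhaust  : ∀ ω → ∃[ x ] C x ω

    module _ {k : ℕ} where

      Pr-partition : ∀ {C : Fin k → Pred Ω 0ℓ} → Partition k C → ∀ {T} → Event T →
        Pr T ≈ sum (λ x → Pr (T ∩ C x))
      Pr-partition {C} π {T} t = trans
        (Pr-cong t (∃-Fin-closed events) ((λ {ω} p → let (x , q) = exhaust ω in x , p , q) , λ (_ , p , _) → p))
        (Pr-⋃-Fin events (λ x≢y ((_ , p) , (_ , q)) → disjoint x≢y (p , q)))
        where
        open Partition π
        events : ∀ x → Event (T ∩ C x)
        events x = ∩-closed t (event x)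

      -- The common refinement of ℓ partitions, taken one at a time: each cell of the first is
      -- absorbed into `T` before the others are applied.
      Pr-partitions : ∀ ℓ {C : Fin ℓ → Fin k → Pred Ω 0ℓ} → (∀ i → Partition k (C i)) → ∀ {T} → Event T →
        Pr T ≈ tupleSum ones ℓ (λ J → Pr (T ∩ ⋂ (Fin ℓ) (λ i → C i (lookup J i))))
      Pr-partitions zero    π t = Pr-cong t (∩-closed t (∀-Fin-closed λ ())) ((λ p → p , λ ()) , proj₁)
      Pr-partitions (suc ℓ) {C} π {T} t = trans (Pr-partition (π zero) t) (sum-cong-≋ (λ x → trans (trans
        (Pr-partitions ℓ (π ∘ suc) (∩-closed t (event (π zero) x)))
        (tupleSum-cong ℓ (λ J → Pr-cong
          (∩-closed (∩-closed t (event (π zero) x)) (∀-Fin-closed (λ i → event (π (suc i)) (lookup J i))))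
          (∩-closed t (∀-Fin-closed (λ i → event (π i) (lookup (x ∷ J) i))))
          ((λ { ((p , q) , r) → p , λ { zero → q ; (suc i) → r i } }) , λ (p , r) → (p , r zero) , r ∘ suc))))
        (sym (*-identityˡ (tupleSum ones ℓ (λ J → Pr (T ∩ ⋂ (Fin (suc ℓ)) (λ i → C i (lookup (x ∷ J) i)))))))))
        where open Partition

  -- Moves the product weights into the integrand, to match the unweighted sum over cells that
  -- `Pr-partitions` produces.
  tupleSum-density : ∀ {k} (q : Fin k → ℝ) ℓ (F : Vec (Fin k) ℓ → ℝ) →
    tupleSum q ℓ F ≈ tupleSum ones ℓ (λ J → product (λ i → q (lookup J i)) * F J)
  tupleSum-density q zero    F = sym (*-identityˡ _)
  tupleSum-density {k} q (suc ℓ) F = sum-cong-≋ (λ x → trans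
    (*-congˡ (tupleSum-density q ℓ (λ J → F (x ∷ J))))
    (trans (sym (tupleSum-*ˡ ℓ (q x) (λ J → product (λ i → q (lookup J i)) * F (x ∷ J))))
      (trans (tupleSum-cong ℓ (λ J → sym (*-assoc (q x) (product (λ i → q (lookup J i))) (F (x ∷ J)))))
        (sym (*-identityˡ (tupleSum ones ℓ (λ J → product (λ i → q (lookup (x ∷ J) i)) * F (x ∷ J))))))))

  -- The half-line [0, ∞) is cut at the multiples of δ up to N δ.
  module Grid (δ : ℝ) (0<δ : 0# < δ) (N : ℕ) where

    point : Fin (suc N) → ℝ
    point j = fromℕ (toℕ j) * δ

    -- The upper end is conditional: the last cell is a half-line, so that finitely many cells cover
    -- all non-negative values.
    Cell : Fin (suc N) → Pred ℝ 0ℓ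
    Cell j x = (point j ≤ x) × (toℕ j ℕ.< N → x < fromℕ (suc (toℕ j)) * δ)

    point-nonneg : ∀ j → 0# ≤ point j
    point-nonneg j = *-nonneg (fromℕ-nonneg (toℕ j)) (<⇒≤ 0<δ)

    cell-borel : ∀ j → Borel (Cell j)
    cell-borel j = ∩-closed (above-borel (point j))
      (→-closed (toℕ j ℕ.< N) (below-borel (fromℕ (suc (toℕ j)) * δ)))
      where open SigmaAlgebra borel

    cells-disjoint : ∀ {i j} → i ≢ j → ∀ {x} → ¬ (Cell i x × Cell j x)
    cells-disjoint {i} {j} i≢j ((pi , qi) , (pj , qj)) with ℕₚ.<-cmp (toℕ i) (toℕ j)
    ... | tri≈ _ eq _ = i≢j (Finₚ.toℕ-injective eq)
    ... | tri< i<j _ _ = <⇒≱ (qi (ℕₚ.<-≤-trans i<j (Finₚ.toℕ≤pred[n] j)))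
                           (≤-trans (*-monoʳ-≤ δ (<⇒≤ 0<δ) (fromℕ-mono i<j)) pj)
    ... | tri> _ _ j<i = <⇒≱ (qj (ℕₚ.<-≤-trans j<i (Finₚ.toℕ≤pred[n] i)))
                           (≤-trans (*-monoʳ-≤ δ (<⇒≤ 0<δ) (fromℕ-mono j<i)) pi)

    locate : ∀ {x} → ∃[ n ] (fromℕ n ≤ x / δ × x / δ < fromℕ (suc n)) → ∃[ j ] Cell j x
    locate (n , n≤ , <n+1) with n ℕₚ.<? N
    ... | yes n<N = j , ≤-resp (*-congʳ (fromℕ-cong (≡.sym j≡n))) (/-* 0<δ) (*-monoʳ-≤ δ (<⇒≤ 0<δ) n≤) ,
            λ _ → ≰⇒> (λ h → <⇒≱ <n+1 (≤-/ 0<δ (≤-resp (*-congʳ (fromℕ-cong (≡.cong suc j≡n))) refl h)))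
      where
      j = fromℕ< (ℕₚ.m<n⇒m<1+n n<N)
      j≡n = Finₚ.toℕ-fromℕ< (ℕₚ.m<n⇒m<1+n n<N)
    ... | no n≮N = Fin.fromℕ N ,
            ≤-resp (*-congʳ (fromℕ-cong (≡.sym (Finₚ.toℕ-fromℕ N)))) (/-* 0<δ)
              (*-monoʳ-≤ δ (<⇒≤ 0<δ) (≤-trans (fromℕ-mono (ℕₚ.≮⇒≥ n≮N)) n≤)) ,
            λ N<N → ⊥-elim (ℕₚ.<-irrefl (Finₚ.toℕ-fromℕ N) N<N)

    cells-exhaust : ∀ {x} → 0# ≤ x → ∃[ j ] Cell j x
    cells-exhaust 0≤x = locate (floor (/-nonneg 0≤x 0<δ))

    module _ {t : ℝ} (t≤Nδ : t ≤ fromℕ N * δ) where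

      opaque
        cell-upper : ∀ j {x} → Cell j x → t ≤ point j ⊎ x ≤ point j + δ
        cell-upper j {x} (_ , q) with toℕ j ℕₚ.<? N
        ... | yes j<N = inj₂ (≤-resp refl
          (solve 2 (λ a d → (con (+ 1) :+ a) :* d := a :* d :+ d) refl (fromℕ (toℕ j)) δ) (<⇒≤ (q j<N)))
        ... | no j≮N  = inj₁ (≤-trans t≤Nδ (*-monoʳ-≤ δ (<⇒≤ 0<δ) (fromℕ-mono (ℕₚ.≮⇒≥ j≮N))))

      opaque
        -- Either some entry lies in the unbounded cell, whose left end alone reaches t, or every
        -- entry exceeds the left end of its cell by at most δ.
        cells-sum-dichotomy : ∀ {ℓ} (x : Fin ℓ → ℝ) (J : Vec (Fin (suc N)) ℓ) →
          (∀ i → Cell (lookup J i) (x i)) →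
          t ≤ sum (λ i → point (lookup J i)) ⊎ sum x ≤ sum (λ i → point (lookup J i)) + fromℕ ℓ * δ
        cells-sum-dichotomy x [] h =
          inj₂ (≤-reflexive (solve 1 (λ d → con (+ 0) := con (+ 0) :+ con (+ 0) :* d) refl δ))
        cells-sum-dichotomy {suc ℓ} x (j ∷ J) h
          with cell-upper j (h zero) | cells-sum-dichotomy (x ∘ suc) J (h ∘ suc)
        ... | inj₁ p | _      = inj₁ (≤-trans p (x≤x+y (sum-nonneg (λ i → point-nonneg (lookup J i)))))
        ... | _      | inj₁ p = inj₁ (≤-trans p (y≤x+y (point-nonneg j)))
        ... | inj₂ p | inj₂ q = inj₂ (≤-resp refl
                (solve 4 (λ a s l d → (a :+ d) :+ (s :+ l :* d) := (a :+ s) :+ (con (+ 1) :+ l) :* d) refl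
                  (point j) (sum (λ i → point (lookup J i))) (fromℕ ℓ) δ)
                (+-mono-≤ p q))

      cells-sum-upper : ∀ {ℓ} (x : Fin ℓ → ℝ) (J : Vec (Fin (suc N)) ℓ) → (∀ i → Cell (lookup J i) (x i)) →
        t ≤ sum x → t ≤ sum (λ i → point (lookup J i)) + fromℕ ℓ * δ
      cells-sum-upper {ℓ} x J h t≤ with cells-sum-dichotomy x J h
      ... | inj₁ p = ≤-trans p (x≤x+y (*-nonneg (fromℕ-nonneg ℓ) (<⇒≤ 0<δ)))
      ... | inj₂ p = ≤-trans t≤ p

  -- Tails of sums of independent variables, and their discretisation.

  module Tail {ℓ : ℕ} (𝒳 : NonNegativeIID ℓ) where
    open NonNegativeIID 𝒳
    open Measure space

    Exceeds : ℝ → Pred Ω 0ℓ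
    Exceeds t ω = t ≤ sum (λ i → X i ω)

    module _ (δ : ℝ) (0<δ : 0# < δ) (N : ℕ) where
      open Grid δ 0<δ N

      rectangle : Vec (Fin (suc N)) ℓ → Pred Ω 0ℓ
      rectangle J = ⋂ (Fin ℓ) (λ i → X i ⊢ Cell (lookup J i))

      rectangle-event : ∀ J → Event (rectangle J)
      rectangle-event J = ∀-Fin-closed (λ i → isRandomVariable i (cell-borel (lookup J i)))

      rectangles-exhaust : ∀ ω → ∃[ J ] rectangle J ω
      rectangles-exhaust ω = go (λ i → X i ω) (λ i → nonneg i ω)
        where
        go : ∀ {ℓ} (x : Fin ℓ → ℝ) → (∀ i → 0# ≤ x i) → ∃[ J ] (∀ i → Cell (lookup J i) (x i))
        go {zero}  x 0≤x = [] , λ ()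
        go {suc ℓ} x 0≤x = let (j , p) = cells-exhaust (0≤x zero) ; (J , ps) = go (x ∘ suc) (0≤x ∘ suc) in
          j ∷ J , λ { zero → p ; (suc i) → ps i }

      NearlyExceeds : ℝ → Vec (Fin (suc N)) ℓ → Set
      NearlyExceeds t J = t ≤ sum (λ i → point (lookup J i)) + fromℕ ℓ * δ

      Approximation : ℝ → Pred Ω 0ℓ
      Approximation t ω = ∃[ J ] (NearlyExceeds t J × rectangle J ω)

      approximation-event : ∀ t → Event (Approximation t)
      approximation-event t = ∃-Vec-closed ℓ
        (λ J → ∩-closed (const-closed (NearlyExceeds t J)) (rectangle-event J))

      exceeds⇒approximation : ∀ {t} → t ≤ fromℕ N * δ → Exceeds t ⊆ Approximation t
      exceeds⇒approximation t≤Nδ {ω} e = let (J , r) = rectangles-exhaust ω in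
        J , cells-sum-upper t≤Nδ (λ i → X i ω) J r e , r

      approximation⇒nearly : ∀ {t ω} → Approximation t ω → t ≤ sum (λ i → X i ω) + fromℕ ℓ * δ
      approximation⇒nearly (J , good , r) =
        ≤-trans good (+-monoˡ-≤ (fromℕ ℓ * δ) (sum-mono (λ i → proj₁ (r i))))

    mesh : ℕ → ℝ
    mesh n = fromℕ (suc n) ⁻¹

    mesh-pos : ∀ n → 0# < mesh n
    mesh-pos n = ⁻¹-pos (fromℕ-pos {suc n} (s≤s z≤n))

    mesh-small : ∀ {ε} → 0# < ε → ∃[ n ] mesh n ≤ ε
    mesh-small {ε} 0<ε = let (n , h) = archimedean (ε ⁻¹) in n , ≤-resp (*-identityˡ (mesh n)) refl (/-≤ (fromℕ-pos {suc n} (s≤s z≤n))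
            (≤-resp (x*x⁻¹≈1 0<ε) refl (*-monoˡ-≤ ε (<⇒≤ 0<ε) (≤-trans h (y≤x+y 0≤1)))))

    -- The event is the intersection of its grid approximations.
    exceeds-event : ∀ t → Event (Exceeds t)
    exceeds-event t = SigmaAlgebra.resp isSigmaAlgebra (from , to)
      (⋂-closed (λ n → approximation-event (mesh n) (mesh-pos n) (size n) t))
      where
      -- The number of cells depends on the mesh, so that the unbounded cell always starts at t or
      -- beyond.
      size : ℕ → ℕ
      size n = proj₁ (archimedean (t / mesh n))
      size-large : ∀ n → t ≤ fromℕ (size n) * mesh n
      size-large n = ≤-resp (/-* (mesh-pos n)) refl
        (*-monoʳ-≤ (mesh n) (<⇒≤ (mesh-pos n)) (proj₂ (archimedean (t / mesh n))))
      to : Exceeds t ⊆ ⋂ ℕ (λ n → Approximation (mesh n) (mesh-pos n) (size n) t)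
      to e n = exceeds⇒approximation (mesh n) (mesh-pos n) (size n) (size-large n) e
      -- The approximation of mesh δ puts t at most ℓ δ above the sum, and δ is arbitrarily small.
      from : ⋂ ℕ (λ n → Approximation (mesh n) (mesh-pos n) (size n) t) ⊆ Exceeds t
      from {ω} h = ≤-from-approximations (fromℕ ℓ) (fromℕ-nonneg ℓ) (λ ε 0<ε _ →
        let (n , mesh≤ε) = mesh-small 0<ε in
        ≤-trans (approximation⇒nearly (mesh n) (mesh-pos n) (size n) (h n))
          (+-monoʳ-≤ (sum (λ i → X i ω)) (*-monoˡ-≤ (fromℕ ℓ) (fromℕ-nonneg ℓ) mesh≤ε)))

    tail≤1 : ∀ t → tail t ≤ 1#
    tail≤1 t = Pr≤1 (exceeds-event t)

    module Discretisation (i₀ : Fin ℓ) (δ : ℝ) (0<δ : 0# < δ) (N : ℕ) where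
      open Grid δ 0<δ N

      q : Fin (suc N) → ℝ
      q j = Pr (X i₀ ⊢ Cell j)

      partition : ∀ i → Partition (suc N) (λ j → X i ⊢ Cell j)
      partition i = record
        { event    = λ j → isRandomVariable i (cell-borel j)
        ; disjoint = λ x≢y {ω} p → cells-disjoint x≢y {X i ω} p
        ; exhaust  = λ ω → cells-exhaust (nonneg i ω)
        }

      q-nonneg : ∀ j → 0# ≤ q j
      q-nonneg j = Pr-nonneg (isRandomVariable i₀ (cell-borel j))

      sum-q : sum q ≈ 1#
      sum-q = trans (sum-cong-≋ (λ j → Pr-cong (event j) (∩-closed ∁-whole (event j)) ((tt ,_) , proj₂)))
        (trans (sym (Pr-partition (partition i₀) ∁-whole)) Pr-whole)
        where
        open Partition (partition i₀) using (event)
        ∁-whole = SigmaAlgebra.whole isSigmaAlgebra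

      -- The left ends of the cells are the values of a simple function below `X i₀`, and its
      -- integral is at most the mean.
      mean-q : sum (λ j → q j * point j) ≤ 1#
      mean-q = ≤-resp (sum-cong-≋ (λ j → *-comm (point j) (q j))) refl
        (proj₁ (mean i₀) (φ , (λ j → proj₁) , refl))
        where
        open Partition (partition i₀)
        φ : SimpleFunction space
        φ = record
          { count         = suc N
          ; cell          = λ j → X i₀ ⊢ Cell j
          ; cell-event    = event
          ; cell-disjoint = disjoint
          ; cell-exhaust  = exhaust
          ; value         = point
          ; value-nonneg  = point-nonneg
          }

      -- The tail is split over the rectangles of the grid. A rectangle that does not nearly exceed
      -- t misses the event; any other contributes at most its own probability, a product by
      -- independence, whose factors are values of `q` by identical distribution.
      tail≤ : ∀ {t} → t ≤ fromℕ N * δ → tail t ≤ tupleSum q ℓ (λ J → ind (NearlyExceeds δ 0<δ N t J))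
      tail≤ {t} t≤Nδ = ≤-resp (sym (Pr-partitions ℓ partition (exceeds-event t)))
        (sym (tupleSum-density q ℓ (λ J → ind (NearlyExceeds δ 0<δ N t J))))
        (tupleSum-mono (λ _ → 0≤1) ℓ bound)
        where
        bound : ∀ J → Pr (Exceeds t ∩ rectangle δ 0<δ N J) ≤
          product (λ i → q (lookup J i)) * ind (NearlyExceeds δ 0<δ N t J)
        bound J with em {P = NearlyExceeds δ 0<δ N t J}
        ... | yes good = ≤-resp refl (sym (*-identityʳ _)) (≤-trans
                (Pr-mono (∩-closed (exceeds-event t) (rectangle-event δ 0<δ N J))
                  (rectangle-event δ 0<δ N J) proj₂)
                (≤-reflexive (trans (independent (λ i → cell-borel (lookup J i)))
                  (product-cong (λ i → identicallyDistributed i i₀ (cell-borel (lookup J i)))))))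
        ... | no bad = ≤-resp refl (sym (zeroʳ _)) (≤-reflexive (trans
                (Pr-cong (∩-closed (exceeds-event t) (rectangle-event δ 0<δ N J)) ∅-closed
                  ((λ {ω} (e , r) → bad (cells-sum-upper t≤Nδ (λ i → X i ω) J r e)) , λ ()))
                Pr-∅))

  -- From fractional covers to random variables

  matchingSize : (ℓ d m : ℕ) → ℝ
  matchingSize ℓ d m = fromℕ (m ℕ.+ d) / fromℕ (ℓ ℕ.+ d)

  -- The vertices receive weight 1 / (m + d) each.  The remaining mass d / (m + d)
  -- sits at one extra point, whose value raises the mean to exactly 1.
  module FromCover {ℓ d m : ℕ} (1≤d : 1 ℕ.≤ d) (c : Fin m → ℝ) (0≤c : ∀ v → 0# ≤ c v)
    (c-small : sum c < matchingSize ℓ d m) where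

    M L D : ℝ
    M = fromℕ (m ℕ.+ d)
    L = fromℕ (ℓ ℕ.+ d)
    D = fromℕ d

    0<D : 0# < D
    0<D = fromℕ-pos 1≤d
    0<M : 0# < M
    0<M = fromℕ-pos (ℕₚ.≤-trans 1≤d (ℕₚ.m≤n+m d m))
    0<L : 0# < L
    0<L = fromℕ-pos (ℕₚ.≤-trans 1≤d (ℕₚ.m≤n+m d ℓ))

    scaled : Fin m → ℝ
    scaled v = L * c v

    scaled-small : sum scaled ≤ M
    scaled-small = ≤-resp (*-distribˡ-sum L c) (trans (*-comm _ _) (/-* 0<L))
      (*-monoˡ-≤ L (<⇒≤ 0<L) (<⇒≤ c-small))

    q value : Fin (suc m) → ℝ
    q     = (M ⁻¹ * D) Vector.∷ (λ _ → M ⁻¹)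
    value = ((M - sum scaled) * D ⁻¹) Vector.∷ scaled

    q-nonneg : ∀ x → 0# ≤ q x
    q-nonneg zero    = *-nonneg (<⇒≤ (⁻¹-pos 0<M)) (<⇒≤ 0<D)
    q-nonneg (suc v) = <⇒≤ (⁻¹-pos 0<M)

    value-nonneg : ∀ x → 0# ≤ value x
    value-nonneg zero    = *-nonneg (0≤y-x scaled-small) (<⇒≤ (⁻¹-pos 0<D))
    value-nonneg (suc v) = *-nonneg (<⇒≤ 0<L) (0≤c v)

    sum-q : sum q ≈ 1#
    sum-q = begin
      M ⁻¹ * D + sum {m} (λ _ → M ⁻¹)   ≈⟨ +-congˡ (sum-const m (M ⁻¹)) ⟩
      M ⁻¹ * D + fromℕ m * M ⁻¹         ≈⟨ solve 3 (λ u d m → u :* d :+ m :* u := (m :+ d) :* u) refl (M ⁻¹)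
        D (fromℕ m) ⟩
      (fromℕ m + D) * M ⁻¹              ≈⟨ *-congʳ (fromℕ-+ m d) ⟨
      M * M ⁻¹                          ≈⟨ x*x⁻¹≈1 0<M ⟩
      1#                                ∎
      where open ≈-Reasoning

    mean-q : sum (λ x → q x * value x) ≈ 1#
    mean-q = begin
      (M ⁻¹ * D) * ((M - S) * D ⁻¹) + sum (λ v → M ⁻¹ * scaled v)
        ≈⟨ +-congˡ (*-distribˡ-sum (M ⁻¹) scaled) ⟨
      (M ⁻¹ * D) * ((M - S) * D ⁻¹) + M ⁻¹ * S
        ≈⟨ solve 5 (λ u d m s e → (u :* d) :* ((m :- s) :* e) :+ u :* s := u :* ((m :- s) :* (d :* e)) :+
          u :* s) refl (M ⁻¹) D M S (D ⁻¹) ⟩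
      M ⁻¹ * ((M - S) * (D * D ⁻¹)) + M ⁻¹ * S
        ≈⟨ +-congʳ (*-congˡ (*-congˡ (x*x⁻¹≈1 0<D))) ⟩
      M ⁻¹ * ((M - S) * 1#) + M ⁻¹ * S
        ≈⟨ solve 3 (λ u m s → u :* ((m :- s) :* con (+ 1)) :+ u :* s := m :* u) refl (M ⁻¹) M S ⟩
      M * M ⁻¹
        ≈⟨ x*x⁻¹≈1 0<M ⟩
      1# ∎
      where
      open ≈-Reasoning
      S = sum scaled

    open FiniteProduct ℓ q value q-nonneg sum-q value-nonneg mean-q public using (iid)

    threshold : ℝ
    threshold = fromℕ ℓ + D

    Heavy : Vec (Fin m) ℓ → Set
    Heavy ω = threshold ≤ sum (λ i → scaled (lookup ω i))

    -- Heavy tuples that avoid the extra point already carry this probability, and tuples through it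
    -- only add. Vertices and points are compared through their values in ℝ.
    scaled-count≤tail : (M ⁻¹) ^ ℓ * count ℓ Heavy ≤ NonNegativeIID.tail iid threshold
    scaled-count≤tail = begin
      (M ⁻¹) ^ ℓ * tupleSum ones ℓ (λ ω → ind (Heavy ω))
        ≈⟨ tupleSum-scale {q = ones} ℓ (M ⁻¹) (λ ω → ind (Heavy ω)) ⟨
      tupleSum w ℓ (λ ω → ind (Heavy ω))
        ≈⟨ tupleSum-cong ℓ (λ ω → ind-lookup-map scaled ω) ⟨
      tupleSum w ℓ (λ ω → F (map scaled ω))
        ≤⟨ tupleSum-push scaled value w-nonneg q-nonneg dominated ℓ F (λ v → ind-nonneg _) ⟩
      tupleSum q ℓ (λ ω → F (map value ω))
        ≈⟨ tupleSum-cong ℓ (λ ω → ind-lookup-map value ω) ⟩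
      tupleSum q ℓ (λ ω → ind (threshold ≤ sum (λ i → value (lookup ω i)))) ∎
      where
      open ≤-Reasoning
      w : Fin m → ℝ
      w v = M ⁻¹ * ones v
      F : Vec ℝ ℓ → ℝ
      F v = ind (threshold ≤ sum (lookup v))
      ind-lookup-map : ∀ {k} (f : Fin k → ℝ) (ω : Vec (Fin k) ℓ) →
        F (map f ω) ≈ ind (threshold ≤ sum (λ i → f (lookup ω i)))
      ind-lookup-map f ω = ind-cong (≤-resp refl same) (≤-resp refl (sym same))
        where same = sum-cong-≋ (λ i → reflexive (lookup-map i f ω))
      w-nonneg : ∀ v → 0# ≤ w v
      w-nonneg v = *-nonneg (<⇒≤ (⁻¹-pos 0<M)) 0≤1
      dominated : (f : ℝ → ℝ) → (∀ s → 0# ≤ f s) →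
        sum (λ v → w v * f (scaled v)) ≤ sum (λ x → q x * f (value x))
      dominated f 0≤f = ≤-trans
        (≤-reflexive (sum-cong-≋ (λ v → *-congʳ {f (scaled v)} (*-identityʳ (M ⁻¹)))))
        (y≤x+y (*-nonneg (q-nonneg zero) (0≤f (value zero))))

    count≤tail : count ℓ Heavy ≤ NonNegativeIID.tail iid threshold * M ^ ℓ
    count≤tail = ≤-resp
      (trans (solve 3 (λ u n p → (u :* n) :* p := n :* (p :* u)) refl ((M ⁻¹) ^ ℓ) (count ℓ Heavy) (M ^ ℓ))
        (trans (*-congˡ (trans (sym (^-distrib-* M (M ⁻¹) ℓ)) (trans (^-congˡ ℓ (x*x⁻¹≈1 0<M)) (1^ ℓ))))
          (*-identityʳ _)))
      refl (*-monoʳ-≤ (M ^ ℓ) (^-nonneg ℓ (<⇒≤ 0<M)) scaled-count≤tail)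

  unmatched⇒iid : ∀ {ℓ d m} → 1 ℕ.≤ ℓ → 1 ℕ.≤ d → (H : Hypergraph ℓ m) →
    ¬ HasMatchingOfSize H (matchingSize ℓ d m) →
    Σ[ 𝒳 ∈ NonNegativeIID ℓ ]
      fromℕ (Hypergraph.size H) * fromℕ (ℓ !) ≤ NonNegativeIID.tail 𝒳 (fromℕ ℓ + fromℕ d) * fromℕ (m ℕ.+ d) ^ ℓ
  unmatched⇒iid {ℓ} {d} {m} 1≤ℓ 1≤d H unmatched =
    iid , ≤-trans (size*!≤count H Heavy heavy) count≤tail
    where
    positive : 0# < matchingSize ℓ d m
    positive = /-pos (fromℕ-pos (ℕₚ.≤-trans 1≤d (ℕₚ.m≤n+m d m))) (fromℕ-pos (ℕₚ.≤-trans 1≤d (ℕₚ.m≤n+m d ℓ)))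
    cover = strong-duality H 1≤ℓ positive unmatched
    c = proj₁ cover
    open FromCover {ℓ} {d} {m} 1≤d c (proj₁ (proj₁ (proj₂ cover))) (proj₂ (proj₂ cover))
    open Hypergraph H
    heavy : ∀ i ω → Selects (edge i) ω → Heavy ω
    heavy i ω s = begin
      fromℕ ℓ + fromℕ d               ≈⟨ fromℕ-+ ℓ d ⟨
      L                               ≈⟨ *-identityʳ L ⟨
      L * 1#                          ≤⟨ *-monoˡ-≤ L (<⇒≤ 0<L) (proj₂ (proj₁ (proj₂ cover)) i) ⟩
      L * c ⟨ edge i ⟩                ≈⟨ ⟨⟩-* L c (edge i) ⟨
      scaled ⟨ edge i ⟩               ≈⟨ Selects-⟨⟩ scaled ω (uniform i) s ⟩
      sum (λ i → scaled (lookup ω i)) ∎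
      where open ≤-Reasoning

  -- From random variables to hypergraphs

  -- τ takes each value y j exactly a j times, and z at the remaining points.
  Places : ∀ {S : Set} {k} → (Fin k → ℕ) → (Fin k → S) → S → ℕ → Set
  Places {S} a y z m = Σ[ τ ∈ (Fin m → S) ] ∃[ r ]
    ((f : S → ℝ) → sum (λ v → f (τ v)) ≈ sum (λ j → fromℕ (a j) * f (y j)) + fromℕ r * f z)

  places : ∀ {S : Set} k (a : Fin k → ℕ) (y : Fin k → S) z m → sum (λ j → fromℕ (a j)) ≤ fromℕ m →
    Places a y z m
  places zero a y z m _ = (λ _ → z) , m , λ f → trans (sum-const m (f z)) (sym (+-identityˡ _))
  places {S} (suc k) a y z m = block (a zero) m
    where
    -- Inner recursion on the copies of `y zero` still to be placed; each uses up one vertex, and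
    -- the bound on the total ensures that the vertices do not run out.
    block : ∀ n m → fromℕ n + sum (λ j → fromℕ (a (suc j))) ≤ fromℕ m → Places (n Vector.∷ (a ∘ suc)) y z m
    block zero m h with places k (a ∘ suc) (y ∘ suc) z m (≤-resp (+-identityˡ _) refl h)
    ... | τ , r , eq = τ , r , λ f →
      trans (eq f) (+-congʳ (sym (trans (+-congʳ (zeroˡ (f (y zero)))) (+-identityˡ _))))
    block (suc n) zero h = ⊥-elim (<⇒≱
      (+-pos-nonneg (fromℕ-pos {suc n} (s≤s z≤n)) (sum-nonneg (λ j → fromℕ-nonneg (a (suc j))))) h)
    block (suc n) (suc m) h with block n m (≤-by (0≤y-x h)
      (solve 3 (λ n s m → (con (+ 1) :+ m) :- ((con (+ 1) :+ n) :+ s) := m :- (n :+ s)) refl (fromℕ n)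
        (sum (λ j → fromℕ (a (suc j)))) (fromℕ m)))
    ... | τ , r , eq = (y zero Vector.∷ τ) , r , λ f → trans (+-congˡ (eq f))
      (solve 4 (λ x n s z → x :+ ((n :* x :+ s) :+ z) := (((con (+ 1) :+ n) :* x) :+ s) :+ z) refl
        (f (y zero)) (fromℕ n) (sum (λ j → fromℕ (a (suc j)) * f (y (suc j)))) (fromℕ r * f z))

  -- A unit of slack ε q m for q > 0 absorbs the rounding error.
  eventually-integer : ∀ {q ε} → 0# ≤ q → 0# < ε → ε < 1# →
    Eventually (λ m → ∃[ a ] ((1# - ε) * (1# - ε) * q * fromℕ m ≤ fromℕ a × fromℕ a ≤ (1# - ε) * q * fromℕ m))
  eventually-integer {q} {ε} 0≤q 0<ε ε<1 = [ vanishing , positive ]′ (q ≤? 0#)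
    where
    e = 1# - ε
    0<e : 0# < e
    0<e = 0<y-x ε<1
    Goal : ℕ → Set
    Goal m = ∃[ a ] (e * e * q * fromℕ m ≤ fromℕ a × fromℕ a ≤ e * q * fromℕ m)
    -- For q = 0 the slack never grows, but then the multiplicity 0 is exact.
    vanishing : q ≤ 0# → Eventually Goal
    vanishing q≤0 = 0 , λ m _ → 0 ,
      ≤-reflexive (trans (*-congʳ (trans (*-congˡ q≈0) (zeroʳ _))) (zeroˡ _)) ,
      ≤-reflexive (sym (trans (*-congʳ (trans (*-congˡ q≈0) (zeroʳ _))) (zeroˡ _)))
      where
      q≈0 : q ≈ 0#
      q≈0 = ≤-antisym q≤0 0≤q
    positive : 0# < q → Eventually Goal
    positive 0<q = eventually-map round (eventually-large (*-pos (*-pos 0<ε 0<e) 0<q) 1#)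
      where
      round : ∀ m → 1# ≤ ε * e * q * fromℕ m → Goal m
      round m slack = let (a , a≤ , <a+1) = floor (*-nonneg (*-nonneg (<⇒≤ 0<e) 0≤q) (fromℕ-nonneg m)) in
        a , ≤-by (+-nonneg (0≤y-x slack) (0≤y-x (<⇒≤ <a+1)))
              (solve 4 (λ ε q m a →
                (ε :* (con (+ 1) :- ε) :* q :* m :- con (+ 1)) :+ ((con (+ 1) :+ a) :- (con (+ 1) :- ε) :* q :* m)
                := a :- (con (+ 1) :- ε) :* (con (+ 1) :- ε) :* q :* m) refl ε q (fromℕ m) (fromℕ a)) ,
            a≤

  -- Values are placed on vertices together with their proofs, so that non-negativity of the vertex
  -- weights comes with the placement.
  NonNegative : Set
  NonNegative = ∃[ x ] 0# ≤ x

  module HeavyHypergraph (ℓ d m : ℕ) (1≤d : 1 ℕ.≤ d) (c : Fin m → ℝ) (0≤c : ∀ v → 0# ≤ c v)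
    (sum-c : sum c ≤ fromℕ m) where

    threshold : ℝ
    threshold = fromℕ ℓ + fromℕ d

    graph : Hypergraph ℓ m
    graph = hypergraphWhere (λ e → threshold ≤ c ⟨ e ⟩)

    open Hypergraph graph

    unmatched : ¬ HasMatchingOfSize graph (matchingSize ℓ d m)
    unmatched matching = <⇒≱ cover-small (weak-duality graph {c = λ v → L ⁻¹ * c v}
      ((λ v → *-nonneg (<⇒≤ (⁻¹-pos 0<L)) (0≤c v)) , covers) matching)
      where
      M L : ℝ
      M = fromℕ (m ℕ.+ d)
      L = fromℕ (ℓ ℕ.+ d)
      0<L : 0# < L
      0<L = fromℕ-pos (ℕₚ.≤-trans 1≤d (ℕₚ.m≤n+m d ℓ))
      covers : ∀ i → 1# ≤ (λ v → L ⁻¹ * c v) ⟨ edge i ⟩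
      covers i = ≤-resp (trans (*-comm (L ⁻¹) L) (x*x⁻¹≈1 0<L)) (sym (⟨⟩-* (L ⁻¹) c (edge i)))
        (*-monoˡ-≤ (L ⁻¹) (<⇒≤ (⁻¹-pos 0<L)) (≤-resp (sym (fromℕ-+ ℓ d)) refl
          (proj₂ (∈-edgesWhere⁻ {ℓ} (λ e → threshold ≤ c ⟨ e ⟩) i))))
      sum-c<M : sum c < M
      sum-c<M = ≤-<-trans sum-c (<-by (fromℕ-pos 1≤d)
        (trans (solve 2 (λ m d → d := (m :+ d) :- m) refl (fromℕ m) (fromℕ d)) (+-congʳ (sym (fromℕ-+ m d)))))
      cover-small : sum (λ v → L ⁻¹ * c v) < matchingSize ℓ d m
      cover-small = <-by (*-pos (⁻¹-pos 0<L) (0<y-x sum-c<M))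
        (trans (solve 3 (λ u M s → u :* (M :- s) := M :* u :- u :* s) refl (L ⁻¹) M (sum c))
          (+-congˡ (-‿cong (*-distribˡ-sum (L ⁻¹) c))))

    Heavy : Vec (Fin m) ℓ → Set
    Heavy ω = threshold ≤ sum (λ i → c (lookup ω i))

    heavy-selection : ∀ ω → Selects ⊤ ω × Heavy ω → ∃[ i ] Selects (edge i) ω
    heavy-selection ω (s , heavy) =
      let (e , size , s′ , _) = Selects-support ω s
          (i , e≡) = hypergraphWhere-complete (λ e → threshold ≤ c ⟨ e ⟩) e size
                       (≤-resp refl (sym (Selects-⟨⟩ c ω size s′)) heavy)
      in i , ≡.subst (λ e → Selects e ω) e≡ s′

    -- Inclusion-exclusion inside the m^ℓ tuples: those that are both heavy and free of repetitions
    -- are orderings of edges.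
    count-heavy≤ : count ℓ Heavy + fromℕ (falling m ℓ) ≤ fromℕ size * fromℕ (ℓ !) + fromℕ m ^ ℓ
    count-heavy≤ = begin
      count ℓ Heavy + fromℕ (falling m ℓ)
        ≈⟨ +-congˡ (trans (count-Selects ℓ ⊤) (fromℕ-cong (≡.cong (λ n → falling n ℓ) (∣⊤∣≡n m)))) ⟨
      count ℓ Heavy + count ℓ (Selects ⊤)
        ≈⟨ tupleSum-+ ℓ (λ ω → ind (Heavy ω)) (λ ω → ind (Selects ⊤ ω)) ⟨
      tupleSum ones ℓ (λ ω → ind (Heavy ω) + ind (Selects ⊤ ω))
        ≤⟨ tupleSum-mono (λ _ → 0≤1) ℓ (λ ω → inclusion-exclusion) ⟩
      tupleSum ones ℓ (λ ω → ind (Selects ⊤ ω × Heavy ω) + 1#)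
        ≈⟨ tupleSum-+ ℓ (λ ω → ind (Selects ⊤ ω × Heavy ω)) (λ _ → 1#) ⟩
      count ℓ (λ ω → Selects ⊤ ω × Heavy ω) + tupleSum ones ℓ (λ _ → 1#)
        ≤⟨ +-mono-≤ (count≤size*! graph (λ ω → Selects ⊤ ω × Heavy ω) heavy-selection)
             (≤-reflexive (trans (tupleSum-1 {q = ones {m}} ℓ)
               (^-congˡ ℓ (trans (sum-const m 1#) (*-identityʳ _))))) ⟩
      fromℕ size * fromℕ (ℓ !) + fromℕ m ^ ℓ ∎
      where
      open ≤-Reasoning
      inclusion-exclusion : ∀ {P Q} → ind P + ind Q ≤ ind (Q × P) + 1#
      inclusion-exclusion {P} {Q} = ≤-by (*-nonneg (0≤y-x (ind≤1 P)) (0≤y-x (ind≤1 Q)))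
        (trans (solve 2 (λ p q → (con (+ 1) :- p) :* (con (+ 1) :- q) := (q :* p :+ con (+ 1)) :- (p :+ q))
          refl (ind P) (ind Q))
          (+-congʳ (+-congʳ (sym ind-×))))

  -- Rounding the variables down to multiples of δ loses at most ℓ δ = ε t of their
  -- sum.  Dividing the values by 1 - ε restores the threshold t, and multiplying
  -- the probabilities by 1 - ε then restores the mean.
  module FromIID {ℓ d : ℕ} (1≤d : 1 ℕ.≤ d) (i₀ : Fin ℓ) (𝒳 : NonNegativeIID ℓ) {ε : ℝ} (0<ε : 0# < ε)
    (ε<1 : ε < 1#) where

    open Tail 𝒳

    t e δ : ℝ
    t = fromℕ ℓ + fromℕ d
    e = 1# - ε
    δ = ε * t / fromℕ ℓ

    0<t : 0# < t
    0<t = <-≤-trans (fromℕ-pos 1≤d) (y≤x+y (fromℕ-nonneg ℓ))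
    0<e : 0# < e
    0<e = 0<y-x ε<1
    0<ℓ : 0# < fromℕ ℓ
    0<ℓ = fromℕ-pos (1≤ i₀)
      where
      1≤ : ∀ {n} → Fin n → 1 ℕ.≤ n
      1≤ {suc n} _ = s≤s z≤n
    0<δ : 0# < δ
    0<δ = /-pos (*-pos 0<ε 0<t) 0<ℓ

    N : ℕ
    N = proj₁ (archimedean (t / δ))

    t≤Nδ : t ≤ fromℕ N * δ
    t≤Nδ = ≤-resp (/-* 0<δ) refl (*-monoʳ-≤ δ (<⇒≤ 0<δ) (proj₂ (archimedean (t / δ))))

    open Grid δ 0<δ N using (point; point-nonneg)
    open Discretisation i₀ δ 0<δ N using (q; q-nonneg; sum-q; mean-q; tail≤)

    p : ℝ
    p = NonNegativeIID.tail 𝒳 t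

    y : Fin (suc N) → NonNegative
    y j = e ⁻¹ * point j , *-nonneg (<⇒≤ (⁻¹-pos 0<e)) (point-nonneg j)

    Good : Vec NonNegative ℓ → Set
    Good v = t ≤ sum (λ i → proj₁ (lookup v i))

    nearly⇒good : ∀ J → NearlyExceeds δ 0<δ N t J → Good (map y J)
    nearly⇒good J h = ≤-resp
      (trans (solve 3 (λ u e t → u :* (e :* t) := (e :* u) :* t) refl (e ⁻¹) e t)
        (trans (*-congʳ (x*x⁻¹≈1 0<e)) (*-identityˡ t)))
      (trans (*-distribˡ-sum (e ⁻¹) (λ i → point (lookup J i)))
        (sum-cong-≋ (λ i → reflexive (≡.cong proj₁ (≡.sym (lookup-map i y J))))))
      (*-monoˡ-≤ (e ⁻¹) (<⇒≤ (⁻¹-pos 0<e)) (≤-by (0≤y-x h)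
        (trans (+-congʳ (+-congˡ (trans (*-comm _ _) (/-* 0<ℓ))))
          (solve 3 (λ s ε t → (s :+ ε :* t) :- t := s :- (con (+ 1) :- ε) :* t) refl
            (sum (λ i → point (lookup J i))) ε t))))

    p≤good : p ≤ tupleSum q ℓ (λ J → ind (Good (map y J)))
    p≤good = ≤-trans (tail≤ t≤Nδ) (tupleSum-mono q-nonneg ℓ (λ J → ind-mono (nearly⇒good J)))

    -- One factor `e` compensates for the enlarged values `y`, so that the total weight stays at
    -- most m; the second, in the lower bound, pays for rounding to integers.
    Multiplicities : ℕ → Set
    Multiplicities m = ∀ j → ∃[ a ] (e * e * q j * fromℕ m ≤ fromℕ a × fromℕ a ≤ e * q j * fromℕ m)

    -- In the error constant, 2 ℓ is the loss in the ℓ-th power of e², and 1 accounts for tuples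
    -- with repeated entries.
    Dense : ℕ → Set
    Dense m = Σ[ H ∈ Hypergraph ℓ m ] (¬ HasMatchingOfSize H (matchingSize ℓ d m) ×
      (p - (fromℕ ℓ * fromℕ 2 + 1#) * ε) * fromℕ m ^ ℓ ≤ fromℕ (Hypergraph.size H) * fromℕ (ℓ !))

    module _ (m : ℕ) (multiplicities : Multiplicities m)
      (asymptotics : e * fromℕ (m ℕ.+ 0) ^ ℓ ≤ fromℕ (falling m ℓ)) where

      a : Fin (suc N) → ℕ
      a j = proj₁ (multiplicities j)

      a-lower : ∀ j → e * e * q j * fromℕ m ≤ fromℕ (a j)
      a-lower j = proj₁ (proj₂ (multiplicities j))

      a-upper : ∀ j → fromℕ (a j) ≤ e * q j * fromℕ m
      a-upper j = proj₂ (proj₂ (multiplicities j))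

      0≤m : 0# ≤ fromℕ m
      0≤m = fromℕ-nonneg m

      sum-a : sum (λ j → fromℕ (a j)) ≤ fromℕ m
      sum-a = begin
        sum (λ j → fromℕ (a j))           ≤⟨ sum-mono a-upper ⟩
        sum (λ j → e * q j * fromℕ m)     ≈⟨ *-distribʳ-sum (fromℕ m) (λ j → e * q j) ⟨
        sum (λ j → e * q j) * fromℕ m
          ≈⟨ *-congʳ (trans (sym (*-distribˡ-sum e q)) (trans (*-congˡ sum-q) (*-identityʳ e))) ⟩
        e * fromℕ m                       ≤⟨ *-monoʳ-≤ (fromℕ m) 0≤m (x-y≤x (<⇒≤ 0<ε)) ⟩
        1# * fromℕ m                      ≈⟨ *-identityˡ _ ⟩
        fromℕ m                           ∎
        where open ≤-Reasoning

      placement : Places a y (0# , ≤-refl) m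
      placement = places (suc N) a y (0# , ≤-refl) m sum-a

      τ : Fin m → NonNegative
      τ = proj₁ placement

      c : Fin m → ℝ
      c v = proj₁ (τ v)

      sum-c : sum c ≤ fromℕ m
      sum-c = begin
        sum c
          ≈⟨ proj₂ (proj₂ placement) proj₁ ⟩
        sum (λ j → fromℕ (a j) * (e ⁻¹ * point j)) + fromℕ (proj₁ (proj₂ placement)) * 0#
          ≈⟨ trans (+-congˡ (zeroʳ _)) (+-identityʳ _) ⟩
        sum (λ j → fromℕ (a j) * (e ⁻¹ * point j))
          ≤⟨ sum-mono (λ j → *-monoʳ-≤ (e ⁻¹ * point j) (proj₂ (y j)) (a-upper j)) ⟩
        sum (λ j → (e * q j * fromℕ m) * (e ⁻¹ * point j))
          ≈⟨ sum-cong-≋ (λ j → trans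
               (solve 5 (λ e q m u x → (e :* q :* m) :* (u :* x) := (e :* u) :* (m :* (q :* x))) refl e
                 (q j) (fromℕ m) (e ⁻¹) (point j))
               (trans (*-congʳ (x*x⁻¹≈1 0<e)) (*-identityˡ _))) ⟩
        sum (λ j → fromℕ m * (q j * point j))
          ≈⟨ *-distribˡ-sum (fromℕ m) (λ j → q j * point j) ⟨
        fromℕ m * sum (λ j → q j * point j)
          ≤⟨ *-monoˡ-≤ (fromℕ m) 0≤m mean-q ⟩
        fromℕ m * 1#
          ≈⟨ *-identityʳ _ ⟩
        fromℕ m ∎
        where open ≤-Reasoning

      open HeavyHypergraph ℓ d m 1≤d c (λ v → proj₂ (τ v)) sum-c

      -- The weights pass from probabilities to multiplicities, and then to single vertices with the
      -- same values; the padding vertices can only enlarge the count.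
      count-heavy≥ : (e * e * fromℕ m) ^ ℓ * p ≤ count ℓ Heavy
      count-heavy≥ = begin
        (e * e * fromℕ m) ^ ℓ * p
          ≤⟨ *-monoˡ-≤ _ (^-nonneg ℓ (*-nonneg (*-nonneg (<⇒≤ 0<e) (<⇒≤ 0<e)) 0≤m)) p≤good ⟩
        (e * e * fromℕ m) ^ ℓ * tupleSum q ℓ (λ J → ind (Good (map y J)))
          ≈⟨ tupleSum-scale {q = q} ℓ (e * e * fromℕ m) (λ J → ind (Good (map y J))) ⟨
        tupleSum (λ j → (e * e * fromℕ m) * q j) ℓ (λ J → ind (Good (map y J)))
          ≤⟨ tupleSum-mono-weights (λ j → *-nonneg (*-nonneg (*-nonneg (<⇒≤ 0<e) (<⇒≤ 0<e)) 0≤m) (q-nonneg j))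
               (λ j → ≤-resp (solve 3 (λ e q m → e :* e :* q :* m := (e :* e :* m) :* q) refl e (q j)
                 (fromℕ m)) refl (a-lower j))
               ℓ (λ J → ind-nonneg (Good (map y J))) ⟩
        tupleSum (λ j → fromℕ (a j)) ℓ (λ J → ind (Good (map y J)))
          ≤⟨ tupleSum-push y τ (λ j → fromℕ-nonneg (a j)) (λ _ → 0≤1) dominated ℓ (λ v → ind (Good v))
            (λ v → ind-nonneg (Good v)) ⟩
        tupleSum ones ℓ (λ ω → ind (Good (map τ ω)))
          ≤⟨ tupleSum-mono (λ _ → 0≤1) ℓ
            (λ ω → ind-mono (≤-resp refl (sum-cong-≋ (λ i → reflexive (≡.cong proj₁ (lookup-map i τ ω)))))) ⟩
        count ℓ Heavy ∎
        where
        open ≤-Reasoning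
        dominated : (f : NonNegative → ℝ) → (∀ s → 0# ≤ f s) →
          sum (λ j → fromℕ (a j) * f (y j)) ≤ sum (λ v → ones v * f (τ v))
        dominated f 0≤f = ≤-trans
          (x≤x+y (*-nonneg (fromℕ-nonneg (proj₁ (proj₂ placement))) (0≤f (0# , ≤-refl))))
          (≤-reflexive (trans (sym (proj₂ (proj₂ placement) f))
            (sum-cong-≋ (λ v → sym (*-identityˡ (f (τ v)))))))

      0≤p : 0# ≤ p
      0≤p = NonNegativeIID.Pr-nonneg 𝒳 (exceeds-event t)

      -- Bernoulli's inequality for 1 - e², which is 2 ε - ε².
      power-bound : 1# - fromℕ ℓ * (fromℕ 2 * ε) ≤ (e * e) ^ ℓ
      power-bound = ≤-trans (≤-by (*-nonneg (fromℕ-nonneg ℓ) (0≤x² ε))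
          (solve 2 (λ l ε → l :* (ε :* ε) :=
            (con (+ 1) :- l :* (con (+ 1) :- (con (+ 1) :- ε) :* (con (+ 1) :- ε))) :-
            (con (+ 1) :- l :* (con (+ 2) :* ε))) refl (fromℕ ℓ) ε))
        (≤-trans (bernoulli ℓ (0≤y-x e²≤1) (x-y≤x (*-nonneg (<⇒≤ 0<e) (<⇒≤ 0<e))))
          (≤-reflexive (^-congˡ ℓ (solve 1 (λ e → con (+ 1) :- (con (+ 1) :- e :* e) := e :* e) refl e))))
        where
        e≤1 : e ≤ 1#
        e≤1 = x-y≤x (<⇒≤ 0<ε)
        e²≤1 : e * e ≤ 1#
        e²≤1 = ≤-resp refl (*-identityˡ 1#) (*-mono-≤ (<⇒≤ 0<e) 0≤1 e≤1 e≤1)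

      edges-lower : (p - (fromℕ ℓ * fromℕ 2 + 1#) * ε) * fromℕ m ^ ℓ ≤
        fromℕ (Hypergraph.size graph) * fromℕ (ℓ !)
      edges-lower = begin
        (p - (l * fromℕ 2 + 1#) * ε) * P
          ≈⟨ solve 4 (λ p l ε P → (p :- (l :* con (+ 2) :+ con (+ 1)) :* ε) :* P :=
            (p :- l :* (con (+ 2) :* ε)) :* P :- ε :* P) refl p l ε P ⟩
        (p - l * (fromℕ 2 * ε)) * P - ε * P
          ≤⟨ +-monoˡ-≤ (- (ε * P)) (≤-trans main-term count-bound) ⟩
        (S + ε * P) - ε * P
          ≈⟨ solve 2 (λ S x → (S :+ x) :- x := S) refl S (ε * P) ⟩
        S ∎
        where
        open ≤-Reasoning
        P S W l : ℝ
        P = fromℕ m ^ ℓ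
        S = fromℕ (Hypergraph.size graph) * fromℕ (ℓ !)
        W = (e * e) ^ ℓ
        l = fromℕ ℓ
        0≤P : 0# ≤ P
        0≤P = ^-nonneg ℓ 0≤m
        asymptotics′ : e * P ≤ fromℕ (falling m ℓ)
        asymptotics′ = ≤-resp (*-congˡ (^-congˡ ℓ (fromℕ-cong (ℕₚ.+-identityʳ m)))) refl asymptotics
        -- Here p ≤ 1 serves to replace the relative error p · 2 ℓ ε by an absolute one.
        main-term : (p - l * (fromℕ 2 * ε)) * P ≤ (W * P) * p
        main-term = ≤-by
          (*-nonneg 0≤P (+-nonneg (*-nonneg 0≤p (0≤y-x power-bound))
            (*-nonneg (*-nonneg (fromℕ-nonneg ℓ) (*-nonneg (fromℕ-nonneg 2) (<⇒≤ 0<ε))) (0≤y-x (tail≤1 t)))))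
          (solve 4 (λ P p W x → P :* (p :* (W :- (con (+ 1) :- x)) :+ x :* (con (+ 1) :- p)) :=
            (W :* P) :* p :- (p :- x) :* P)
            refl P p W (l * (fromℕ 2 * ε)))
        count-bound : (W * P) * p ≤ S + ε * P
        count-bound = ≤-by
          (0≤y-x (≤-trans (+-mono-≤ (≤-resp (*-congʳ (^-distrib-* (e * e) (fromℕ m) ℓ)) refl count-heavy≥)
            asymptotics′) count-heavy≤))
          (solve 4 (λ x ε P S → (S :+ P) :- (x :+ (con (+ 1) :- ε) :* P) := (S :+ ε :* P) :- x) refl
            ((W * P) * p) ε P S)

      dense : Dense m
      dense = graph , unmatched , edges-lower

    eventually-dense : Eventually Dense
    eventually-dense = eventually-map (λ m (multiplicities , asymptotics) → dense m multiplicities asymptotics)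
      (eventually-× (eventually-Fin (λ j → eventually-integer (q-nonneg j) 0<ε ε<1))
                    (falling-asymptotics 0 ℓ 0<ε (<⇒≤ ε<1)))

  -- The limit superior

  -- Excluded middle makes every proposition equivalent to a small one, so that
  -- suprema of large predicates exist.
  Resized : ∀ {a} → Set a → Set
  Resized P = T (does (em {P = P}))

  resize : ∀ {a} {P : Set a} → P → Resized P
  resize {P = P} p with em {P = P}
  ... | yes _ = tt
  ... | no ¬p = ⊥-elim (¬p p)

  unresize : ∀ {a} {P : Set a} → Resized P → P
  unresize {P = P} r with em {P = P}
  ... | yes p = p

  supremum-large : ∀ {a} (S : ℝ → Set a) → ∃ S → ∀ {b} → IsUpperBound S b → ∃[ x ] IsSupremum S x
  supremum-large S (y , y∈S) {b} bound =
    let (x , upper , least) = supremum (λ y → Resized (S y)) (y , resize y∈S) (b , λ r → bound (unresize r)) in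
    x , (λ y∈S → upper (resize y∈S)) , λ bound′ → least (λ r → bound′ (unresize r))

  least-natural : ∀ {P : ℕ → Set} n → P n → ∃[ k ] (k ℕ.≤ n × P k × (∀ j → P j → k ℕ.≤ j))
  least-natural {P} n pn = [ (λ none → n , ℕₚ.≤-refl , pn , λ j pj → ℕₚ.≮⇒≥ (λ j<n → none j j<n pj)) ,
    (λ x → x) ]′ (search n ℕₚ.≤-refl)
    where
    search : ∀ b → b ℕ.≤ n → (∀ j → j ℕ.< b → ¬ P j) ⊎ ∃[ k ] (k ℕ.≤ n × P k × (∀ j → P j → k ℕ.≤ j))
    search zero    _   = inj₁ λ _ ()
    search (suc b) b<n with search b (ℕₚ.<⇒≤ b<n)
    ... | inj₂ found = inj₂ found
    ... | inj₁ none with em {P = P b}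
    ...   | yes pb = inj₂ (b , ℕₚ.<⇒≤ b<n , pb , λ j pj → ℕₚ.≮⇒≥ (λ j<b → none j j<b pj))
    ...   | no ¬pb = inj₁ λ j j<1+b pj → [ (λ j<b → none j j<b pj) ,
      (λ { ≡.refl → ¬pb pj }) ]′ (ℕₚ.m<1+n⇒m<n∨m≡n j<1+b)

  falling-pos : ∀ {n k} → k ℕ.≤ n → 0 ℕ.< falling n k
  falling-pos z≤n                = s≤s z≤n
  falling-pos {suc n} (s≤s k≤n) = ℕₚ.<-≤-trans (falling-pos k≤n) (ℕₚ.m≤m+n _ _)

  x≤x^n : ∀ {n x} → 1 ℕ.≤ n → 1# ≤ x → x ≤ x ^ n
  x≤x^n {suc n} {x} _ 1≤x = ≤-resp (*-identityʳ x) refl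
    (*-monoˡ-≤ x (≤-trans 0≤1 1≤x) (≤-resp (1^ n) refl (^-mono n 0≤1 1≤x)))

  module _ (ℓ d : ℕ) (1≤ℓ : 1 ℕ.≤ ℓ) (1≤d : 1 ℕ.≤ d) where

    t : ℝ
    t = fromℕ ℓ + fromℕ d

    Tails : ℝ → Set _
    Tails p = Σ[ 𝒳 ∈ NonNegativeIID ℓ ] p ≈ NonNegativeIID.tail 𝒳 t

    -- The constant variables 1 show that the set of tails is inhabited and that its supremum is
    -- non-negative.
    some-iid : NonNegativeIID ℓ
    some-iid = FiniteProduct.iid {1} ℓ (λ _ → 1#) (λ _ → 1#) (λ _ → 0≤1) (+-identityʳ 1#) (λ _ → 0≤1)
      (trans (+-identityʳ _) (*-identityʳ 1#))

    Θ : ∃[ x ] IsΘ ℓ (fromℕ d) x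
    Θ = supremum-large Tails (_ , some-iid , refl)
      λ { (𝒳 , p≈) → ≤-trans (≤-reflexive p≈) (Tail.tail≤1 𝒳 t) }

    θ : ℝ
    θ = proj₁ Θ

    tail≤θ : ∀ 𝒳 → NonNegativeIID.tail 𝒳 t ≤ θ
    tail≤θ 𝒳 = proj₁ (proj₂ Θ) (𝒳 , refl)

    0≤θ : 0# ≤ θ
    0≤θ = ≤-trans (NonNegativeIID.Pr-nonneg some-iid (Tail.exceeds-event some-iid t)) (tail≤θ some-iid)

    Forced : ℕ → ℕ → Set
    Forced m = Forces (matchingSize ℓ d m) ℓ m

    -- No ℓ-graph has more than `m C ℓ` edges, so one edge more forces a matching vacuously and the
    -- minimum exists.
    f₀-exists : ∀ {m} → ℓ ℕ.≤ m → ∃[ M ] (M ℕ.≤ suc (m C ℓ) × Isf₀ (matchingSize ℓ d m) ℓ m M)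
    f₀-exists {m} ℓ≤m = let (M , M≤ , forces , least) = least-natural {Forced m} (suc (m C ℓ))
                                  (λ H C<size → ⊥-elim (ℕₚ.<⇒≱ C<size (size≤C H ℓ≤m))) in
      M , M≤ , forces , least

    f₀-total : ∀ m → ∃[ M ] (M ℕ.≤ suc (m C ℓ) × (ℓ ℕ.≤ m → Isf₀ (matchingSize ℓ d m) ℓ m M))
    f₀-total m with ℓ ℕₚ.≤? m
    ... | yes ℓ≤m = let (M , M≤ , isf₀) = f₀-exists ℓ≤m in M , M≤ , λ _ → isf₀
    -- Below ℓ the binomial coefficient vanishes and its inverse is unspecified; the value 0 makes
    -- the ratio 0 all the same.
    ... | no ℓ≰m  = 0 , z≤n , λ ℓ≤m → ⊥-elim (ℓ≰m ℓ≤m)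

    g : ℕ → ℕ
    g m = proj₁ (f₀-total m)

    g-isf₀ : ∀ m → ℓ ℕ.≤ m → Isf₀ (matchingSize ℓ d m) ℓ m (g m)
    g-isf₀ m = proj₂ (proj₂ (f₀-total m))

    ratio : ℕ → ℝ
    ratio m = fromℕ (g m) / fromℕ (m C ℓ)

    C*!≈falling : ∀ {m} → ℓ ℕ.≤ m → fromℕ (m C ℓ) * fromℕ (ℓ !) ≈ fromℕ (falling m ℓ)
    C*!≈falling {m} ℓ≤m = trans (sym (fromℕ-* (m C ℓ) (ℓ !))) (fromℕ-cong (≡.sym (falling≡C*! ℓ≤m)))

    0<! : 0# < fromℕ (ℓ !)
    0<! = fromℕ-pos (ℕₚ.1≤n! ℓ)

    C-pos : ∀ {m} → ℓ ℕ.≤ m → 0# < fromℕ (m C ℓ)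
    C-pos {m} ℓ≤m = ≰⇒> (λ C≤0 → <⇒≱ (fromℕ-pos (falling-pos ℓ≤m))
      (≤-resp (C*!≈falling ℓ≤m) (zeroˡ _) (*-monoʳ-≤ (fromℕ (ℓ !)) (<⇒≤ 0<!) C≤0)))

    ratio-nonneg : ∀ {m} → ℓ ℕ.≤ m → 0# ≤ ratio m
    ratio-nonneg {m} ℓ≤m = /-nonneg (fromℕ-nonneg (g m)) (C-pos ℓ≤m)

    g-below : ∀ m → ¬ (ℓ ℕ.≤ m) → g m ≡ 0
    g-below m ℓ≰m with ℓ ℕₚ.≤? m
    ... | yes ℓ≤m = ⊥-elim (ℓ≰m ℓ≤m)
    ... | no _    = ≡.refl

    -- The bound C + 1 for f₀ is at most 2 C because C ≥ 1. It makes the suprema in the limsup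
    -- finite.
    ratio≤2 : ∀ m → ratio m ≤ fromℕ 2
    ratio≤2 m = [ (λ m<ℓ → ≤-trans
      (≤-reflexive (trans (*-congʳ (fromℕ-cong (g-below m (ℕₚ.<⇒≱ m<ℓ)))) (zeroˡ _))) (fromℕ-nonneg 2))
                , main ]′ (ℕₚ.<-≤-connex m ℓ)
      where
      main : ℓ ℕ.≤ m → ratio m ≤ fromℕ 2
      main ℓ≤m = /-≤ (C-pos ℓ≤m) (≤-trans
        (fromℕ-mono {g m} {m C ℓ ℕ.+ m C ℓ}
          (ℕₚ.≤-trans (proj₁ (proj₂ (f₀-total m))) (ℕₚ.+-monoˡ-≤ (m C ℓ) 1≤C)))
        (≤-reflexive (trans (fromℕ-+ (m C ℓ) (m C ℓ))
          (solve 1 (λ c → c :+ c := con (+ 2) :* c) refl (fromℕ (m C ℓ))))))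
        where
        1≤C : 1 ℕ.≤ m C ℓ
        1≤C = ℕₚ.n≢0⇒n>0 (λ C≡0 → <⇒≱ (C-pos ℓ≤m) (≤-reflexive (fromℕ-cong C≡0)))

    module _ {ε : ℝ} (0<ε : 0# < ε) (ε<1 : ε < 1#) where

      0<1-ε : 0# < 1# - ε
      0<1-ε = 0<y-x ε<1

      -- The last condition absorbs the off-by-one between f₀ and the size of an unmatched
      -- hypergraph.
      Asymptotic : ℕ → Set
      Asymptotic m = ℓ ℕ.≤ m × (1# - ε) * fromℕ (m ℕ.+ d) ^ ℓ ≤ fromℕ (falling m ℓ) × 1# ≤ ε * fromℕ (m C ℓ)

      -- For the last condition linear growth suffices: ℓ! `m C ℓ` is at least (1 - ε)(m + d)^ℓ,
      -- hence at least (1 - ε) m since ℓ ≥ 1.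
      eventually-asymptotic : Eventually Asymptotic
      eventually-asymptotic = eventually-map conclude
        (eventually-× (eventually-≥ ℓ) (eventually-× (falling-asymptotics d ℓ 0<ε (<⇒≤ ε<1))
          (eventually-large (*-pos 0<ε 0<1-ε) (fromℕ (ℓ !)))))
        where
        conclude : ∀ m →
          ℓ ℕ.≤ m × (1# - ε) * fromℕ (m ℕ.+ d) ^ ℓ ≤ fromℕ (falling m ℓ) × fromℕ (ℓ !) ≤ ε * (1# - ε) * fromℕ m →
          Asymptotic m
        conclude m (ℓ≤m , bound , large) = ℓ≤m , bound , *-cancelˡ-≤ 0<! (begin
          fromℕ (ℓ !) * 1#                            ≈⟨ *-identityʳ _ ⟩
          fromℕ (ℓ !)                                 ≤⟨ large ⟩
          ε * (1# - ε) * fromℕ m                      ≈⟨ *-assoc _ _ _ ⟩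
          ε * ((1# - ε) * fromℕ m)                    ≤⟨ *-monoˡ-≤ ε (<⇒≤ 0<ε)
            (≤-trans (*-monoˡ-≤ (1# - ε) (<⇒≤ 0<1-ε) m≤) bound) ⟩
          ε * fromℕ (falling m ℓ)                     ≈⟨ *-congˡ (C*!≈falling ℓ≤m) ⟨
          ε * (fromℕ (m C ℓ) * fromℕ (ℓ !))           ≈⟨ solve 3
            (λ e c f → e :* (c :* f) := f :* (e :* c)) refl ε (fromℕ (m C ℓ)) (fromℕ (ℓ !)) ⟩
          fromℕ (ℓ !) * (ε * fromℕ (m C ℓ))           ∎)
          where
          open ≤-Reasoning
          m≤ : fromℕ m ≤ fromℕ (m ℕ.+ d) ^ ℓ
          m≤ = ≤-trans (fromℕ-mono (ℕₚ.m≤m+n m d))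
            (x≤x^n 1≤ℓ (≤-trans (≤-reflexive (sym (+-identityʳ 1#)))
              (fromℕ-mono {1} (ℕₚ.≤-trans 1≤d (ℕₚ.m≤n+m d m)))))

      -- Duality bounds (1 - ε) |E| by θ C. Adding ε |E| ≤ ε C removes the factor without a
      -- division.
      unmatched-size : ∀ {m} → Asymptotic m → (H : Hypergraph ℓ m) →
        ¬ HasMatchingOfSize H (matchingSize ℓ d m) →
        fromℕ (Hypergraph.size H) ≤ (θ + ε) * fromℕ (m C ℓ)
      unmatched-size {m} (ℓ≤m , bound , _) H unmatched = ≤-by
        (+-nonneg (0≤y-x scaled) (*-nonneg (<⇒≤ 0<ε) (0≤y-x (fromℕ-mono (size≤C H ℓ≤m)))))
        (solve 4 (λ θ C ε s → (θ :* C :- (con (+ 1) :- ε) :* s) :+ ε :* (C :- s) := (θ :+ ε) :* C :- s) refl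
          θ (fromℕ (m C ℓ)) ε size)
        where
        size = fromℕ (Hypergraph.size H)
        dual = unmatched⇒iid 1≤ℓ 1≤d H unmatched
        M^ℓ = fromℕ (m ℕ.+ d) ^ ℓ
        scaled : (1# - ε) * size ≤ θ * fromℕ (m C ℓ)
        scaled = *-cancelˡ-≤ 0<! (begin
          fromℕ (ℓ !) * ((1# - ε) * size)       ≈⟨ solve 3 (λ f e s → f :* (e :* s) := e :* (s :* f)) refl
            (fromℕ (ℓ !)) (1# - ε) size ⟩
          (1# - ε) * (size * fromℕ (ℓ !))       ≤⟨ *-monoˡ-≤ (1# - ε) (<⇒≤ 0<1-ε) (≤-trans (proj₂ dual)
                                                     (*-monoʳ-≤ M^ℓ (^-nonneg ℓ (fromℕ-nonneg (m ℕ.+ d)))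
                                                       (tail≤θ (proj₁ dual)))) ⟩
          (1# - ε) * (θ * M^ℓ)                  ≈⟨ solve 3 (λ e θ p → e :* (θ :* p) := θ :* (e :* p)) refl
            (1# - ε) θ M^ℓ ⟩
          θ * ((1# - ε) * M^ℓ)                  ≤⟨ *-monoˡ-≤ θ 0≤θ bound ⟩
          θ * fromℕ (falling m ℓ)               ≈⟨ *-congˡ (C*!≈falling ℓ≤m) ⟨
          θ * (fromℕ (m C ℓ) * fromℕ (ℓ !))     ≈⟨ solve 3 (λ θ c f → θ :* (c :* f) := f :* (θ :* c)) refl θ
            (fromℕ (m C ℓ)) (fromℕ (ℓ !)) ⟩
          fromℕ (ℓ !) * (θ * fromℕ (m C ℓ))     ∎)
          where open ≤-Reasoning

      not-forced : ∀ {m M} → ¬ Forced m M →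
        Σ[ H ∈ Hypergraph ℓ m ] (M ℕ.≤ Hypergraph.size H × ¬ HasMatchingOfSize H (matchingSize ℓ d m))
      not-forced {m} {M} ¬forced with em
        {P = Σ[ H ∈ Hypergraph ℓ m ] (M ℕ.≤ Hypergraph.size H × ¬ HasMatchingOfSize H (matchingSize ℓ d m))}
      ... | yes found = found
      ... | no ¬found = ⊥-elim (¬forced forced)
        where
        forced : Forced m M
        forced H M≤size with em {P = HasMatchingOfSize H (matchingSize ℓ d m)}
        ... | yes matched  = matched
        ... | no unmatched = ⊥-elim (¬found (H , M≤size , unmatched))

      -- By minimality the predecessor of f₀ is not forced, so some unmatched hypergraph has at
      -- least that many edges. Its size costs one ε, the missing edge another.
      f₀-upper : ∀ {m} M → Asymptotic m → Isf₀ (matchingSize ℓ d m) ℓ m M →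
        fromℕ M ≤ (θ + fromℕ 2 * ε) * fromℕ (m C ℓ)
      f₀-upper {m} zero    _ _ =
        *-nonneg (+-nonneg 0≤θ (*-nonneg (fromℕ-nonneg 2) (<⇒≤ 0<ε))) (fromℕ-nonneg (m C ℓ))
      f₀-upper {m} (suc h) asymptotic (_ , least) = begin
        1# + fromℕ h
          ≤⟨ +-mono-≤ (proj₂ (proj₂ asymptotic))
               (≤-trans (fromℕ-mono (proj₁ (proj₂ witness)))
                 (unmatched-size asymptotic (proj₁ witness) (proj₂ (proj₂ witness)))) ⟩
        ε * fromℕ (m C ℓ) + (θ + ε) * fromℕ (m C ℓ)
          ≈⟨ solve 3 (λ ε θ c → ε :* c :+ (θ :+ ε) :* c := (θ :+ con (+ 2) :* ε) :* c) refl ε θ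
            (fromℕ (m C ℓ)) ⟩
        (θ + fromℕ 2 * ε) * fromℕ (m C ℓ) ∎
        where
        open ≤-Reasoning
        witness : Σ[ H ∈ Hypergraph ℓ m ] (h ℕ.≤ Hypergraph.size H × ¬ HasMatchingOfSize H (matchingSize ℓ d m))
        witness = not-forced (λ forced → ℕₚ.<-irrefl ≡.refl (least h forced))

      ratio-upper : ∀ {m} → Asymptotic m → ratio m ≤ θ + fromℕ 2 * ε
      ratio-upper {m} asymptotic@(ℓ≤m , _) = /-≤ (C-pos ℓ≤m) (f₀-upper (g m) asymptotic (g-isf₀ m ℓ≤m))

      module _ (𝒳 : NonNegativeIID ℓ) where

        open FromIID {ℓ} {d} 1≤d (fromℕ< 1≤ℓ) 𝒳 0<ε ε<1 using (Dense; eventually-dense)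

        K : ℝ
        K = fromℕ ℓ * fromℕ 2 + 1#

        -- An unmatched hypergraph has fewer than f₀ edges. Replacing m^ℓ by the smaller falling
        -- factorial preserves the bound only for p > 0; for p ≤ 0 non-negativity of the ratio
        -- suffices.
        ratio-lower : ∀ {m} → ℓ ℕ.≤ m → Dense m → NonNegativeIID.tail 𝒳 t ≤ ratio m + K * ε
        ratio-lower {m} ℓ≤m (H , unmatched , many) = ≤-by
          (0≤y-x ([ (λ p≤0 → ≤-trans p≤0 (ratio-nonneg ℓ≤m)) , positive ]′ (p ≤? 0#)))
          (solve 3 (λ r P x → r :- (P :- x) := (r :+ x) :- P) refl (ratio m) (NonNegativeIID.tail 𝒳 t) (K * ε))
          where
          p : ℝ
          p = NonNegativeIID.tail 𝒳 t - K * ε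
          size<g : Hypergraph.size H ℕ.< g m
          size<g = ℕₚ.≰⇒> (λ g≤size → unmatched (proj₁ (g-isf₀ m ℓ≤m) H g≤size))
          positive : 0# < p → p ≤ ratio m
          positive 0<p = ≤-/ (C-pos ℓ≤m) (*-cancelˡ-≤ 0<! (begin
            fromℕ (ℓ !) * (p * fromℕ (m C ℓ))             ≈⟨ solve 3
              (λ f p c → f :* (p :* c) := p :* (c :* f)) refl (fromℕ (ℓ !)) p (fromℕ (m C ℓ)) ⟩
            p * (fromℕ (m C ℓ) * fromℕ (ℓ !))             ≈⟨ *-congˡ (C*!≈falling ℓ≤m) ⟩
            p * fromℕ (falling m ℓ)                       ≤⟨ *-monoˡ-≤ p (<⇒≤ 0<p)
              (≤-resp refl (fromℕ-^ m ℓ) (fromℕ-mono (falling≤^ m ℓ))) ⟩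
            p * fromℕ m ^ ℓ                               ≤⟨ many ⟩
            fromℕ (Hypergraph.size H) * fromℕ (ℓ !)
              ≤⟨ *-monoʳ-≤ (fromℕ (ℓ !)) (<⇒≤ 0<!) (fromℕ-mono (ℕₚ.<⇒≤ size<g)) ⟩
            fromℕ (g m) * fromℕ (ℓ !)                     ≈⟨ *-comm _ _ ⟩
            fromℕ (ℓ !) * fromℕ (g m)                     ∎))
            where open ≤-Reasoning

        frequently-large : ∀ n → ∃[ m ] (n ℕ.≤ m × NonNegativeIID.tail 𝒳 t ≤ ratio m + K * ε)
        frequently-large n = let (m₀ , h) = eventually-× (eventually-≥ n) (eventually-× (eventually-≥ ℓ) eventually-dense)
                                 (n≤m , ℓ≤m , dense) = h m₀ ℕₚ.≤-refl in
          m₀ , n≤m , ratio-lower ℓ≤m dense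

    TailRatios : ℕ → ℝ → Set
    TailRatios n y = ∃[ m ] (n ℕ.≤ m × y ≈ ratio m)

    tail-supremum : ∀ n → ∃[ x ] IsSupremum (TailRatios n) x
    tail-supremum n = supremum (TailRatios n) (ratio n , n , ℕₚ.≤-refl , refl)
      (fromℕ 2 , λ (m , _ , y≈) → ≤-trans (≤-reflexive y≈) (ratio≤2 m))

    -- Dense unmatched hypergraphs exist for arbitrarily large m, so each tail probability is at
    -- most every supremum `s n` up to K ε; from some n on all ratios are at most θ + 2 ε. Both
    -- errors vanish with ε.
    limsup : IsLimSup ratio θ
    limsup = (λ n → proj₁ (tail-supremum n)) , (λ n → proj₂ (tail-supremum n)) , below , greatest
      where
      s : ℕ → ℝ
      s n = proj₁ (tail-supremum n)
      ratio≤s : ∀ {n m} → n ℕ.≤ m → ratio m ≤ s n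
      ratio≤s {n} {m} n≤m = proj₁ (proj₂ (tail-supremum n)) (m , n≤m , refl)
      θ≤s : ∀ n → θ ≤ s n
      θ≤s n = proj₂ (proj₂ Θ) λ (𝒳 , p≈) → ≤-trans (≤-reflexive p≈)
        (≤-from-approximations (fromℕ ℓ * fromℕ 2 + 1#)
          (+-nonneg (*-nonneg (fromℕ-nonneg ℓ) (fromℕ-nonneg 2)) 0≤1)
          (λ ε 0<ε ε<1 → let (m , n≤m , h) = frequently-large 0<ε ε<1 𝒳 n in
            ≤-trans h (+-monoˡ-≤ _ (ratio≤s n≤m))))
      below : ∀ {y} → ∃[ n ] y ≈ s n → θ ≤ y
      below (n , y≈) = ≤-trans (θ≤s n) (≤-reflexive (sym y≈))
      greatest : ∀ {y} → (∀ {z} → ∃[ n ] z ≈ s n → y ≤ z) → y ≤ θ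
      greatest h = ≤-from-approximations (fromℕ 2) (fromℕ-nonneg 2) (λ ε 0<ε ε<1 →
        let (n , asymptotic) = eventually-asymptotic 0<ε ε<1 in
        ≤-trans (h (n , refl)) (proj₂ (proj₂ (tail-supremum n)) λ (m , n≤m , y≈) →
          ≤-trans (≤-reflexive y≈) (ratio-upper 0<ε ε<1 (asymptotic m n≤m))))

    main : ∃[ x ] (Isf ℓ d x × IsΘ ℓ (fromℕ d) x)
    main = θ , (g , g-isf₀ , limsup) , proj₂ Θ

open import Data.Nat.Base using (_≤_)

theorem1p14 : (∀ {a} → ExcludedMiddle a) → (R : CompleteOrderedField) →
    ∀ ℓ d → 1 ≤ ℓ → 1 ≤ d →
    ∃[ x ] (FractionalMatchings.Isf R ℓ d x × Probability.IsΘ R ℓ (Reals.fromℕ R d) x)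
theorem1p14 em R = Proof.main em R
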